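{- Let $p \equiv 3 \pmod 4$ be a prime, $s$ a positive integer, $q=p^{2s}$, and $g$ a primitive root of $\mathbb{F}_q$. For $j \in \{0,1,2,3\}$ let $B_j=\{g^{4k+j}: 1 \leq k \leq \frac{q-1}{4}\}$. If $p \equiv 7 \pmod 8$ and $s$ is odd, let $B=B_1 \cup B_2$; if $p \equiv 3 \pmod 8$ or $s$ is even, let $B=B_0 \cup B_3$. If $A$ is a clique in the Peisert graph $P_q^*$ (constructed with the primitive root $g$), then $|A| \leq \sqrt{q}$; moreover, $|A|=\sqrt{q}$ if and only if $\sum_{a \in A} e_p\big(\operatorname{Tr}(ac)\big)=0$ for all $c \in B$.
   Context: The Peisert graph $P_q^*$ (for $q=p^{2s}$, $p\equiv 3 \pmod 4$, with primitive root $g$ of $\mathbb{F}_q$) has vertex set $\mathbb{F}_q$, two distinct vertices being adjacent iff their difference lies in $M_q=\{g^j: j \equiv 0,1 \pmod 4\}$. $\operatorname{Tr}$ is the absolute trace $\mathbb{F}_q\to\mathbb{F}_p$ and $e_p(x)=e^{2\pi i x/p}$ for $x \in \mathbb{F}_p$.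
   Formalization: The equivalence is stated for nonempty cliques A only, since for A empty all the sums vanish while |A| = 0 is not √q; the bound |A| ≤ √q is stated for every clique. -}

module Defs where

open import Algebra.Bundles using (CommutativeRing; Semiring)
import Algebra.Definitions
import Algebra.Definitions.RawSemiring as RawSemiringDefs
open import Data.Fin.Base using (Fin; toℕ)
open import Data.Fin.Properties using (any?) renaming (_≟_ to _≟ᶠ_)
open import Data.List.Base using (List; map; foldr; upTo)
import Data.List.Membership.Setoid as Membership
import Data.List.Relation.Unary.Unique.Setoid as UniqueSetoid
open import Data.Nat.Base as ℕ using (ℕ; suc)
open import Data.Nat.DivMod using (_/_; _%_)
open import Data.Product.Base using (_×_; _,_; ∃-syntax)
open import Data.Sum.Base using (_⊎_)
open import Function.Bundles using (Inverse)
open import Function.Properties.Inverse using (Inverse⇒Injection)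
open import Level using (Level; _⊔_) renaming (suc to lsuc)
open import Relation.Binary.Definitions using (Decidable)
open import Relation.Binary.PropositionalEquality.Core using (_≡_)
open import Relation.Binary.PropositionalEquality.Properties using (setoid)
open import Relation.Nullary.Decidable using (yes; no; via-injection)
open import Relation.Nullary.Negation using (¬_)

record FiniteField (c ℓ : Level) (q : ℕ) : Set (lsuc (c ⊔ ℓ)) where
  field
    commutativeRing : CommutativeRing c ℓ
  open CommutativeRing commutativeRing public
    renaming (setoid to ≈-setoid)
  field
    1≉0         : ¬ (1# ≈ 0#)
    inverse     : ∀ x → ¬ (x ≈ 0#) → ∃[ y ] (x * y ≈ 1#)
    enumeration : Inverse ≈-setoid (setoid (Fin q))

  open RawSemiringDefs (Semiring.rawSemiring semiring) public
    using (_^_) renaming (_×_ to _·_)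

  infix 4 _≟_
  _≟_ : Decidable _≈_
  _≟_ = via-injection (Inverse⇒Injection enumeration) _≟ᶠ_

-- The values e_p(x) = e^{2πix/p} enter only through ζ = e^{2πi/p}, via
-- e_p(n) = ζⁿ.  The pair (ℂ , e^{2πi/p}) is abstracted to an integral domain
-- of characteristic zero with an element of multiplicative order p (p being
-- prime, ζᵖ = 1 and ζ ≠ 1 say exactly this).  The domain axiom is the
-- cancellation law, which also holds for constructive complex numbers.
record Char0DomainWithRoot (c ℓ : Level) (p : ℕ) : Set (lsuc (c ⊔ ℓ)) where
  field
    commutativeRing : CommutativeRing c ℓ
  open CommutativeRing commutativeRing public
  open RawSemiringDefs (Semiring.rawSemiring semiring) public
    using (_^_) renaming (_×_ to _·_)
  field
    *-cancel : Algebra.Definitions.AlmostLeftCancellative _≈_ 0# _*_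
    char0    : ∀ n → ¬ (suc n · 1# ≈ 0#)
    ζ        : Carrier
    ζᵖ≈1     : ζ ^ p ≈ 1#
    ζ≉1      : ¬ (ζ ≈ 1#)

module _ {c ℓ : Level} {q : ℕ} (F : FiniteField c ℓ q) where
  open FiniteField F

  IsPrimitiveRoot : Carrier → Set (c ⊔ ℓ)
  IsPrimitiveRoot g = ¬ (g ≈ 0#) × (∀ x → ¬ (x ≈ 0#) → ∃[ k ] (x ≈ g ^ k))

  PeisertSet : Carrier → Carrier → Set ℓ
  PeisertSet g x = ∃[ j ] ((j % 4 ≡ 0 ⊎ j % 4 ≡ 1) × x ≈ g ^ j)

  PeisertAdjacent : Carrier → Carrier → Carrier → Set ℓ
  PeisertAdjacent g x y = ¬ (x ≈ y) × PeisertSet g (x - y)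

  -- Finite sets of vertices are duplicate-free lists, so that cardinality is
  -- length.
  IsFiniteSet : List Carrier → Set (c ⊔ ℓ)
  IsFiniteSet A = UniqueSetoid.Unique ≈-setoid A

  IsPeisertClique : Carrier → List Carrier → Set (c ⊔ ℓ)
  IsPeisertClique g A =
    ∀ x y → x ∈ A → y ∈ A → ¬ (x ≈ y) → PeisertAdjacent g x y
    where open Membership ≈-setoid using (_∈_)

  B⟨_⟩ : ℕ → Carrier → Carrier → Set ℓ
  B⟨ j ⟩ g x =
    ∃[ k ] (1 ℕ.≤ k × k ℕ.≤ (q ℕ.∸ 1) / 4 × x ≈ g ^ (4 ℕ.* k ℕ.+ j))

  -- For a prime p ≡ 3 (mod 4) exactly one of the two side conditions holds.
  B : (p s : ℕ) → Carrier → Carrier → Set ℓ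
  B p s g x =
      ((p % 8 ≡ 7 × s % 2 ≡ 1) × (B⟨ 1 ⟩ g x ⊎ B⟨ 2 ⟩ g x))
    ⊎ ((p % 8 ≡ 3 ⊎ s % 2 ≡ 0) × (B⟨ 0 ⟩ g x ⊎ B⟨ 3 ⟩ g x))

  -- Absolute trace of a field with pⁿ elements, as an element of the field:
  -- x + x^p + … + x^(p^(n-1)).
  Tr : (p n : ℕ) → Carrier → Carrier
  Tr p n x = foldr _+_ 0# (map (λ i → x ^ (p ℕ.^ i)) (upTo n))

  -- The i < p with x = i · 1, for x in the prime subfield 𝔽_p; the value 0
  -- for other x is a dummy, never used on traces since these lie in 𝔽_p.
  residue : (p : ℕ) → Carrier → ℕ
  residue p x with any? {n = p} (λ i → toℕ i · 1# ≟ x)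
  ... | yes (i , _) = toℕ i
  ... | no _        = 0

module _ {c ℓ c′ ℓ′ : Level} {q : ℕ} (F : FiniteField c ℓ q)
         (p : ℕ) (K : Char0DomainWithRoot c′ ℓ′ p) where
  private
    module F = FiniteField F
    module K = Char0DomainWithRoot K

  eₚ : F.Carrier → K.Carrier
  eₚ x = K.ζ K.^ residue F p x

  exponentialSum : (n : ℕ) → List F.Carrier → F.Carrier → K.Carrier
  exponentialSum n A b =
    foldr K._+_ K.0# (map (λ a → eₚ (Tr F p n (a F.* b))) A)

{-# OPTIONS --safe #-}
-- Write Q = pˢ, q = Q², q − 1 = 4m, C_j = { g^(4i+j) }, and let
-- ψ(x) = ζ^Tr(x) and η_j = Σ_{x ∈ C_j} ψ(x).
--
-- Bound: g² maps differences of a clique A into C₂ ∪ C₃, so that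
-- (a , b) ↦ a + g² b is injective on A × A.
--
-- Periods: 𝔽ₚ* ⊆ C₀ makes the η_j integers, Frobenius exchanges C₁ and C₃, and
-- orthogonality gives Σ_j η_{j+a} η_{j+b} = q [a = b] − m.  Hence η₀ − η₂ and
-- η₀ − 2η₁ + η₂ are ±Q.  Moreover η₀ is odd: η₀ = #{Tr = 0} − #{Tr = 1} on C₀,
-- the first set is stable under x ↦ −x, and the parity of the second is found
-- by passing to the fixed points of x ↦ x^(pᵈ) for d = s (and d = s/2 if s is
-- even) and then to those of the reflection in a point of trace 1.  Modulo 8
-- this fixes the signs, and it follows that Σ_{x ∈ B} ψ(yx) = −(Q+1)/2 for
-- every y ∈ C₀ ∪ C₁.
--
-- Equality: with S(x) = Σ_{a ∈ A} ψ(ax), summing over differences of elements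
-- of A yields Σ_{x ∈ B} S(x) S(−x) = |A| (Q − |A|) (Q+1)/2, so S = 0 on B forces
-- |A| = Q.  Conversely, the sum of S(x) S(−x) over an orbit of 𝔽ₚ* is half of
-- Σ_{r,s} (n_r − n_s)², where n_r counts the a ∈ A with Tr(ax) = r; this
-- replaces positivity of |S|².  If |A| = Q, all these squares vanish, so n_r is
-- constant and S(x) is a multiple of Σ_r ζʳ = 0.
module Submission where

open import Defs
open import Algebra.Bundles using (CommutativeRing; CommutativeSemiring)
import Algebra.Properties.CommutativeSemiring.Binomial
import Algebra.Properties.CommutativeSemiring.Exp
import Algebra.Properties.Ring
import Algebra.Properties.Semiring.Exp
import Algebra.Properties.Semiring.Mult
import Algebra.Properties.Semiring.Sum
import Algebra.Solver.Ring
open import Algebra.Solver.Ring.AlmostCommutativeRing using (_-Raw-AlmostCommutative⟶_; fromCommutativeRing)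
open import Data.Bool.Base using (if_then_else_)
open import Data.Fin.Base as Fin using (Fin; zero; suc; toℕ)
import Data.Fin.Permutation as Perm
import Data.Fin.Properties as Fin
open import Data.Integer.Base as ℤ using (ℤ; -[1+_]) renaming (+_ to pos)
import Data.Integer.Properties as ℤ
import Data.Integer.Tactic.RingSolver as ℤ-Solver
open import Data.List.Base using (List; []; _∷_; foldr; map; upTo; applyUpTo; length; lookup)
open import Data.List.Membership.Setoid.Properties using (∈-lookup)
open import Data.List.Relation.Unary.All as All using (All)
open import Data.List.Relation.Unary.AllPairs.Core using ([]; _∷_)
open import Data.Maybe.Base using (Maybe; just; nothing)
open import Data.Nat.Base as ℕ using (ℕ; zero; suc)
open import Data.Nat.Combinatorics using (_C_; nCn≡1; nC1≡n; nCk+nC[k+1]≡[n+1]C[k+1])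
open import Data.Nat.Coprimality using (coprime-Bézout; prime⇒coprime)
open import Data.Nat.DivMod using (_/_; _%_; m≡m%n+[m/n]*n; m%n<n; m/n*n≡m; m<n*o⇒m/o<n; m<n⇒m%n≡m; [m+kn]%n≡m%n; %-distribˡ-+; m*n/n≡m)
open import Data.Nat.Divisibility using (_∣_; divides; m%n≡0⇒n∣m; ∣⇒≤; *-cancelʳ-∣; ∣-trans; n∣m*n; _∣?_)
open import Data.Nat.GCD using (module Bézout)
open import Data.Nat.Primality using (Prime; euclidsLemma; prime⇒nonTrivial; prime⇒nonZero)
import Data.Nat.Properties as ℕ
open import Data.Nat.Tactic.RingSolver using (solve-∀)
open import Data.Product.Base using (_×_; _,_; ∃-syntax; proj₁; proj₂)
open import Data.Sum.Base using (_⊎_; inj₁; inj₂)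
open import Function.Base using (_∘_; id)
open import Function.Bundles using (Inverse; _⇔_; mk⇔; module Equivalence)
open import Level using (Level)
open import Relation.Binary.Core using (_Preserves_⟶_)
open import Relation.Binary.Definitions using (tri<; tri≈; tri>)
open import Relation.Binary.PropositionalEquality as ≡ using (_≡_; _≢_)
import Relation.Binary.Reasoning.Setoid
open import Relation.Nullary.Decidable using (Dec; yes; no; does; ¬?; from-no)
open import Relation.Nullary.Negation using (¬_; contradiction)

-- `K` has neither conjugation nor order, and its equality need not be decidable; it offers
-- cancellation and characteristic zero. So every decisive equation is brought to the form ι i ≈ ι j
-- with integers i and j, injectivity of `ι` carries it over to ℤ or ℕ, and case distinctions are
-- made there.
--
-- η₀ - η₂ and η₀ - 2η₁ + η₂ are the quartic and the quadratic Gauss sum, as η₁ = η₃. Their squares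
-- leave signs open, and the sign of D = η₀ - η₂ decides which two classes have to make up B. With E
-- for the second sum, 4η₀ = E + 2D - 1; the oddness of η₀ turns this into a congruence modulo 8
-- that settles the sign.
--
-- The descent to a subfield with pᵈ elements has to reach one whose non-zero elements are all
-- fourth powers in the large field, because the final reflection need not preserve fourth powers.
-- This requires 4 | (q - 1)/(pᵈ - 1). For d = s the quotient is Q + 1, a multiple of 4 exactly for
-- odd s; hence the further step to d = s/2 for even s.

-- Finite sums and indicator functions

module FiniteSums {c ℓ : Level} (R : CommutativeSemiring c ℓ) where
  open CommutativeSemiring R hiding (zero)
  open Algebra.Properties.Semiring.Sum semiring public
    using (sum; sum-cong-≋; sum-replicate; sum-replicate-zero; ∑-distrib-+; ∑-comm; sum-permute; *-distribˡ-sum; *-distribʳ-sum)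
  open Algebra.Properties.Semiring.Mult semiring using () renaming (_×_ to _·_)
  open Relation.Binary.Reasoning.Setoid setoid

  ∑< : ℕ → (ℕ → Carrier) → Carrier
  ∑< n f = sum {n} (f ∘ toℕ)

  [_] : ∀ {a} {P : Set a} → Dec P → Carrier
  [ d ] = if does d then 1# else 0#

  []-yes : ∀ {a} {P : Set a} (d : Dec P) → P → [ d ] ≈ 1#
  []-yes (yes _) _ = refl
  []-yes (no ¬p) p = contradiction p ¬p

  []-no : ∀ {a} {P : Set a} (d : Dec P) → ¬ P → [ d ] ≈ 0#
  []-no (yes p) ¬p = contradiction p ¬p
  []-no (no _)  _  = refl

  []-cong : ∀ {a b} {P : Set a} {P′ : Set b} (d : Dec P) (d′ : Dec P′) →
            (P → P′) → (P′ → P) → [ d ] ≈ [ d′ ]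
  []-cong (yes p) d′ to from = sym ([]-yes d′ (to p))
  []-cong (no ¬p) d′ to from = sym ([]-no d′ (¬p ∘ from))

  []-*-cong : ∀ {a} {P : Set a} (d : Dec P) {x y} → (P → x ≈ y) → [ d ] * x ≈ [ d ] * y
  []-*-cong (yes p) eq = *-congˡ (eq p)
  []-*-cong (no _)  eq = trans (zeroˡ _) (sym (zeroˡ _))

  sum-cong : ∀ {n} {f g : Fin n → Carrier} → (∀ i → f i ≈ g i) → sum f ≈ sum g
  sum-cong = sum-cong-≋

  ∑<-cong : ∀ n {f g : ℕ → Carrier} → (∀ k → k ℕ.< n → f k ≈ g k) → ∑< n f ≈ ∑< n g
  ∑<-cong n eq = sum-cong (λ i → eq (toℕ i) (Fin.toℕ<n i))

  ∑<-const : ∀ n x → ∑< n (λ _ → x) ≈ n · x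
  ∑<-const n x = sum-replicate n

  ∑<-split : ∀ a b (f : ℕ → Carrier) → ∑< (a ℕ.+ b) f ≈ ∑< a f + ∑< b (λ k → f (a ℕ.+ k))
  ∑<-split zero    b f = sym (+-identityˡ _)
  ∑<-split (suc a) b f = trans (+-congˡ (∑<-split a b (f ∘ suc))) (sym (+-assoc _ _ _))

  ∑<-last : ∀ n (f : ℕ → Carrier) → ∑< (suc n) f ≈ ∑< n f + f n
  ∑<-last zero    f = +-comm _ _
  ∑<-last (suc n) f = trans (+-congˡ (∑<-last n (f ∘ suc))) (sym (+-assoc _ _ _))

  -- Moving the window one step to the right loses the term at `a` and gains the one at `a + n`,
  -- which is the same by periodicity.
  ∑<-shift : ∀ n (f : ℕ → Carrier) → (∀ k → f (n ℕ.+ k) ≈ f k) →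
             ∀ a → ∑< n (λ k → f (a ℕ.+ k)) ≈ ∑< n f
  ∑<-shift n f per zero    = refl
  ∑<-shift n f per (suc a) = begin
    ∑< n (λ k → f (suc (a ℕ.+ k)))          ≈⟨ ∑<-cong n (λ k _ → reflexive (≡.cong f (≡.sym (ℕ.+-suc a k)))) ⟩
    ∑< n (λ k → f (a ℕ.+ suc k))            ≈⟨ by-one n (λ k → f (a ℕ.+ k)) per₀ ⟩
    ∑< n (λ k → f (a ℕ.+ k))                ≈⟨ ∑<-shift n f per a ⟩
    ∑< n f                                  ∎
    where
    per₀ : f (a ℕ.+ n) ≈ f (a ℕ.+ 0)
    per₀ = trans (reflexive (≡.cong f (ℕ.+-comm a n)))
                 (trans (per a) (reflexive (≡.cong f (≡.sym (ℕ.+-identityʳ a)))))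
    by-one : ∀ n (h : ℕ → Carrier) → h n ≈ h 0 → ∑< n (h ∘ suc) ≈ ∑< n h
    by-one zero    h eq = refl
    by-one (suc n) h eq = begin
      ∑< (suc n) (h ∘ suc)      ≈⟨ ∑<-last n (h ∘ suc) ⟩
      ∑< n (h ∘ suc) + h (suc n) ≈⟨ +-comm _ _ ⟩
      h (suc n) + ∑< n (h ∘ suc) ≈⟨ +-congʳ eq ⟩
      h 0 + ∑< n (h ∘ suc)       ∎

  -- Sorts the indices by their residue modulo 4. For a function of g ^ k this is the splitting of
  -- the non-zero field elements into the classes C_j.
  ∑<-mod4 : ∀ m (f : ℕ → Carrier) → ∑< (m ℕ.* 4) f ≈ ∑< 4 (λ j → ∑< m (λ i → f (i ℕ.* 4 ℕ.+ j)))
  ∑<-mod4 zero    f = sym (sum-replicate-zero 4)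
  ∑<-mod4 (suc m) f = begin
    ∑< (4 ℕ.+ m ℕ.* 4) f
      ≈⟨ ∑<-split 4 (m ℕ.* 4) f ⟩
    ∑< 4 f + ∑< (m ℕ.* 4) (λ k → f (4 ℕ.+ k))
      ≈⟨ +-congˡ (∑<-mod4 m (λ k → f (4 ℕ.+ k))) ⟩
    ∑< 4 f + ∑< 4 (λ j → ∑< m (λ i → f (4 ℕ.+ (i ℕ.* 4 ℕ.+ j))))
      ≈⟨ ∑-distrib-+ {4} (f ∘ toℕ) (λ j → ∑< m (λ i → f (4 ℕ.+ (i ℕ.* 4 ℕ.+ toℕ j)))) ⟨
    ∑< 4 (λ j → ∑< (suc m) (λ i → f (i ℕ.* 4 ℕ.+ j))) ∎

  sum-select : ∀ {n} (j : Fin n) (f : Fin n → Carrier) → sum (λ i → [ i Fin.≟ j ] * f i) ≈ f j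
  sum-select {suc n} zero f = begin
    1# * f zero + sum (λ i → [ suc i Fin.≟ zero ] * f (suc i))
      ≈⟨ +-cong (*-identityˡ _) (sum-cong {n} (λ i → zeroˡ _)) ⟩
    f zero + sum {n} (λ i → 0#)
      ≈⟨ +-congˡ (sum-replicate-zero n) ⟩
    f zero + 0#  ≈⟨ +-identityʳ _ ⟩
    f zero       ∎
  sum-select {suc n} (suc j) f = begin
    0# * f zero + sum (λ i → [ suc i Fin.≟ suc j ] * f (suc i))
      ≈⟨ +-cong (zeroˡ _) (sum-cong {n} (λ i → *-congʳ ([]-cong (suc i Fin.≟ suc j) (i Fin.≟ j) Fin.suc-injective (≡.cong suc)))) ⟩
    0# + sum (λ i → [ i Fin.≟ j ] * f (suc i)) ≈⟨ +-identityˡ _ ⟩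
    sum (λ i → [ i Fin.≟ j ] * f (suc i))      ≈⟨ sum-select j (f ∘ suc) ⟩
    f (suc j)                                  ∎

  ∑<-select : ∀ n r → r ℕ.< n → (f : ℕ → Carrier) → ∑< n (λ i → [ i ℕ.≟ r ] * f i) ≈ f r
  ∑<-select n r r<n f = begin
    sum {n} (λ i → [ toℕ i ℕ.≟ r ] * f (toℕ i))
      ≈⟨ sum-cong {n} (λ i → *-congʳ ([]-cong (toℕ i ℕ.≟ r) (i Fin.≟ j)
           (λ eq → Fin.toℕ-injective (≡.trans eq (≡.sym (Fin.toℕ-fromℕ< r<n))))
           (λ eq → ≡.trans (≡.cong toℕ eq) (Fin.toℕ-fromℕ< r<n)))) ⟩
    sum (λ i → [ i Fin.≟ j ] * f (toℕ i)) ≈⟨ sum-select j (f ∘ toℕ) ⟩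
    f (toℕ j)                             ≈⟨ reflexive (≡.cong f (Fin.toℕ-fromℕ< r<n)) ⟩
    f r                                   ∎
    where j = Fin.fromℕ< r<n

  foldr-map≡sum : ∀ {a} {A : Set a} (f : A → Carrier) (xs : List A) →
                  foldr _+_ 0# (map f xs) ≡ sum (f ∘ lookup xs)
  foldr-map≡sum f []       = ≡.refl
  foldr-map≡sum f (x ∷ xs) = ≡.cong (f x +_) (foldr-map≡sum f xs)

  foldr-upTo≡∑< : ∀ n (f : ℕ → Carrier) → foldr _+_ 0# (map f (upTo n)) ≡ ∑< n f
  foldr-upTo≡∑< n f = go n id
    where
    go : ∀ n (h : ℕ → ℕ) → foldr _+_ 0# (map f (applyUpTo h n)) ≡ ∑< n (f ∘ h)
    go zero    h = ≡.refl
    go (suc n) h = ≡.cong (f (h 0) +_) (go n (h ∘ suc))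

-- The homomorphism from ℤ and a ring solver with integer coefficients

module IntegerMultiples {c ℓ : Level} (R : CommutativeRing c ℓ) where
  open CommutativeRing R hiding (zero)
  open Algebra.Properties.Semiring.Mult semiring
    using (×-homo-+; ×1-homo-*) renaming (_×_ to _·_)
  open Algebra.Properties.Ring ring
  open Relation.Binary.Reasoning.Setoid setoid

  ι : ℤ → Carrier
  ι (pos n)    = n · 1#
  ι -[1+ n ] = - (suc n · 1#)

  private
    cancel-suc : ∀ a b → (1# + a) - (1# + b) ≈ a - b
    cancel-suc a b = begin
      (1# + a) - (1# + b)         ≈⟨ +-cong (+-comm 1# a) (sym (-‿+-comm 1# b)) ⟩
      (a + 1#) + (- 1# + - b)     ≈⟨ +-assoc a 1# _ ⟩
      a + (1# + (- 1# + - b))     ≈⟨ +-congˡ (sym (+-assoc 1# _ _)) ⟩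
      a + ((1# - 1#) + - b)       ≈⟨ +-congˡ (+-congʳ (-‿inverseʳ 1#)) ⟩
      a + (0# + - b)              ≈⟨ +-congˡ (+-identityˡ _) ⟩
      a - b                       ∎

    ι-⊖ : ∀ m n → ι (m ℤ.⊖ n) ≈ m · 1# - n · 1#
    ι-⊖ zero    zero    = sym (-‿inverseʳ 0#)
    ι-⊖ zero    (suc n) = sym (+-identityˡ _)
    ι-⊖ (suc m) zero    = sym (trans (+-congˡ -0#≈0#) (+-identityʳ _))
    ι-⊖ (suc m) (suc n) = begin
      ι (suc m ℤ.⊖ suc n)             ≡⟨ ≡.cong ι (ℤ.[1+m]⊖[1+n]≡m⊖n m n) ⟩
      ι (m ℤ.⊖ n)                     ≈⟨ ι-⊖ m n ⟩
      m · 1# - n · 1#                 ≈⟨ sym (cancel-suc _ _) ⟩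
      suc m · 1# - suc n · 1#         ∎

  ι-neg : ∀ i → ι (ℤ.- i) ≈ - ι i
  ι-neg (pos zero)   = sym -0#≈0#
  ι-neg (pos (suc n))  = refl
  ι-neg -[1+ n ]   = sym (-‿involutive _)

  ι-+ : ∀ i j → ι (i ℤ.+ j) ≈ ι i + ι j
  ι-+ (pos m)    (pos n)    = ×-homo-+ 1# m n
  ι-+ (pos m)    -[1+ n ] = ι-⊖ m (suc n)
  ι-+ -[1+ m ] (pos n)    = trans (ι-⊖ n (suc m)) (+-comm _ _)
  ι-+ -[1+ m ] -[1+ n ] = begin
    - (suc (suc (m ℕ.+ n)) · 1#)      ≡⟨ ≡.cong (λ k → - (suc k · 1#)) (≡.sym (ℕ.+-suc m n)) ⟩
    - ((suc m ℕ.+ suc n) · 1#)        ≈⟨ -‿cong (×-homo-+ 1# (suc m) (suc n)) ⟩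
    - (suc m · 1# + suc n · 1#)       ≈⟨ sym (-‿+-comm _ _) ⟩
    - (suc m · 1#) + - (suc n · 1#)   ∎

  private
    ι-pos-* : ∀ m j → ι (pos m ℤ.* j) ≈ ι (pos m) * ι j
    ι-pos-* m (pos n) = begin
      ι (pos m ℤ.* pos n)     ≡⟨ ≡.cong ι (≡.sym (ℤ.pos-* m n)) ⟩
      (m ℕ.* n) · 1#      ≈⟨ ×1-homo-* m n ⟩
      ι (pos m) * ι (pos n)   ∎
    ι-pos-* m -[1+ n ] = begin
      ι (pos m ℤ.* -[1+ n ])          ≡⟨ ≡.cong ι (≡.sym (ℤ.neg-distribʳ-* (pos m) (pos (suc n)))) ⟩
      ι (ℤ.- (pos m ℤ.* pos (suc n)))     ≈⟨ ι-neg (pos m ℤ.* pos (suc n)) ⟩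
      - ι (pos m ℤ.* pos (suc n))         ≈⟨ -‿cong (ι-pos-* m (pos (suc n))) ⟩
      - (ι (pos m) * ι (pos (suc n)))     ≈⟨ -‿distribʳ-* _ _ ⟩
      ι (pos m) * ι -[1+ n ]          ∎

  ι-* : ∀ i j → ι (i ℤ.* j) ≈ ι i * ι j
  ι-* (pos m)  j = ι-pos-* m j
  ι-* -[1+ m ] j = begin
    ι (-[1+ m ] ℤ.* j)            ≡⟨ ≡.cong ι (≡.sym (ℤ.neg-distribˡ-* (pos (suc m)) j)) ⟩
    ι (ℤ.- (pos (suc m) ℤ.* j))       ≈⟨ ι-neg (pos (suc m) ℤ.* j) ⟩
    - ι (pos (suc m) ℤ.* j)           ≈⟨ -‿cong (ι-pos-* (suc m) j) ⟩
    - (ι (pos (suc m)) * ι j)         ≈⟨ -‿distribˡ-* _ _ ⟩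
    ι -[1+ m ] * ι j              ∎

  ι-1 : ι (pos 1) ≈ 1#
  ι-1 = +-identityʳ 1#

  private
    ι-morphism : CommutativeRing.rawRing ℤ.+-*-commutativeRing -Raw-AlmostCommutative⟶ fromCommutativeRing R
    ι-morphism = record
      { ⟦_⟧ = ι ; +-homo = ι-+ ; *-homo = ι-* ; -‿homo = ι-neg ; 0-homo = refl ; 1-homo = ι-1 }

    -- Equality in `R` need not be decidable, so coefficients are compared as integers; `nothing`
    -- only means that the solver ignores a possible coincidence of their images.
    ι-≟ : ∀ i j → Maybe (ι i ≈ ι j)
    ι-≟ i j with i ℤ.≟ j
    ... | yes ≡.refl = just refl
    ... | no _       = nothing

  module Solver = Algebra.Solver.Ring
    (CommutativeRing.rawRing ℤ.+-*-commutativeRing)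
    (fromCommutativeRing R)
    ι-morphism
    ι-≟

module SemiringPowers {c ℓ : Level} (R : CommutativeSemiring c ℓ) where
  open CommutativeSemiring R hiding (zero)
  open Algebra.Properties.Semiring.Exp semiring public using (_^_; ^-congˡ; ^-congʳ; ^-homo-*; ^-assocʳ)
  open Algebra.Properties.CommutativeSemiring.Exp R public using (^-distrib-*)

  1^n≈1 : ∀ n → 1# ^ n ≈ 1#
  1^n≈1 zero    = refl
  1^n≈1 (suc n) = trans (*-identityˡ _) (1^n≈1 n)

-- Finite fields: sums over all elements, involutions, the order of a primitive root

module FieldProperties {c ℓ : Level} {q : ℕ} (F : FiniteField c ℓ q) where
  open FiniteField F hiding (zero)
  open Algebra.Properties.Ring ring public
  open SemiringPowers commutativeSemiring public hiding (_^_)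
  open Algebra.Properties.Semiring.Mult semiring public using (×-congʳ; ×-homo-+; ×1-homo-*; ×-assoc-*; ×-comm-*; ×-assocˡ)
  open IntegerMultiples commutativeRing public using (module Solver)
  open Relation.Binary.Reasoning.Setoid ≈-setoid

  to : Carrier → Fin q
  to = Inverse.to enumeration

  from : Fin q → Carrier
  from = Inverse.from enumeration

  to-cong : ∀ {x y} → x ≈ y → to x ≡ to y
  to-cong = Inverse.to-cong enumeration

  to-injective : ∀ {x y} → to x ≡ to y → x ≈ y
  to-injective eq = trans (sym (Inverse.inverseʳ enumeration ≡.refl))
                          (Inverse.inverseʳ enumeration eq)

  from-to : ∀ x → from (to x) ≈ x
  from-to x = Inverse.inverseʳ enumeration ≡.refl

  to-from : ∀ i → to (from i) ≡ i
  to-from i = Inverse.inverseˡ enumeration refl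

  x≉0⇒*-cancelˡ : ∀ {x} → ¬ (x ≈ 0#) → ∀ {y z} → x * y ≈ x * z → y ≈ z
  x≉0⇒*-cancelˡ {x} x≉0 {y} {z} eq with x⁻¹ , x*x⁻¹≈1 ← inverse x x≉0 = begin
    y              ≈⟨ *-identityˡ y ⟨
    1# * y         ≈⟨ *-congʳ (trans (sym x*x⁻¹≈1) (*-comm x x⁻¹)) ⟩
    x⁻¹ * x * y    ≈⟨ *-assoc x⁻¹ x y ⟩
    x⁻¹ * (x * y)  ≈⟨ *-congˡ eq ⟩
    x⁻¹ * (x * z)  ≈⟨ *-assoc x⁻¹ x z ⟨
    x⁻¹ * x * z    ≈⟨ *-congʳ (trans (sym x*x⁻¹≈1) (*-comm x x⁻¹)) ⟨
    1# * z         ≈⟨ *-identityˡ z ⟩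
    z              ∎

  *-nonzero : ∀ {x y} → ¬ (x ≈ 0#) → ¬ (y ≈ 0#) → ¬ (x * y ≈ 0#)
  *-nonzero x≉0 y≉0 xy≈0 = y≉0 (x≉0⇒*-cancelˡ x≉0 (trans xy≈0 (sym (zeroʳ _))))

  ^-nonzero : ∀ {x} → ¬ (x ≈ 0#) → ∀ n → ¬ (x ^ n ≈ 0#)
  ^-nonzero x≉0 zero    = 1≉0
  ^-nonzero x≉0 (suc n) = *-nonzero x≉0 (^-nonzero x≉0 n)

  module SumOver {c′ ℓ′ : Level} (R : CommutativeSemiring c′ ℓ′) where
    private module R = CommutativeSemiring R
    open FiniteSums R

    ∑F : (Carrier → R.Carrier) → R.Carrier
    ∑F f = sum {q} (f ∘ from)

    ∑F-cong : ∀ {f h : Carrier → R.Carrier} → (∀ x → f x R.≈ h x) → ∑F f R.≈ ∑F h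
    ∑F-cong eq = sum-cong {q} (λ i → eq (from i))

    -- The index type is an arbitrary `Fin k`, so that one lemma serves for permutations of the
    -- field and for its enumeration by 0 and the powers of g.
    ∑F-permute : ∀ (f : Carrier → R.Carrier) → f Preserves _≈_ ⟶ R._≈_ →
                 ∀ {k} (σ : Fin k → Carrier) (σ⁻¹ : Carrier → Fin k) →
                 (∀ {x y} → x ≈ y → σ⁻¹ x ≡ σ⁻¹ y) →
                 (∀ x → σ (σ⁻¹ x) ≈ x) → (∀ i → σ⁻¹ (σ i) ≡ i) →
                 ∑F f R.≈ sum (f ∘ σ)
    ∑F-permute f f-cong {k} σ σ⁻¹ σ⁻¹-cong invˡ invʳ =
      R.trans (sum-permute (f ∘ from) π) (sum-cong {k} (λ i → f-cong (from-to (σ i))))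
      where
      π = Perm.permutation (to ∘ σ) (σ⁻¹ ∘ from)
            (λ i → ≡.trans (to-cong (invˡ (from i))) (to-from i))
            (λ i → ≡.trans (σ⁻¹-cong (from-to (σ i))) (invʳ i))

    ∑F-reindex : ∀ (f : Carrier → R.Carrier) → f Preserves _≈_ ⟶ R._≈_ →
                 ∀ (σ σ⁻¹ : Carrier → Carrier) → σ Preserves _≈_ ⟶ _≈_ → σ⁻¹ Preserves _≈_ ⟶ _≈_ →
                 (∀ x → σ (σ⁻¹ x) ≈ x) → (∀ x → σ⁻¹ (σ x) ≈ x) →
                 ∑F f R.≈ ∑F (f ∘ σ)
    ∑F-reindex f f-cong σ σ⁻¹ σ-cong σ⁻¹-cong invˡ invʳ =
      ∑F-permute f f-cong (σ ∘ from) (to ∘ σ⁻¹) (to-cong ∘ σ⁻¹-cong)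
        (λ x → trans (σ-cong (from-to _)) (invˡ x))
        (λ i → ≡.trans (to-cong (invʳ (from i))) (to-from i))

    ∑F-translate : ∀ (f : Carrier → R.Carrier) → f Preserves _≈_ ⟶ R._≈_ →
                   ∀ a → ∑F f R.≈ ∑F (λ x → f (x + a))
    ∑F-translate f f-cong a = ∑F-reindex f f-cong (_+ a) (_- a) +-congʳ +-congʳ
      (λ x → solve 2 (λ x a → x :- a :+ a := x) refl x a)
      (λ x → solve 2 (λ x a → x :+ a :- a := x) refl x a)
      where open Solver

    ∑F-select : ∀ y (f : Carrier → R.Carrier) → f Preserves _≈_ ⟶ R._≈_ →
                ∑F (λ x → [ x ≟ y ] R.* f x) R.≈ f y
    ∑F-select y f f-cong = R.trans
      (sum-cong {q} (λ i → R.*-congʳ ([]-cong (from i ≟ y) (i Fin.≟ to y)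
        (λ eq → ≡.trans (≡.sym (to-from i)) (to-cong eq))
        (λ eq → to-injective (≡.trans (to-from i) eq)))))
      (R.trans (sum-select (to y) (f ∘ from)) (f-cong (from-to y)))

  module _ where
    open FiniteSums ℕ.+-*-commutativeSemiring using ([_]; []-yes; []-no; []-cong) renaming (∑-distrib-+ to ℕ-∑-distrib-+)
    open SumOver ℕ.+-*-commutativeSemiring

    -- Splitting F into {x < σx}, {x > σx} and {x = σx}, where σ swaps the first
    -- two sets.
    involution-parity :
      ∀ (f : Carrier → ℕ) → f Preserves _≈_ ⟶ _≡_ →
      ∀ (σ σ⁻¹ : Carrier → Carrier) → σ Preserves _≈_ ⟶ _≈_ → σ⁻¹ Preserves _≈_ ⟶ _≈_ →
      (∀ x → σ (σ⁻¹ x) ≈ x) → (∀ x → σ⁻¹ (σ x) ≈ x) →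
      (∀ x → f (σ x) ≡ f x) → (∀ x → f x ≢ 0 → σ (σ x) ≈ x) →
      ∃[ k ] ∑F f ≡ k ℕ.+ k ℕ.+ ∑F (λ x → [ σ x ≟ x ] ℕ.* f x)
    involution-parity f f-cong σ σ⁻¹ σ-cong σ⁻¹-cong invˡ invʳ f-σ σσ =
      ∑F low ,
      ≡.trans (∑F-cong split)
      (≡.trans (ℕ-∑-distrib-+ {q} ((λ x → low x ℕ.+ high x) ∘ from) (fix ∘ from))
      (≡.cong (ℕ._+ ∑F fix)
      (≡.trans (ℕ-∑-distrib-+ {q} (low ∘ from) (high ∘ from))
               (≡.cong (∑F low ℕ.+_) high≡low))))
      where
      idx : Carrier → ℕ
      idx x = toℕ (to x)
      idx-cong : ∀ {x y} → x ≈ y → idx x ≡ idx y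
      idx-cong = ≡.cong toℕ ∘ to-cong
      low high fix : Carrier → ℕ
      low  x = [ idx x ℕ.<? idx (σ x) ] ℕ.* f x
      high x = [ idx (σ x) ℕ.<? idx x ] ℕ.* f x
      fix  x = [ σ x ≟ x ] ℕ.* f x
      split : ∀ x → f x ≡ low x ℕ.+ high x ℕ.+ fix x
      split x with ℕ.<-cmp (idx x) (idx (σ x))
      ... | tri< l _ ¬g rewrite []-yes (idx x ℕ.<? idx (σ x)) l | []-no (idx (σ x) ℕ.<? idx x) ¬g
                      | []-no (σ x ≟ x) (λ eq → ℕ.<⇒≢ l (idx-cong (sym eq))) =
        solve-1 (f x)
        where solve-1 : ∀ a → a ≡ a ℕ.+ 0 ℕ.+ 0 ℕ.+ 0
              solve-1 = solve-∀
      ... | tri≈ ¬l eq ¬g rewrite []-no (idx x ℕ.<? idx (σ x)) ¬l | []-no (idx (σ x) ℕ.<? idx x) ¬g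
                      | []-yes (σ x ≟ x) (sym (to-injective (Fin.toℕ-injective eq))) =
        ≡.sym (ℕ.+-identityʳ (f x))
      ... | tri> ¬l _ g rewrite []-no (idx x ℕ.<? idx (σ x)) ¬l | []-yes (idx (σ x) ℕ.<? idx x) g
                      | []-no (σ x ≟ x) (λ eq → ℕ.<⇒≢ g (idx-cong eq)) =
        solve-1 (f x)
        where solve-1 : ∀ a → a ≡ a ℕ.+ 0 ℕ.+ 0
              solve-1 = solve-∀
      low-cong : low Preserves _≈_ ⟶ _≡_
      low-cong {x} {y} eq = ≡.cong₂ ℕ._*_
        (≡.cong₂ (λ a b → [ a ℕ.<? b ]) (idx-cong eq) (idx-cong (σ-cong eq))) (f-cong eq)
      low-σ : ∀ x → low (σ x) ≡ high x
      low-σ x with f x ℕ.≟ 0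
      -- Outside the support of `f` the map `σ` need not be an involution, but there both sides
      -- vanish.
      ... | yes fx≡0 rewrite ≡.trans (f-σ x) fx≡0 | fx≡0 =
        ≡.trans (ℕ.*-zeroʳ [ idx (σ x) ℕ.<? idx (σ (σ x)) ]) (≡.sym (ℕ.*-zeroʳ [ idx (σ x) ℕ.<? idx x ]))
      ... | no  fx≢0 = ≡.cong₂ ℕ._*_
        (≡.cong (λ b → [ idx (σ x) ℕ.<? b ]) (idx-cong (σσ x fx≢0))) (f-σ x)
      high≡low : ∑F high ≡ ∑F low
      high≡low = ≡.sym (≡.trans (∑F-reindex low low-cong σ σ⁻¹ σ-cong σ⁻¹-cong invˡ invʳ) (∑F-cong low-σ))

  -- Translation by 1 permutes the field, so the sum of all elements equals itself plus `q · 1#`.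
  q·1≈0 : q · 1# ≈ 0#
  q·1≈0 = +-cancelˡ (∑F′ id) (q · 1#) 0# (begin
    ∑F′ id + q · 1#             ≈⟨ +-congˡ (sum-replicate q) ⟨
    ∑F′ id + ∑F′ (λ _ → 1#)     ≈⟨ ∑-distrib-+ {q} from (λ _ → 1#) ⟨
    ∑F′ (λ x → x + 1#)          ≈⟨ ∑F′-translate id id 1# ⟨
    ∑F′ id                      ≈⟨ +-identityʳ _ ⟨
    ∑F′ id + 0#                 ∎)
    where
    open SumOver commutativeSemiring using () renaming (∑F to ∑F′; ∑F-translate to ∑F′-translate)
    open FiniteSums commutativeSemiring using (sum-replicate; ∑-distrib-+)

  q-1-nonZero : ∀ n → q ≡ suc n → ℕ.NonZero n
  q-1-nonZero (suc _) _   = _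
  q-1-nonZero zero    q≡1 = contradiction
    (trans (sym (+-identityʳ 1#)) (≡.subst (λ k → k · 1# ≈ 0#) q≡1 q·1≈0)) 1≉0

  module PrimitiveRoot (g : Carrier) (primitive-root : IsPrimitiveRoot F g) where
    g≉0 : ¬ (g ≈ 0#)
    g≉0 = proj₁ primitive-root

    log : ∀ x → ¬ (x ≈ 0#) → ℕ
    log x x≉0 = proj₁ (proj₂ primitive-root x x≉0)

    g^log : ∀ x (x≉0 : ¬ (x ≈ 0#)) → x ≈ g ^ log x x≉0
    g^log x x≉0 = proj₂ (proj₂ primitive-root x x≉0)

    g^-cancel : ∀ a b → g ^ (a ℕ.+ b) ≈ g ^ a → g ^ b ≈ 1#
    g^-cancel a b eq = x≉0⇒*-cancelˡ (^-nonzero g≉0 a)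
      (trans (sym (^-homo-* g a b)) (trans eq (sym (*-identityʳ _))))

    g^-% : ∀ d .{{_ : ℕ.NonZero d}} → g ^ d ≈ 1# → ∀ k → g ^ k ≈ g ^ (k % d)
    g^-% d g^d≈1 k = begin
      g ^ k                                 ≈⟨ ^-congʳ g (m≡m%n+[m/n]*n k d) ⟩
      g ^ (k % d ℕ.+ k / d ℕ.* d)           ≈⟨ ^-homo-* g (k % d) _ ⟩
      g ^ (k % d) * g ^ (k / d ℕ.* d)       ≈⟨ *-congˡ (^-congʳ g (ℕ.*-comm (k / d) d)) ⟩
      g ^ (k % d) * g ^ (d ℕ.* (k / d))     ≈⟨ *-congˡ (^-assocʳ g d (k / d)) ⟨
      g ^ (k % d) * (g ^ d) ^ (k / d)       ≈⟨ *-congˡ (trans (^-congˡ (k / d) g^d≈1) (1^n≈1 (k / d))) ⟩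
      g ^ (k % d) * 1#                      ≈⟨ *-identityʳ _ ⟩
      g ^ (k % d)                           ∎

    -- Every element is 0 or one of g ^ 0, ..., g ^ (d - 1), which makes at most 1 + d elements.
    g^d≈1⇒q≤1+d : ∀ d .{{_ : ℕ.NonZero d}} → g ^ d ≈ 1# → q ℕ.≤ suc d
    g^d≈1⇒q≤1+d d g^d≈1 = Fin.injective⇒≤ {f = λ i → index (from i)}
      (λ {i} {j} eq → ≡.trans (≡.sym (to-from i)) (≡.trans (to-cong (index-injective (from i) (from j) eq)) (to-from j)))
      where
      index : Carrier → Fin (suc d)
      index x with x ≟ 0#
      ... | yes _  = zero
      ... | no x≉0 = suc (Fin.fromℕ< (m%n<n (log x x≉0) d))
      index-injective : ∀ x y → index x ≡ index y → x ≈ y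
      index-injective x y eq with x ≟ 0# | y ≟ 0#
      index-injective x y eq | yes x≈0 | yes y≈0 = trans x≈0 (sym y≈0)
      index-injective x y () | yes x≈0 | no y≉0
      index-injective x y () | no x≉0  | yes y≈0
      index-injective x y eq | no x≉0  | no y≉0 = begin
        x                        ≈⟨ g^log x x≉0 ⟩
        g ^ log x x≉0            ≈⟨ g^-% d g^d≈1 _ ⟩
        g ^ (log x x≉0 % d)      ≈⟨ ^-congʳ g (Fin.fromℕ<-injective _ _ _ _ (Fin.suc-injective eq)) ⟩
        g ^ (log y y≉0 % d)      ≈⟨ g^-% d g^d≈1 _ ⟨
        g ^ log y y≉0            ≈⟨ g^log y y≉0 ⟨
        y                        ∎

    private
      -- Among the q + 1 elements 0, g ^ 0, ..., g ^ (q - 1) two coincide, and 0 is not a power of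
      -- g. The difference of the two exponents is at most q - 1.
      collision : ∃[ d ] (1 ℕ.≤ d × suc d ℕ.≤ q × g ^ d ≈ 1#)
      collision with Fin.pigeonhole (ℕ.n<1+n q) (λ { zero → to 0# ; (suc i) → to (g ^ toℕ i) })
      ... | zero  , suc j , _ , eq = contradiction (sym (to-injective eq)) (^-nonzero g≉0 (toℕ j))
      ... | suc i , suc j , ℕ.s≤s i<j , eq = d , ℕ.m<n⇒0<n∸m i<j ,
            ℕ.≤-<-trans (ℕ.m∸n≤m (toℕ j) (toℕ i)) (Fin.toℕ<n j) ,
            g^-cancel (toℕ i) d (trans (^-congʳ g (ℕ.m+[n∸m]≡n (ℕ.<⇒≤ i<j))) (sym (to-injective eq)))
        where d = toℕ j ℕ.∸ toℕ i

    -- The exponent found by `collision` is at most q - 1, and `g^d≈1⇒q≤1+d` makes it at least q -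
    -- 1.
    g^[q-1]≈1 : ∀ n → q ≡ suc n → g ^ n ≈ 1#
    g^[q-1]≈1 n q≡1+n with d , 1≤d , 1+d≤q , g^d≈1 ← collision =
      ≡.subst (λ k → g ^ k ≈ 1#) (ℕ.suc-injective (≡.trans (ℕ.≤-antisym 1+d≤q q≤1+d) q≡1+n)) g^d≈1
      where
      q≤1+d : q ℕ.≤ suc d
      q≤1+d = g^d≈1⇒q≤1+d d {{ℕ.>-nonZero 1≤d}} g^d≈1

  module PrimitiveRootOrder (g : Carrier) (primitive-root : IsPrimitiveRoot F g)
                            (n : ℕ) (q≡1+n : q ≡ suc n) where
    open PrimitiveRoot g primitive-root public

    instance
      n-nonZero : ℕ.NonZero n
      n-nonZero = q-1-nonZero n q≡1+n

    g^n≈1 : g ^ n ≈ 1#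
    g^n≈1 = g^[q-1]≈1 n q≡1+n

    g^[n+k]≈g^k : ∀ k → g ^ (n ℕ.+ k) ≈ g ^ k
    g^[n+k]≈g^k k = trans (^-homo-* g n k) (trans (*-congʳ g^n≈1) (*-identityˡ _))

    -- A non-zero remainder r of k modulo n would satisfy g ^ r = 1 with r < n, against
    -- `g^d≈1⇒q≤1+d`.
    g^k≈1⇒n∣k : ∀ k → g ^ k ≈ 1# → n ∣ k
    g^k≈1⇒n∣k k g^k≈1 with k % n in eq
    ... | zero  = m%n≡0⇒n∣m k n eq
    ... | suc r = contradiction (ℕ.≤-<-trans n≤1+r (≡.subst (ℕ._< n) eq (m%n<n k n))) (ℕ.<-irrefl ≡.refl)
      where
      n≤1+r : n ℕ.≤ suc r
      n≤1+r = ℕ.s≤s⁻¹ (≡.subst (ℕ._≤ suc (suc r)) q≡1+n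
        (g^d≈1⇒q≤1+d (suc r) (trans (^-congʳ g (≡.sym eq)) (trans (sym (g^-% n g^n≈1 k)) g^k≈1))))

    private
      g^-injective-≤ : ∀ i j → i ℕ.≤ j → j ℕ.< n → g ^ i ≈ g ^ j → i ≡ j
      g^-injective-≤ i j i≤j j<n eq
        with j ℕ.∸ i in d | g^k≈1⇒n∣k (j ℕ.∸ i) (g^-cancel i (j ℕ.∸ i) (trans (^-congʳ g (ℕ.m+[n∸m]≡n i≤j)) (sym eq)))
      ... | zero  | _  = ℕ.≤-antisym i≤j (ℕ.m∸n≡0⇒m≤n d)
      ... | suc e | n∣ = contradiction (ℕ.≤-<-trans (ℕ.≤-trans (∣⇒≤ n∣) (≡.subst (ℕ._≤ j) d (ℕ.m∸n≤m j i))) j<n) (ℕ.<-irrefl ≡.refl)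

    g^-injective : ∀ i j → i ℕ.< n → j ℕ.< n → g ^ i ≈ g ^ j → i ≡ j
    g^-injective i j i<n j<n eq with ℕ.≤-total i j
    ... | inj₁ i≤j = g^-injective-≤ i j i≤j j<n eq
    ... | inj₂ j≤i = ≡.sym (g^-injective-≤ j i j≤i i<n (sym eq))

    log% : ∀ x → ¬ (x ≈ 0#) → ℕ
    log% x x≉0 = log x x≉0 % n

    log%<n : ∀ x (x≉0 : ¬ (x ≈ 0#)) → log% x x≉0 ℕ.< n
    log%<n x x≉0 = m%n<n (log x x≉0) n

    g^log% : ∀ x (x≉0 : ¬ (x ≈ 0#)) → x ≈ g ^ log% x x≉0
    g^log% x x≉0 = trans (g^log x x≉0) (g^-% n g^n≈1 _)

    module _ {c′ ℓ′ : Level} (R : CommutativeSemiring c′ ℓ′) where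
      private module R = CommutativeSemiring R
      open FiniteSums R using (∑<)
      open SumOver R

      ∑F-by-powers : ∀ (f : Carrier → R.Carrier) → f Preserves _≈_ ⟶ R._≈_ →
                     ∑F f R.≈ f 0# R.+ ∑< n (λ k → f (g ^ k))
      ∑F-by-powers f f-cong = ∑F-permute f f-cong σ σ⁻¹ σ⁻¹-cong invˡ invʳ
        where
        σ : Fin (suc n) → Carrier
        σ zero    = 0#
        σ (suc k) = g ^ toℕ k
        σ⁻¹ : Carrier → Fin (suc n)
        σ⁻¹ x with x ≟ 0#
        ... | yes _  = zero
        ... | no x≉0 = suc (Fin.fromℕ< (log%<n x x≉0))
        invˡ : ∀ x → σ (σ⁻¹ x) ≈ x
        invˡ x with x ≟ 0#
        ... | yes x≈0 = sym x≈0
        ... | no x≉0  = trans (^-congʳ g (Fin.toℕ-fromℕ< (log%<n x x≉0))) (sym (g^log% x x≉0))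
        σ-injective : ∀ i j → σ i ≈ σ j → i ≡ j
        σ-injective zero    zero    eq = ≡.refl
        σ-injective zero    (suc j) eq = contradiction (sym eq) (^-nonzero g≉0 (toℕ j))
        σ-injective (suc i) zero    eq = contradiction eq (^-nonzero g≉0 (toℕ i))
        σ-injective (suc i) (suc j) eq = ≡.cong suc (Fin.toℕ-injective (g^-injective _ _ (Fin.toℕ<n i) (Fin.toℕ<n j) eq))
        σ⁻¹-cong : ∀ {x y} → x ≈ y → σ⁻¹ x ≡ σ⁻¹ y
        σ⁻¹-cong {x} {y} eq = σ-injective _ _ (trans (invˡ x) (trans eq (sym (invˡ y))))
        invʳ : ∀ i → σ⁻¹ (σ i) ≡ i
        invʳ i = σ-injective _ _ (invˡ (σ i))

-- Arithmetic: binomial coefficients, inverses modulo a prime, geometric sums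

-- The absorption identity, by induction along Pascal's rule. Its instance n + 1 = p gives the
-- divisibility of the inner binomial coefficients by p.
[1+k]*[1+n]C[1+k]≡[1+n]*nCk : ∀ n k → suc k ℕ.* (suc n C suc k) ≡ suc n ℕ.* (n C k)
[1+k]*[1+n]C[1+k]≡[1+n]*nCk n zero =
  ≡.trans (≡.cong (1 ℕ.*_) (nC1≡n (suc n))) (ℕ.*-comm 1 (suc n))
[1+k]*[1+n]C[1+k]≡[1+n]*nCk zero (suc k) = ℕ.*-zeroʳ (suc (suc k))
[1+k]*[1+n]C[1+k]≡[1+n]*nCk (suc n) (suc k) = begin
  suc (suc k) ℕ.* (suc (suc n) C suc (suc k))
    ≡⟨ ≡.cong (suc (suc k) ℕ.*_) (≡.sym (nCk+nC[k+1]≡[n+1]C[k+1] (suc n) (suc k))) ⟩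
  suc (suc k) ℕ.* (a ℕ.+ (suc n C suc (suc k)))
    ≡⟨ distrib k a (suc n C suc (suc k)) ⟩
  a ℕ.+ suc k ℕ.* a ℕ.+ suc (suc k) ℕ.* (suc n C suc (suc k))
    ≡⟨ ≡.cong₂ (λ u v → a ℕ.+ u ℕ.+ v) ([1+k]*[1+n]C[1+k]≡[1+n]*nCk n k) ([1+k]*[1+n]C[1+k]≡[1+n]*nCk n (suc k)) ⟩
  a ℕ.+ suc n ℕ.* (n C k) ℕ.+ suc n ℕ.* (n C suc k)
    ≡⟨ collect n a (n C k) (n C suc k) ⟩
  a ℕ.+ suc n ℕ.* ((n C k) ℕ.+ (n C suc k))
    ≡⟨ ≡.cong (λ b → a ℕ.+ suc n ℕ.* b) (nCk+nC[k+1]≡[n+1]C[k+1] n k) ⟩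
  suc (suc n) ℕ.* a ∎
  where
  open ≡.≡-Reasoning
  a = suc n C suc k
  distrib : ∀ k a b → suc (suc k) ℕ.* (a ℕ.+ b) ≡ a ℕ.+ suc k ℕ.* a ℕ.+ suc (suc k) ℕ.* b
  distrib = solve-∀
  collect : ∀ n a b c → a ℕ.+ suc n ℕ.* b ℕ.+ suc n ℕ.* c ≡ a ℕ.+ suc n ℕ.* (b ℕ.+ c)
  collect = solve-∀

-- By absorption p divides k times the coefficient, and 0 < k < p keeps it from dividing k.
prime∣pCk : ∀ {p} → Prime p → ∀ k → 0 ℕ.< k → k ℕ.< p → p ∣ (p C k)
prime∣pCk {suc n} pr (suc k) _ k<p
  with euclidsLemma (suc k) (suc n C suc k) pr
         (divides (n C k) (≡.trans ([1+k]*[1+n]C[1+k]≡[1+n]*nCk n k) (ℕ.*-comm (suc n) (n C k))))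
... | inj₁ p∣k = contradiction (∣⇒≤ p∣k) (ℕ.<⇒≱ k<p)
... | inj₂ p∣C = p∣C

inverse-mod-prime : ∀ {p} → Prime p → ∀ m → 0 ℕ.< m → m ℕ.< p → ∃[ t ] ∃[ u ] t ℕ.* m ≡ 1 ℕ.+ u ℕ.* p
inverse-mod-prime {p} pr m 0<m m<p with coprime-Bézout (prime⇒coprime pr {{ℕ.>-nonZero 0<m}} m<p)
... | Bézout.-+ x y eq = y , x , ≡.sym eq
... | Bézout.+- x y eq = flip p x eq (ℕ.≤-<-trans 0<m m<p)
  where
  -- From y m = x p − 1, the witness is t = (p − 1) y.
  flip : ∀ p x → 1 ℕ.+ y ℕ.* m ≡ x ℕ.* p → 1 ℕ.< p → ∃[ t ] ∃[ u ] t ℕ.* m ≡ 1 ℕ.+ u ℕ.* p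
  flip (suc zero)    _       _  (ℕ.s≤s ())
  flip (suc (suc p)) (suc x) eq _ = suc p ℕ.* y , suc p ℕ.* x ℕ.+ p , (begin
    suc p ℕ.* y ℕ.* m                    ≡⟨ ℕ.*-assoc (suc p) y m ⟩
    suc p ℕ.* (y ℕ.* m)                  ≡⟨ ≡.cong (suc p ℕ.*_) (ℕ.suc-injective eq) ⟩
    suc p ℕ.* (suc p ℕ.+ x ℕ.* suc (suc p)) ≡⟨ expand p x ⟩
    1 ℕ.+ (suc p ℕ.* x ℕ.+ p) ℕ.* suc (suc p) ∎)
    where
    open ≡.≡-Reasoning
    expand : ∀ p x → suc p ℕ.* (suc p ℕ.+ x ℕ.* suc (suc p)) ≡ 1 ℕ.+ (suc p ℕ.* x ℕ.+ p) ℕ.* suc (suc p)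
    expand = solve-∀

-- The sum lies strictly between `suc m` and its double. In `trace-nonzero` this shows that n = q -
-- 1 does not divide (n - 1) + pⁱ for 0 < i < N.
between-multiples : ∀ m P u → 1 ℕ.< P → P ℕ.≤ suc m → m ℕ.+ P ≢ u ℕ.* suc m
between-multiples m P zero 1<P P≤1+m eq =
  ℕ.<⇒≢ (ℕ.<-≤-trans (ℕ.<-trans ℕ.z<s 1<P) (ℕ.m≤n+m P m)) (≡.sym eq)
between-multiples m P (suc zero) 1<P P≤1+m eq =
  ℕ.<⇒≢ (ℕ.+-monoʳ-< m 1<P) (≡.trans (≡.trans (ℕ.+-comm m 1) (≡.sym (ℕ.*-identityˡ (suc m)))) (≡.sym eq))
between-multiples m P (suc (suc u)) 1<P P≤1+m eq = ℕ.<⇒≢ (begin-strict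
  m ℕ.+ P                             <⟨ ℕ.+-mono-<-≤ (ℕ.n<1+n m) P≤1+m ⟩
  suc m ℕ.+ suc m                     ≤⟨ ℕ.+-monoʳ-≤ (suc m) (ℕ.m≤m+n (suc m) (u ℕ.* suc m)) ⟩
  suc m ℕ.+ (suc m ℕ.+ u ℕ.* suc m)   ∎) eq
  where open ℕ.≤-Reasoning

module _ {c ℓ : Level} (R : CommutativeRing c ℓ) where
  open CommutativeRing R hiding (zero)
  open Algebra.Properties.Ring ring
  open Algebra.Properties.Semiring.Exp semiring using (_^_)
  open FiniteSums commutativeSemiring
  open Relation.Binary.Reasoning.Setoid setoid

  -- Multiplication by `h` shifts the terms by one, and h ^ n = 1 closes the circle. The conclusion
  -- stops short of a vanishing sum because the factor h - 1 is cancelled differently in the finite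
  -- field and in `K`.
  geometric-sum : ∀ h n → h ^ n ≈ 1# → h * ∑< n (h ^_) ≈ ∑< n (h ^_)
  geometric-sum h n h^n≈1 = +-cancelˡ 1# _ _ (begin
    1# + h * ∑< n (h ^_)         ≈⟨ +-congˡ (*-distribˡ-sum {n} h (λ k → h ^ toℕ k)) ⟩
    ∑< (suc n) (h ^_)            ≈⟨ ∑<-last n (h ^_) ⟩
    ∑< n (h ^_) + h ^ n          ≈⟨ +-congˡ h^n≈1 ⟩
    ∑< n (h ^_) + 1#             ≈⟨ +-comm _ _ ⟩
    1# + ∑< n (h ^_)             ∎)

-- Frobenius, the absolute trace and the prime field

module Trace {c ℓ : Level} (p N : ℕ) (p-prime : Prime p) (1≤N : 1 ℕ.≤ N)
             (F : FiniteField c ℓ (p ℕ.^ N))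
             (g : FiniteField.Carrier F) (primitive-root : IsPrimitiveRoot F g)
             (n : ℕ) (q≡1+n : p ℕ.^ N ≡ suc n) where
  open FiniteField F hiding (zero)
  open FieldProperties F public
  open PrimitiveRootOrder g primitive-root n q≡1+n public
  open FiniteSums commutativeSemiring
  open Relation.Binary.Reasoning.Setoid ≈-setoid

  instance
    p-nonZero : ℕ.NonZero p
    p-nonZero = prime⇒nonZero p-prime

  1<p : 1 ℕ.< p
  1<p = ℕ.nonTrivial⇒n>1 p {{prime⇒nonTrivial p-prime}}

  p⁻ : ℕ
  p⁻ = ℕ.pred p

  1+p⁻≡p : suc p⁻ ≡ p
  1+p⁻≡p = ℕ.suc-pred p

  0^m≈0 : ∀ m .{{_ : ℕ.NonZero m}} → 0# ^ m ≈ 0#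
  0^m≈0 (suc m) = zeroˡ _

  -- A field has no nilpotent elements, and the N-th power of p · 1 is q · 1 = 0.
  p·1≈0 : p · 1# ≈ 0#
  p·1≈0 with p · 1# ≟ 0#
  ... | yes eq  = eq
  ... | no  neq = contradiction (trans (sym (p^k·1 N)) q·1≈0) (^-nonzero neq N)
    where
    p^k·1 : ∀ k → (p ℕ.^ k) · 1# ≈ (p · 1#) ^ k
    p^k·1 zero    = +-identityʳ 1#
    p^k·1 (suc k) = trans (×1-homo-* p (p ℕ.^ k)) (*-congˡ (p^k·1 k))

  m·x≈[m·1]*x : ∀ m x → m · x ≈ (m · 1#) * x
  m·x≈[m·1]*x m x = sym (trans (×-assoc-* m 1# x) (×-congʳ m (*-identityˡ x)))

  [u*p]·1≈0 : ∀ u → (u ℕ.* p) · 1# ≈ 0#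
  [u*p]·1≈0 u = trans (×1-homo-* u p) (trans (*-congˡ p·1≈0) (zeroʳ _))

  m·1≈[m%p]·1 : ∀ m → m · 1# ≈ (m % p) · 1#
  m·1≈[m%p]·1 m = begin
    m · 1#                                      ≡⟨ ≡.cong (_· 1#) (m≡m%n+[m/n]*n m p) ⟩
    (m % p ℕ.+ m / p ℕ.* p) · 1#                ≈⟨ ×-homo-+ 1# (m % p) _ ⟩
    (m % p) · 1# + (m / p ℕ.* p) · 1#           ≈⟨ +-congˡ ([u*p]·1≈0 (m / p)) ⟩
    (m % p) · 1# + 0#                           ≈⟨ +-identityʳ _ ⟩
    (m % p) · 1#                                ∎

  -- With t an inverse of m modulo p, m · 1 = 0 would give 1 = (t m) · 1 = 0.
  m·1≉0 : ∀ m → 0 ℕ.< m → m ℕ.< p → ¬ (m · 1# ≈ 0#)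
  m·1≉0 m 0<m m<p m·1≈0 with t , u , eq ← inverse-mod-prime p-prime m 0<m m<p = 1≉0 (begin
    1#                          ≈⟨ +-identityʳ 1# ⟨
    1# + 0#                     ≈⟨ +-congˡ ([u*p]·1≈0 u) ⟨
    (1 ℕ.+ u ℕ.* p) · 1#        ≡⟨ ≡.cong (_· 1#) eq ⟨
    (t ℕ.* m) · 1#              ≈⟨ ×1-homo-* t m ⟩
    (t · 1#) * (m · 1#)         ≈⟨ *-congˡ m·1≈0 ⟩
    (t · 1#) * 0#               ≈⟨ zeroʳ _ ⟩
    0#                          ∎)

  private
    ·1-difference : ∀ {i j} → i ℕ.< j → i · 1# ≈ j · 1# → (j ℕ.∸ i) · 1# ≈ 0#
    ·1-difference {i} {j} i<j eq = +-cancelˡ (i · 1#) _ _ (begin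
      i · 1# + (j ℕ.∸ i) · 1#  ≈⟨ ×-homo-+ 1# i (j ℕ.∸ i) ⟨
      (i ℕ.+ (j ℕ.∸ i)) · 1#   ≡⟨ ≡.cong (_· 1#) (ℕ.m+[n∸m]≡n (ℕ.<⇒≤ i<j)) ⟩
      j · 1#                   ≈⟨ eq ⟨
      i · 1#                   ≈⟨ +-identityʳ _ ⟨
      i · 1# + 0#              ∎)

  ·1-injective : ∀ {i j} → i ℕ.< p → j ℕ.< p → i · 1# ≈ j · 1# → i ≡ j
  ·1-injective {i} {j} i<p j<p eq with ℕ.<-cmp i j
  ... | tri≈ _ i≡j _ = i≡j
  ... | tri< i<j _ _ = contradiction (·1-difference i<j eq)
                         (m·1≉0 (j ℕ.∸ i) (ℕ.m<n⇒0<n∸m i<j) (ℕ.≤-<-trans (ℕ.m∸n≤m j i) j<p))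
  ... | tri> _ _ j<i = contradiction (·1-difference j<i (sym eq))
                         (m·1≉0 (i ℕ.∸ j) (ℕ.m<n⇒0<n∸m j<i) (ℕ.≤-<-trans (ℕ.m∸n≤m i j) i<p))

  -- The inner binomial coefficients are multiples of p, which is 0 in the field.
  ^p-+ : ∀ x y → (x + y) ^ p ≈ x ^ p + y ^ p
  ^p-+ x y = begin
    (x + y) ^ p
      ≈⟨ Binomial.theorem p x y ⟩
    ∑< (suc p) term
      ≈⟨ ∑<-last p term ⟩
    ∑< p term + term p
      ≡⟨ ≡.cong (λ k → ∑< k term + term p) (≡.sym 1+p⁻≡p) ⟩
    (term 0 + ∑< p⁻ (term ∘ suc)) + term p
      ≈⟨ +-cong (+-cong term-0 (trans (∑<-cong p⁻ middle) (sum-replicate-zero p⁻))) term-p ⟩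
    (y ^ p + 0#) + x ^ p
      ≈⟨ trans (+-congʳ (+-identityʳ _)) (+-comm _ _) ⟩
    x ^ p + y ^ p ∎
    where
    module Binomial = Algebra.Properties.CommutativeSemiring.Binomial commutativeSemiring
    term : ℕ → Carrier
    term k = (p C k) · (x ^ k * y ^ (p ℕ.∸ k))
    term-0 : term 0 ≈ y ^ p
    term-0 = trans (+-identityʳ _) (*-identityˡ _)
    term-p : term p ≈ x ^ p
    term-p = begin
      (p C p) · (x ^ p * y ^ (p ℕ.∸ p))  ≡⟨ ≡.cong₂ (λ k m → k · (x ^ p * y ^ m)) (nCn≡1 p) (ℕ.n∸n≡0 p) ⟩
      x ^ p * 1# + 0#                    ≈⟨ trans (+-identityʳ _) (*-identityʳ _) ⟩
      x ^ p                              ∎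
    middle : ∀ k → k ℕ.< p⁻ → term (suc k) ≈ 0#
    middle k k<p⁻ with divides u eq ← prime∣pCk p-prime (suc k) (ℕ.s≤s ℕ.z≤n) (≡.subst (suc k ℕ.<_) 1+p⁻≡p (ℕ.s≤s k<p⁻)) = begin
      (p C suc k) · z              ≡⟨ ≡.cong (_· z) eq ⟩
      (u ℕ.* p) · z                ≈⟨ m·x≈[m·1]*x (u ℕ.* p) z ⟩
      ((u ℕ.* p) · 1#) * z         ≈⟨ *-congʳ ([u*p]·1≈0 u) ⟩
      0# * z                       ≈⟨ zeroˡ z ⟩
      0#                           ∎
      where z = x ^ suc k * y ^ (p ℕ.∸ suc k)

  Frob : ℕ → Carrier → Carrier
  Frob d x = x ^ (p ℕ.^ d)

  Frob-cong : ∀ d {x y} → x ≈ y → Frob d x ≈ Frob d y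
  Frob-cong d = ^-congˡ (p ℕ.^ d)

  Frob-suc : ∀ d x → Frob (suc d) x ≈ Frob d (x ^ p)
  Frob-suc d x = sym (^-assocʳ x p (p ℕ.^ d))

  Frob-∘ : ∀ d e x → Frob d (Frob e x) ≈ Frob (d ℕ.+ e) x
  Frob-∘ d e x = trans (^-assocʳ x (p ℕ.^ e) (p ℕ.^ d))
    (^-congʳ x (≡.trans (ℕ.*-comm (p ℕ.^ e) (p ℕ.^ d)) (≡.sym (ℕ.^-distribˡ-+-* p d e))))

  Frob-+ : ∀ d x y → Frob d (x + y) ≈ Frob d x + Frob d y
  Frob-+ zero    x y = trans (*-identityʳ _) (sym (+-cong (*-identityʳ _) (*-identityʳ _)))
  Frob-+ (suc d) x y = begin
    Frob (suc d) (x + y)                ≈⟨ Frob-suc d (x + y) ⟩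
    Frob d ((x + y) ^ p)                ≈⟨ Frob-cong d (^p-+ x y) ⟩
    Frob d (x ^ p + y ^ p)              ≈⟨ Frob-+ d (x ^ p) (y ^ p) ⟩
    Frob d (x ^ p) + Frob d (y ^ p)     ≈⟨ +-cong (Frob-suc d x) (Frob-suc d y) ⟨
    Frob (suc d) x + Frob (suc d) y     ∎

  Frob-0 : ∀ d → Frob d 0# ≈ 0#
  Frob-0 d = 0^m≈0 (p ℕ.^ d) {{ℕ.m^n≢0 p d}}

  Frob-neg : ∀ d x → Frob d (- x) ≈ - Frob d x
  Frob-neg d x = +-inverseʳ-unique (Frob d x) (Frob d (- x))
    (trans (sym (Frob-+ d x (- x))) (trans (Frob-cong d (-‿inverseʳ x)) (Frob-0 d)))

  Frob-sum : ∀ d m (f : ℕ → Carrier) → Frob d (∑< m f) ≈ ∑< m (Frob d ∘ f)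
  Frob-sum d zero    f = Frob-0 d
  Frob-sum d (suc m) f = trans (Frob-+ d _ _) (+-congˡ (Frob-sum d m (f ∘ suc)))

  g^k^n≈1 : ∀ k → (g ^ k) ^ n ≈ 1#
  g^k^n≈1 k = begin
    (g ^ k) ^ n      ≈⟨ ^-assocʳ g k n ⟩
    g ^ (k ℕ.* n)    ≈⟨ ^-congʳ g (ℕ.*-comm k n) ⟩
    g ^ (n ℕ.* k)    ≈⟨ ^-assocʳ g n k ⟨
    (g ^ n) ^ k      ≈⟨ ^-congˡ k g^n≈1 ⟩
    1# ^ k           ≈⟨ 1^n≈1 k ⟩
    1#               ∎

  x^q≈x : ∀ x → Frob N x ≈ x
  x^q≈x x with x ≟ 0#
  ... | yes x≈0 = trans (Frob-cong N x≈0) (trans (Frob-0 N) (sym x≈0))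
  ... | no x≉0  = begin
    x ^ (p ℕ.^ N)         ≈⟨ ^-congʳ x q≡1+n ⟩
    x * x ^ n             ≈⟨ *-congˡ (^-congˡ n (g^log x x≉0)) ⟩
    x * (g ^ k) ^ n       ≈⟨ *-congˡ (g^k^n≈1 k) ⟩
    x * 1#                ≈⟨ *-identityʳ x ⟩
    x                     ∎
    where k = log x x≉0

  Frob-inverse : ∀ d → d ℕ.≤ N → ∀ x → Frob (N ℕ.∸ d) (Frob d x) ≈ x
  Frob-inverse d d≤N x = trans (Frob-∘ (N ℕ.∸ d) d x)
    (trans (^-congʳ x (≡.cong (p ℕ.^_) (ℕ.m∸n+n≡m d≤N))) (x^q≈x x))

  Frob-inverse′ : ∀ d → d ℕ.≤ N → ∀ x → Frob d (Frob (N ℕ.∸ d) x) ≈ x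
  Frob-inverse′ d d≤N x = trans (Frob-∘ d (N ℕ.∸ d) x)
    (trans (^-congʳ x (≡.cong (p ℕ.^_) (ℕ.m+[n∸m]≡n d≤N))) (x^q≈x x))

  Frob-injective : ∀ d → d ℕ.≤ N → ∀ {x y} → Frob d x ≈ Frob d y → x ≈ y
  Frob-injective d d≤N {x} {y} eq =
    trans (sym (Frob-inverse d d≤N x)) (trans (Frob-cong (N ℕ.∸ d) eq) (Frob-inverse d d≤N y))

  tr : Carrier → Carrier
  tr x = ∑< N (λ i → Frob i x)

  Tr≈tr : ∀ x → Tr F p N x ≈ tr x
  Tr≈tr x = reflexive (foldr-upTo≡∑< N (λ i → x ^ (p ℕ.^ i)))

  tr-cong : ∀ {x y} → x ≈ y → tr x ≈ tr y
  tr-cong eq = ∑<-cong N (λ i _ → Frob-cong i eq)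

  tr-+ : ∀ x y → tr (x + y) ≈ tr x + tr y
  tr-+ x y = trans (∑<-cong N (λ i _ → Frob-+ i x y)) (∑-distrib-+ {N} _ _)

  tr-0 : tr 0# ≈ 0#
  tr-0 = trans (∑<-cong N (λ i _ → Frob-0 i)) (sum-replicate-zero N)

  tr-· : ∀ t x → tr (t · x) ≈ t · tr x
  tr-· zero    x = tr-0
  tr-· (suc t) x = trans (tr-+ x (t · x)) (+-congˡ (tr-· t x))

  -- `Frob d` shifts the N conjugates of x cyclically, since the N-th iterate of Frobenius is the
  -- identity.
  tr-Frob : ∀ d x → tr (Frob d x) ≈ tr x
  tr-Frob d x = begin
    ∑< N (λ i → Frob i (Frob d x))    ≈⟨ ∑<-cong N (λ i _ → trans (Frob-∘ i d x) (^-congʳ x (≡.cong (p ℕ.^_) (ℕ.+-comm i d)))) ⟩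
    ∑< N (λ i → Frob (d ℕ.+ i) x)     ≈⟨ ∑<-shift N (λ i → Frob i x) (λ i → trans (sym (Frob-∘ N i x)) (x^q≈x _)) d ⟩
    ∑< N (λ i → Frob i x)             ∎

  tr-fixed : ∀ x → Frob 1 (tr x) ≈ tr x
  tr-fixed x = begin
    Frob 1 (tr x)                     ≈⟨ Frob-sum 1 N (λ i → Frob i x) ⟩
    ∑< N (λ i → Frob 1 (Frob i x))    ≈⟨ ∑<-cong N (λ i _ → Frob-∘ 1 i x) ⟩
    ∑< N (λ i → Frob (suc i) x)       ≈⟨ ∑<-cong N (λ i _ → trans (Frob-∘ i 1 x) (^-congʳ x (≡.cong (p ℕ.^_) (ℕ.+-comm i 1)))) ⟨
    tr (Frob 1 x)                     ≈⟨ tr-Frob 1 x ⟩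
    tr x                              ∎

  -- Here W = (q - 1)/(pᵈ - 1). A fixed g ^ k satisfies g ^ (k e) = 1 with e = pᵈ - 1, so W e
  -- divides k e: the non-zero elements of the subfield are powers of g ^ W.
  fixed⇒∣log : ∀ d e W .{{_ : ℕ.NonZero e}} → p ℕ.^ d ≡ suc e → n ≡ W ℕ.* e →
               ∀ k → Frob d (g ^ k) ≈ g ^ k → W ∣ k
  fixed⇒∣log d e W p^d≡1+e n≡W*e k fixed =
    *-cancelʳ-∣ e (≡.subst (_∣ k ℕ.* e) n≡W*e (g^k≈1⇒n∣k (k ℕ.* e) (g^-cancel k (k ℕ.* e) (begin
      g ^ (k ℕ.+ k ℕ.* e)    ≈⟨ ^-congʳ g (≡.sym (ℕ.*-suc k e)) ⟩
      g ^ (k ℕ.* suc e)      ≈⟨ ^-congʳ g (≡.cong (k ℕ.*_) p^d≡1+e) ⟨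
      g ^ (k ℕ.* p ℕ.^ d)    ≈⟨ ^-assocʳ g k (p ℕ.^ d) ⟨
      Frob d (g ^ k)         ≈⟨ fixed ⟩
      g ^ k                  ∎))))

  instance
    p⁻-nonZero : ℕ.NonZero p⁻
    p⁻-nonZero = ℕ.>-nonZero (ℕ.s≤s⁻¹ (≡.subst (1 ℕ.<_) (≡.sym 1+p⁻≡p) 1<p))

  p^1≡1+p⁻ : p ℕ.^ 1 ≡ suc p⁻
  p^1≡1+p⁻ = ≡.trans (ℕ.*-identityʳ p) (≡.sym 1+p⁻≡p)

  Frob-·1 : ∀ d i → Frob d (i · 1#) ≈ i · 1#
  Frob-·1 d zero    = Frob-0 d
  Frob-·1 d (suc i) = trans (Frob-+ d 1# (i · 1#)) (+-cong (1^n≈1 (p ℕ.^ d)) (Frob-·1 d i))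

  module PrimeField (W : ℕ) (n≡W*p⁻ : n ≡ W ℕ.* p⁻) where
    private
      instance
        W-nonZero : ℕ.NonZero W
        W-nonZero = ℕ.m*n≢0⇒m≢0 W {{≡.subst ℕ.NonZero n≡W*p⁻ n-nonZero}}

      -- Numbers the fixed points of Frobenius below p: 0 gets 0 and (g ^ W) ^ i gets 1 + i. On
      -- other elements the division by `W` rounds, and the value has no meaning.
      index : Carrier → ℕ
      index x with x ≟ 0#
      ... | yes _  = 0
      ... | no x≉0 = suc (log% x x≉0 / W)

      index<p : ∀ x → index x ℕ.< p
      index<p x with x ≟ 0#
      ... | yes _  = ℕ.<-trans ℕ.z<s 1<p
      ... | no x≉0 = ≡.subst (suc (log% x x≉0 / W) ℕ.<_) 1+p⁻≡p
        (ℕ.s≤s (m<n*o⇒m/o<n (≡.subst (log% x x≉0 ℕ.<_) (≡.trans n≡W*p⁻ (ℕ.*-comm W p⁻)) (log%<n x x≉0))))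

      W∣log% : ∀ x (x≉0 : ¬ (x ≈ 0#)) → Frob 1 x ≈ x → W ∣ log% x x≉0
      W∣log% x x≉0 fixed = fixed⇒∣log 1 p⁻ W p^1≡1+p⁻ n≡W*p⁻ (log% x x≉0)
        (trans (Frob-cong 1 (sym (g^log% x x≉0))) (trans fixed (g^log% x x≉0)))

      index-injective : ∀ x y → Frob 1 x ≈ x → Frob 1 y ≈ y → index x ≡ index y → x ≈ y
      index-injective x y fx fy eq with x ≟ 0# | y ≟ 0#
      index-injective x y fx fy eq | yes x≈0 | yes y≈0 = trans x≈0 (sym y≈0)
      index-injective x y fx fy eq | no x≉0  | no y≉0 = begin
        x                  ≈⟨ g^log% x x≉0 ⟩
        g ^ log% x x≉0     ≈⟨ ^-congʳ g (≡.trans (≡.sym (m/n*n≡m (W∣log% x x≉0 fx)))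
                                (≡.trans (≡.cong (ℕ._* W) (ℕ.suc-injective eq)) (m/n*n≡m (W∣log% y y≉0 fy)))) ⟩
        g ^ log% y y≉0     ≈⟨ g^log% y y≉0 ⟨
        y                  ∎

    -- The p elements i · 1 and x would otherwise be p + 1 fixed points of
    -- Frobenius, which has at most p of them.
    fixed⇒∈prime-field : ∀ x → Frob 1 x ≈ x → ∃[ i ] toℕ {p} i · 1# ≈ x
    fixed⇒∈prime-field x fixed with Fin.any? {p} (λ i → toℕ i · 1# ≟ x)
    ... | yes found = found
    ... | no ¬found with Fin.pigeonhole (ℕ.n<1+n p) (λ i → Fin.fromℕ< (index<p (point i)))
      where
      point : Fin (suc p) → Carrier
      point zero    = x
      point (suc i) = toℕ i · 1#
    ... | zero  , suc j , _ , eq = contradiction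
            (j , sym (index-injective _ _ fixed (Frob-·1 1 (toℕ j)) (Fin.fromℕ<-injective _ _ _ _ eq))) ¬found
    ... | suc i , suc j , ℕ.s≤s i<j , eq = contradiction
            (·1-injective (Fin.toℕ<n i) (Fin.toℕ<n j) (index-injective _ _ (Frob-·1 1 (toℕ i)) (Frob-·1 1 (toℕ j)) (Fin.fromℕ<-injective _ _ _ _ eq)))
            (ℕ.<⇒≢ i<j)

    residue-spec : ∀ x → ∃[ i ] toℕ {p} i · 1# ≈ x → residue F p x ℕ.< p × residue F p x · 1# ≈ x
    residue-spec x found with Fin.any? {p} (λ i → toℕ i · 1# ≟ x)
    ... | yes (i , eq) = Fin.toℕ<n i , eq
    ... | no ¬found    = contradiction found ¬found

    -- Defined through `Tr` and not `tr`, so that ζ ^ ρ x unfolds to the same term as the value of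
    -- `eₚ` at the trace in `exponentialSum`.
    ρ : Carrier → ℕ
    ρ x = residue F p (Tr F p N x)

    private
      ρ-spec : ∀ x → ρ x ℕ.< p × ρ x · 1# ≈ Tr F p N x
      ρ-spec x = residue-spec (Tr F p N x) (fixed⇒∈prime-field (Tr F p N x)
        (trans (Frob-cong 1 (Tr≈tr x)) (trans (tr-fixed x) (sym (Tr≈tr x)))))

    ρ<p : ∀ x → ρ x ℕ.< p
    ρ<p = proj₁ ∘ ρ-spec

    ρ·1≈tr : ∀ x → ρ x · 1# ≈ tr x
    ρ·1≈tr x = trans (proj₂ (ρ-spec x)) (Tr≈tr x)

    -- Numbers below p are determined by their images in the field. The compatibility of `ρ` with
    -- sums and multiples modulo p comes from this.
    ·1≈tr⇒%p≡ρ : ∀ x i → i · 1# ≈ tr x → i % p ≡ ρ x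
    ·1≈tr⇒%p≡ρ x i eq = ·1-injective (m%n<n i p) (ρ<p x) (trans (sym (m·1≈[m%p]·1 i)) (trans eq (sym (ρ·1≈tr x))))

    ρ-tr-cong : ∀ {x y} → tr x ≈ tr y → ρ x ≡ ρ y
    ρ-tr-cong {x} {y} eq = ·1-injective (ρ<p x) (ρ<p y) (trans (ρ·1≈tr x) (trans eq (sym (ρ·1≈tr y))))

    ρ-cong : ∀ {x y} → x ≈ y → ρ x ≡ ρ y
    ρ-cong eq = ρ-tr-cong (tr-cong eq)

    ρ-+ : ∀ x y → (ρ x ℕ.+ ρ y) % p ≡ ρ (x + y)
    ρ-+ x y = ·1≈tr⇒%p≡ρ (x + y) (ρ x ℕ.+ ρ y)
      (trans (×-homo-+ 1# (ρ x) (ρ y)) (trans (+-cong (ρ·1≈tr x) (ρ·1≈tr y)) (sym (tr-+ x y))))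

    ρ-· : ∀ t x → (t ℕ.* ρ x) % p ≡ ρ (t · x)
    ρ-· t x = ·1≈tr⇒%p≡ρ (t · x) (t ℕ.* ρ x)
      (trans (sym (×-assocˡ 1# t (ρ x))) (trans (×-congʳ t (ρ·1≈tr x)) (sym (tr-· t x))))

    ρ≡0 : ∀ {x} → tr x ≈ 0# → ρ x ≡ 0
    ρ≡0 {x} eq = ≡.trans (≡.sym (·1≈tr⇒%p≡ρ x 0 (sym eq))) (m<n⇒m%n≡m (ℕ.<-trans ℕ.z<s 1<p))

    ρ≡0⇒tr≈0 : ∀ {x} → ρ x ≡ 0 → tr x ≈ 0#
    ρ≡0⇒tr≈0 {x} eq = trans (sym (ρ·1≈tr x)) (reflexive (≡.cong (_· 1#) eq))

  -- If tr vanished, then so would Σₖ g⁻ᵏ tr(gᵏ); but here the i-th term of tr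
  -- contributes the power sum of g^(pⁱ − 1), which is 0 unless i = 0.
  trace-nonzero : ¬ (∀ k → tr (g ^ k) ≈ 0#)
  trace-nonzero tr≈0 = 1≉0 (begin
    1#
      ≈⟨ solve 2 (λ a b → a := (a :+ b) :- b) refl 1# (n · 1#) ⟩
    suc n · 1# - n · 1#
      ≈⟨ +-cong (trans (reflexive (≡.cong (_· 1#) (≡.sym q≡1+n))) q·1≈0) (-‿cong n·1≈0) ⟩
    0# - 0#
      ≈⟨ -‿inverseʳ 0# ⟩
    0# ∎)
    where
    open Solver using (solve; _:+_; _:-_; _:=_)
    n⁻ N⁻ : ℕ
    n⁻ = ℕ.pred n
    N⁻ = ℕ.pred N
    1+N⁻≡N : suc N⁻ ≡ N
    1+N⁻≡N = ℕ.suc-pred N {{ℕ.>-nonZero 1≤N}}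
    h : ℕ → Carrier
    -- As g has order n, the exponent `n⁻` = n - 1 stands for -1.
    h i = g ^ (n⁻ ℕ.+ p ℕ.^ i)
    term : ∀ k i → g ^ (k ℕ.* n⁻) * Frob i (g ^ k) ≈ h i ^ k
    term k i = begin
      g ^ (k ℕ.* n⁻) * (g ^ k) ^ (p ℕ.^ i)     ≈⟨ *-congˡ (^-assocʳ g k (p ℕ.^ i)) ⟩
      g ^ (k ℕ.* n⁻) * g ^ (k ℕ.* p ℕ.^ i)     ≈⟨ ^-homo-* g (k ℕ.* n⁻) (k ℕ.* p ℕ.^ i) ⟨
      g ^ (k ℕ.* n⁻ ℕ.+ k ℕ.* p ℕ.^ i)         ≈⟨ ^-congʳ g (≡.trans (≡.sym (ℕ.*-distribˡ-+ k n⁻ (p ℕ.^ i))) (ℕ.*-comm k _)) ⟩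
      g ^ ((n⁻ ℕ.+ p ℕ.^ i) ℕ.* k)             ≈⟨ ^-assocʳ g (n⁻ ℕ.+ p ℕ.^ i) k ⟨
      h i ^ k                                  ∎
    h-0 : h 0 ≈ 1#
    h-0 = trans (^-congʳ g (≡.trans (ℕ.+-comm n⁻ 1) (ℕ.suc-pred n))) g^n≈1
    h^n : ∀ i → h i ^ n ≈ 1#
    h^n i = g^k^n≈1 (n⁻ ℕ.+ p ℕ.^ i)
    h-suc : ∀ i → i ℕ.< N⁻ → ¬ (h (suc i) ≈ 1#)
    h-suc i i<N⁻ eq with divides u n⁻+P≡u*n ← g^k≈1⇒n∣k _ eq =
      between-multiples n⁻ P u 1<P (≡.subst (P ℕ.≤_) (≡.sym (ℕ.suc-pred n)) (ℕ.s≤s⁻¹ P<1+n))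
        (≡.trans n⁻+P≡u*n (≡.cong (u ℕ.*_) (≡.sym (ℕ.suc-pred n))))
      where
      P = p ℕ.^ suc i
      1<P : 1 ℕ.< P
      1<P = ℕ.<-≤-trans 1<p (ℕ.m≤m*n p (p ℕ.^ i) {{ℕ.m^n≢0 p i}})
      P<1+n : P ℕ.< suc n
      P<1+n = ≡.subst (P ℕ.<_) q≡1+n (ℕ.^-monoʳ-< p 1<p (≡.subst (suc i ℕ.<_) 1+N⁻≡N (ℕ.s≤s i<N⁻)))
    power-sum-0 : ∑< n (h 0 ^_) ≈ n · 1#
    power-sum-0 = trans (∑<-cong n (λ k _ → trans (^-congˡ k h-0) (1^n≈1 k))) (∑<-const n 1#)
    power-sum-suc : ∀ i → i ℕ.< N⁻ → ∑< n (h (suc i) ^_) ≈ 0#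
    power-sum-suc i i<N⁻ with ∑< n (h (suc i) ^_) ≟ 0#
    ... | yes eq = eq
    ... | no neq = contradiction
      (x≉0⇒*-cancelˡ neq (trans (*-comm _ _) (trans (geometric-sum commutativeRing (h (suc i)) n (h^n (suc i))) (sym (*-identityʳ _)))))
      (h-suc i i<N⁻)
    n·1≈0 : n · 1# ≈ 0#
    n·1≈0 = begin
      n · 1#                                                       ≈⟨ +-identityʳ _ ⟨
      n · 1# + 0#                                                  ≈⟨ +-cong power-sum-0 (trans (∑<-cong N⁻ power-sum-suc) (sum-replicate-zero N⁻)) ⟨
      ∑< (suc N⁻) (λ i → ∑< n (h i ^_))                            ≡⟨ ≡.cong (λ N → ∑< N (λ i → ∑< n (h i ^_))) 1+N⁻≡N ⟩
      ∑< N (λ i → ∑< n (h i ^_))                                   ≈⟨ ∑-comm {N} {n} (λ i k → h (toℕ i) ^ toℕ k) ⟩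
      ∑< n (λ k → ∑< N (λ i → h i ^ k))                            ≈⟨ ∑<-cong n (λ k _ → ∑<-cong N (λ i _ → term k i)) ⟨
      ∑< n (λ k → ∑< N (λ i → g ^ (k ℕ.* n⁻) * Frob i (g ^ k)))    ≈⟨ ∑<-cong n (λ k _ → *-distribˡ-sum {N} (g ^ (k ℕ.* n⁻)) (λ i → Frob (toℕ i) (g ^ k))) ⟨
      ∑< n (λ k → g ^ (k ℕ.* n⁻) * tr (g ^ k))                     ≈⟨ ∑<-cong n (λ k _ → trans (*-congˡ (tr≈0 k)) (zeroʳ (g ^ (k ℕ.* n⁻)))) ⟩
      ∑< n (λ k → 0#)                                              ≈⟨ sum-replicate-zero n ⟩
      0#                                                           ∎

-- The parity of the number of fourth powers of trace 1

module TraceOneParity {c ℓ : Level} (p N : ℕ) (p-prime : Prime p) (1≤N : 1 ℕ.≤ N) (2<p : 2 ℕ.< p)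
             (F : FiniteField c ℓ (p ℕ.^ N))
             (g : FiniteField.Carrier F) (primitive-root : IsPrimitiveRoot F g)
             (m : ℕ) (q≡1+4m : p ℕ.^ N ≡ suc (m ℕ.* 4))
             (W : ℕ) (4m≡W*p⁻ : m ℕ.* 4 ≡ W ℕ.* ℕ.pred p) where
  open FiniteField F hiding (zero)
  open Trace p N p-prime 1≤N F g primitive-root (m ℕ.* 4) q≡1+4m public
  open PrimeField W 4m≡W*p⁻ public
  open Relation.Binary.Reasoning.Setoid ≈-setoid
  open FiniteSums ℕ.+-*-commutativeSemiring
  open SumOver ℕ.+-*-commutativeSemiring

  private instance
    m-nonZero : ℕ.NonZero m
    m-nonZero = ℕ.m*n≢0⇒m≢0 m {{n-nonZero}}

  g^[4i]^m≈1 : ∀ i → (g ^ (i ℕ.* 4)) ^ m ≈ 1#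
  g^[4i]^m≈1 i = begin
    (g ^ (i ℕ.* 4)) ^ m     ≈⟨ ^-assocʳ g (i ℕ.* 4) m ⟩
    g ^ (i ℕ.* 4 ℕ.* m)     ≈⟨ ^-congʳ g (arith i m) ⟩
    g ^ (i ℕ.* (m ℕ.* 4))   ≈⟨ ^-assocʳ g i (m ℕ.* 4) ⟨
    (g ^ i) ^ (m ℕ.* 4)     ≈⟨ g^k^n≈1 i ⟩
    1#                      ∎
    where
    arith : ∀ i m → i ℕ.* 4 ℕ.* m ≡ i ℕ.* (m ℕ.* 4)
    arith = solve-∀

  g^[4i+j]^m≈g^[j*m] : ∀ i j → (g ^ (i ℕ.* 4 ℕ.+ j)) ^ m ≈ g ^ (j ℕ.* m)
  g^[4i+j]^m≈g^[j*m] i j = begin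
    (g ^ (i ℕ.* 4 ℕ.+ j)) ^ m                ≈⟨ ^-congˡ m (^-homo-* g (i ℕ.* 4) j) ⟩
    (g ^ (i ℕ.* 4) * g ^ j) ^ m              ≈⟨ ^-distrib-* (g ^ (i ℕ.* 4)) (g ^ j) m ⟩
    (g ^ (i ℕ.* 4)) ^ m * (g ^ j) ^ m        ≈⟨ *-cong (g^[4i]^m≈1 i) (^-assocʳ g j m) ⟩
    1# * g ^ (j ℕ.* m)                       ≈⟨ *-identityˡ _ ⟩
    g ^ (j ℕ.* m)                            ∎

  -- `g ^ m` has order 4. So the m-th power, the quartic residue symbol, tells the four classes
  -- apart.
  g^[j*m]-injective : ∀ i j → i ℕ.< 4 → j ℕ.< 4 → g ^ (i ℕ.* m) ≈ g ^ (j ℕ.* m) → i ≡ j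
  g^[j*m]-injective i j i<4 j<4 eq = ℕ.*-cancelʳ-≡ i j m
    (g^-injective (i ℕ.* m) (j ℕ.* m) (bound i i<4) (bound j j<4) eq)
    where
    bound : ∀ i → i ℕ.< 4 → i ℕ.* m ℕ.< m ℕ.* 4
    bound i i<4 = ≡.subst (i ℕ.* m ℕ.<_) (ℕ.*-comm 4 m) (ℕ.*-monoˡ-< m i<4)

  module _ {c′ ℓ′ : Level} (R : CommutativeSemiring c′ ℓ′) where
    private
      module R = CommutativeSemiring R
      module ∑R = FiniteSums R
      module F∑R = SumOver R

    -- The class of g^(4i + j) is recognised by its m-th power g^(jm).
    ∑F-class : ∀ (f : Carrier → R.Carrier) → f Preserves _≈_ ⟶ R._≈_ → ∀ j → j ℕ.< 4 →
               F∑R.∑F (λ x → ∑R.[ x ^ m ≟ g ^ (j ℕ.* m) ] R.* f x)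
                 R.≈ ∑R.∑< m (λ i → f (g ^ (i ℕ.* 4 ℕ.+ j)))
    ∑F-class f f-cong j j<4 =
      R.trans (∑F-by-powers R h h-cong)
      (R.trans (R.+-cong h-0 (∑R.∑<-mod4 m (λ k → h (g ^ k))))
      (R.trans (R.+-identityˡ _)
      (R.trans (∑R.∑<-cong 4 class)
      (∑R.∑<-select 4 j j<4 (λ j′ → ∑R.∑< m (λ i → f (g ^ (i ℕ.* 4 ℕ.+ j′))))))))
      where
      h : Carrier → R.Carrier
      h x = ∑R.[ x ^ m ≟ g ^ (j ℕ.* m) ] R.* f x
      h-cong : h Preserves _≈_ ⟶ R._≈_
      h-cong {x} {y} eq = R.*-cong
        (∑R.[]-cong (x ^ m ≟ g ^ (j ℕ.* m)) (y ^ m ≟ g ^ (j ℕ.* m))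
          (trans (^-congˡ m (sym eq))) (trans (^-congˡ m eq)))
        (f-cong eq)
      h-0 : h 0# R.≈ R.0#
      h-0 = R.trans (R.*-congʳ (∑R.[]-no (0# ^ m ≟ g ^ (j ℕ.* m))
        (λ eq → ^-nonzero g≉0 (j ℕ.* m) (trans (sym eq) (0^m≈0 m))))) (R.zeroˡ _)
      indicator : ∀ j′ → j′ ℕ.< 4 → ∀ i →
                  ∑R.[ (g ^ (i ℕ.* 4 ℕ.+ j′)) ^ m ≟ g ^ (j ℕ.* m) ] R.≈ ∑R.[ j′ ℕ.≟ j ]
      indicator j′ j′<4 i = ∑R.[]-cong ((g ^ (i ℕ.* 4 ℕ.+ j′)) ^ m ≟ g ^ (j ℕ.* m)) (j′ ℕ.≟ j)
        (λ eq → g^[j*m]-injective j′ j j′<4 j<4 (trans (sym (g^[4i+j]^m≈g^[j*m] i j′)) eq))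
        (λ eq → trans (g^[4i+j]^m≈g^[j*m] i j′) (^-congʳ g (≡.cong (ℕ._* m) eq)))
      class : ∀ j′ → j′ ℕ.< 4 → ∑R.∑< m (λ i → h (g ^ (i ℕ.* 4 ℕ.+ j′)))
                R.≈ ∑R.[ j′ ℕ.≟ j ] R.* ∑R.∑< m (λ i → f (g ^ (i ℕ.* 4 ℕ.+ j′)))
      class j′ j′<4 = R.trans
        (∑R.∑<-cong m {g = λ i → ∑R.[ j′ ℕ.≟ j ] R.* f (g ^ (i ℕ.* 4 ℕ.+ j′))} (λ i _ → R.*-congʳ (indicator j′ j′<4 i)))
        (R.sym (∑R.*-distribˡ-sum {m} ∑R.[ j′ ℕ.≟ j ] (λ i → f (g ^ (toℕ i ℕ.* 4 ℕ.+ j′)))))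

  4∣k⇒g^k^m≈1 : ∀ k → 4 ∣ k → (g ^ k) ^ m ≈ 1#
  4∣k⇒g^k^m≈1 k (divides i eq) = trans (^-congˡ m (^-congʳ g eq)) (g^[4i]^m≈1 i)

  -- Indicator of the fourth powers x ≠ 0 of trace 1.
  u : Carrier → ℕ
  u x = [ x ^ m ≟ 1# ] ℕ.* [ ρ x ℕ.≟ 1 ]

  u-cong : u Preserves _≈_ ⟶ _≡_
  u-cong {x} {y} eq = ≡.cong₂ ℕ._*_
    ([]-cong (x ^ m ≟ 1#) (y ^ m ≟ 1#) (trans (^-congˡ m (sym eq))) (trans (^-congˡ m eq)))
    (≡.cong (λ r → [ r ℕ.≟ 1 ]) (ρ-cong eq))

  ∑F-u : ∑F u ≡ ∑< m (λ i → [ ρ (g ^ (i ℕ.* 4 ℕ.+ 0)) ℕ.≟ 1 ])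
  ∑F-u = ∑F-class ℕ.+-*-commutativeSemiring (λ x → [ ρ x ℕ.≟ 1 ])
    (λ eq → ≡.cong (λ r → [ r ℕ.≟ 1 ]) (ρ-cong eq)) 0 (ℕ.s≤s ℕ.z≤n)

  u-Frob : ∀ d → d ℕ.≤ N → ∀ x → u (Frob d x) ≡ u x
  u-Frob d d≤N x = ≡.cong₂ ℕ._*_
    ([]-cong (Frob d x ^ m ≟ 1#) (x ^ m ≟ 1#) backward (forward d x))
    (≡.cong (λ r → [ r ℕ.≟ 1 ]) (ρ-tr-cong (tr-Frob d x)))
    where
    forward : ∀ d x → x ^ m ≈ 1# → Frob d x ^ m ≈ 1#
    forward d x eq = begin
      (x ^ (p ℕ.^ d)) ^ m    ≈⟨ ^-assocʳ x (p ℕ.^ d) m ⟩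
      x ^ (p ℕ.^ d ℕ.* m)    ≈⟨ ^-congʳ x (ℕ.*-comm (p ℕ.^ d) m) ⟩
      x ^ (m ℕ.* p ℕ.^ d)    ≈⟨ ^-assocʳ x m (p ℕ.^ d) ⟨
      (x ^ m) ^ (p ℕ.^ d)    ≈⟨ ^-congˡ (p ℕ.^ d) eq ⟩
      1# ^ (p ℕ.^ d)         ≈⟨ 1^n≈1 (p ℕ.^ d) ⟩
      1#                     ∎
    -- The inverse of `Frob d` is again a power of Frobenius, so `forward` applies to it.
    backward : Frob d x ^ m ≈ 1# → x ^ m ≈ 1#
    backward eq = trans (^-congˡ m (sym (Frob-inverse d d≤N x))) (forward (N ℕ.∸ d) (Frob d x) eq)

  -- fixed-u d restricts u to the subfield with pᵈ elements.
  fixed-u : ℕ → Carrier → ℕ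
  fixed-u d x = [ Frob d x ≟ x ] ℕ.* u x

  fixed-u-cong : ∀ d → fixed-u d Preserves _≈_ ⟶ _≡_
  fixed-u-cong d {x} {y} eq = ≡.cong₂ ℕ._*_
    ([]-cong (Frob d x ≟ x) (Frob d y ≟ y)
      (λ e → trans (Frob-cong d (sym eq)) (trans e eq))
      (λ e → trans (Frob-cong d eq) (trans e (sym eq))))
    (u-cong eq)

  ∑F-fixed-u-N : ∑F u ≡ ∑F (fixed-u N)
  ∑F-fixed-u-N = ∑F-cong (λ x → ≡.sym (≡.trans
    (≡.cong (ℕ._* u x) ([]-yes (Frob N x ≟ x) (x^q≈x x))) (ℕ.*-identityˡ (u x))))

  -- On the subfield with p ^ (d + d) elements `Frob d` is an involution whose fixed points form the
  -- subfield with p ^ d elements. Elsewhere the summand is 0, which is why `involution-parity` asks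
  -- for an involution on the support only.
  fixed-u-halve : ∀ d → d ℕ.≤ N → ∃[ k ] ∑F (fixed-u (d ℕ.+ d)) ≡ k ℕ.+ k ℕ.+ ∑F (fixed-u d)
  fixed-u-halve d d≤N = proj₁ parity ,
    ≡.trans (proj₂ parity) (≡.cong (proj₁ parity ℕ.+ proj₁ parity ℕ.+_) (∑F-cong restrict))
    where
    commute : ∀ x → Frob (d ℕ.+ d) (Frob d x) ≈ Frob d (Frob (d ℕ.+ d) x)
    commute x = trans (Frob-∘ (d ℕ.+ d) d x) (trans (^-congʳ x (≡.cong (p ℕ.^_) (ℕ.+-assoc d d d))) (sym (Frob-∘ d (d ℕ.+ d) x)))
    invariant : ∀ x → fixed-u (d ℕ.+ d) (Frob d x) ≡ fixed-u (d ℕ.+ d) x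
    invariant x = ≡.cong₂ ℕ._*_
      ([]-cong (Frob (d ℕ.+ d) (Frob d x) ≟ Frob d x) (Frob (d ℕ.+ d) x ≟ x)
        (λ e → Frob-injective d d≤N (trans (sym (commute x)) e))
        (λ e → trans (commute x) (Frob-cong d e)))
      (u-Frob d d≤N x)
    involutive : ∀ x → fixed-u (d ℕ.+ d) x ≢ 0 → Frob d (Frob d x) ≈ x
    involutive x nz = decide (Frob (d ℕ.+ d) x ≟ x)
      where
      decide : Dec (Frob (d ℕ.+ d) x ≈ x) → Frob d (Frob d x) ≈ x
      decide (yes e) = trans (Frob-∘ d d x) e
      decide (no ¬e) = contradiction (≡.cong (ℕ._* u x) ([]-no (Frob (d ℕ.+ d) x ≟ x) ¬e)) nz
    restrict : ∀ x → [ Frob d x ≟ x ] ℕ.* fixed-u (d ℕ.+ d) x ≡ fixed-u d x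
    restrict x = []-*-cong (Frob d x ≟ x) (λ e → ≡.trans
      (≡.cong (ℕ._* u x) ([]-yes (Frob (d ℕ.+ d) x ≟ x) (trans (sym (Frob-∘ d d x)) (trans (Frob-cong d e) e))))
      (ℕ.*-identityˡ (u x)))
    parity = involution-parity (fixed-u (d ℕ.+ d)) (fixed-u-cong (d ℕ.+ d))
      (Frob d) (Frob (N ℕ.∸ d)) (Frob-cong d) (Frob-cong (N ℕ.∸ d))
      (Frob-inverse′ d d≤N) (Frob-inverse d d≤N) invariant involutive

  -- `trace-nonzero` merely refutes a universal statement; a search through the finitely many powers
  -- of g extracts a witness from it.
  fixed-point-N : ∃[ x ] (Frob N x ≈ x × ¬ (tr x ≈ 0#))
  fixed-point-N with Fin.any? {m ℕ.* 4} (λ k → ¬? (tr (g ^ toℕ k) ≟ 0#))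
  ... | yes (k , tr≉0) = g ^ toℕ k , x^q≈x _ , tr≉0
  ... | no none = contradiction tr≈0 trace-nonzero
    where
    tr≈0 : ∀ k → tr (g ^ k) ≈ 0#
    tr≈0 k with tr (g ^ k) ≟ 0#
    ... | yes eq = eq
    ... | no neq = contradiction (Fin.fromℕ< k%n< , λ eq → neq (trans (tr-cong g^k≈) eq)) none
      where
      k%n< = m%n<n k (m ℕ.* 4)
      g^k≈ : g ^ k ≈ g ^ toℕ (Fin.fromℕ< k%n<)
      g^k≈ = trans (g^-% (m ℕ.* 4) g^n≈1 k) (^-congʳ g (≡.sym (Fin.toℕ-fromℕ< k%n<)))

  2·x≉0 : ∀ {x} → ¬ (x ≈ 0#) → ¬ (x + x ≈ 0#)
  2·x≉0 {x} x≉0 eq = *-nonzero (m·1≉0 2 (ℕ.s≤s ℕ.z≤n) 2<p) x≉0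
    (trans (sym (m·x≈[m·1]*x 2 x)) (trans (+-congˡ (+-identityʳ x)) eq))

  -- The witness is the relative trace of x down to the smaller subfield. Its absolute trace is
  -- twice that of x, and p is odd.
  fixed-point-halve : ∀ d → ∃[ x ] (Frob (d ℕ.+ d) x ≈ x × ¬ (tr x ≈ 0#)) →
                      ∃[ x ] (Frob d x ≈ x × ¬ (tr x ≈ 0#))
  fixed-point-halve d (x , fixed , tr≉0) = x + Frob d x ,
    (begin
      Frob d (x + Frob d x)            ≈⟨ Frob-+ d x (Frob d x) ⟩
      Frob d x + Frob d (Frob d x)     ≈⟨ +-congˡ (trans (Frob-∘ d d x) fixed) ⟩
      Frob d x + x                     ≈⟨ +-comm _ _ ⟩
      x + Frob d x                     ∎) ,
    λ eq → 2·x≉0 tr≉0 (trans (sym (trans (tr-+ x (Frob d x)) (+-congˡ (tr-Frob d x)))) eq)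

  Frob-· : ∀ d t x → Frob d (t · x) ≈ t · Frob d x
  Frob-· d zero    x = Frob-0 d
  Frob-· d (suc t) x = trans (Frob-+ d x (t · x)) (+-congˡ (Frob-· d t x))

  -- Scaling by an inverse of `ρ x` modulo p normalises the trace to 1, and a multiple `t · x` stays
  -- fixed by `Frob d`.
  trace-one-point : ∀ d → ∃[ x ] (Frob d x ≈ x × ¬ (tr x ≈ 0#)) → ∃[ x ] (Frob d x ≈ x × ρ x ≡ 1)
  trace-one-point d (x , fixed , tr≉0)
    with t , v , eq ← inverse-mod-prime p-prime (ρ x) (ℕ.n≢0⇒n>0 (λ ρ≡0 → tr≉0 (ρ≡0⇒tr≈0 ρ≡0))) (ρ<p x) =
    t · x , trans (Frob-· d t x) (×-congʳ t fixed) ,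
    ≡.trans (≡.sym (ρ-· t x)) (≡.trans (≡.cong (_% p) eq) (≡.trans ([m+kn]%n≡m%n 1 v p) (m<n⇒m%n≡m 1<p)))

  -- The reflection x ↦ 2 x₁ − x in a point x₁ of trace 1 has x₁ as its only
  -- fixed point.
  fixed-u-odd : ∀ d → ∃[ x ] (Frob d x ≈ x × ¬ (tr x ≈ 0#)) →
                (∀ x → ¬ (x ≈ 0#) → Frob d x ≈ x → x ^ m ≈ 1#) →
                ∃[ k ] ∑F (fixed-u d) ≡ k ℕ.+ k ℕ.+ 1
  fixed-u-odd d point fourth-powers = k , ≡.trans (∑F-cong u≡v) (≡.trans eq (≡.cong (k ℕ.+ k ℕ.+_)
      (≡.trans (∑F-cong (λ x → ≡.cong (ℕ._* v x) ([]-cong (σ x ≟ x) (x ≟ x₁) σ-fixed (σ-fix x))))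
      (≡.trans (∑F-select x₁ v v-cong) v₁≡1))))
    where
    open Solver using (solve; _:+_; _:-_; _:=_)
    x₁ = proj₁ (trace-one-point d point)
    fixed₁ = proj₁ (proj₂ (trace-one-point d point))
    ρ₁≡1 = proj₂ (proj₂ (trace-one-point d point))
    σ : Carrier → Carrier
    σ x = x₁ + x₁ - x
    σ-cong : σ Preserves _≈_ ⟶ _≈_
    σ-cong eq = +-congˡ (-‿cong eq)
    σσ : ∀ x → σ (σ x) ≈ x
    σσ x = solve 2 (λ a x → a :+ a :- (a :+ a :- x) := x) refl x₁ x
    v : Carrier → ℕ
    v x = [ Frob d x ≟ x ] ℕ.* [ ρ x ℕ.≟ 1 ]
    v-cong : v Preserves _≈_ ⟶ _≡_
    v-cong {x} {y} eq = ≡.cong₂ ℕ._*_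
      ([]-cong (Frob d x ≟ x) (Frob d y ≟ y)
        (λ e → trans (Frob-cong d (sym eq)) (trans e eq))
        (λ e → trans (Frob-cong d eq) (trans e (sym eq))))
      (≡.cong (λ r → [ r ℕ.≟ 1 ]) (ρ-cong eq))
    u≡v : ∀ x → fixed-u d x ≡ v x
    u≡v x = []-*-cong (Frob d x ≟ x) (λ e → decide e (x ≟ 0#))
      where
      decide : Frob d x ≈ x → Dec (x ≈ 0#) → u x ≡ [ ρ x ℕ.≟ 1 ]
      decide e (no x≉0)  = ≡.trans
        (≡.cong (ℕ._* [ ρ x ℕ.≟ 1 ]) ([]-yes (x ^ m ≟ 1#) (fourth-powers x x≉0 e))) (ℕ.*-identityˡ _)
      decide e (yes x≈0) = ≡.trans
        (≡.cong ([ x ^ m ≟ 1# ] ℕ.*_) ρx≢1) (≡.trans (ℕ.*-zeroʳ [ x ^ m ≟ 1# ]) (≡.sym ρx≢1))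
        where
        ρx≢1 : [ ρ x ℕ.≟ 1 ] ≡ 0
        ρx≢1 = []-no (ρ x ℕ.≟ 1) (λ eq → contradiction (≡.trans (≡.sym (ρ≡0 (trans (tr-cong x≈0) tr-0))) eq) λ ())
    Frob-σ : ∀ x → Frob d x ≈ x → Frob d (σ x) ≈ σ x
    Frob-σ x e = begin
      Frob d (x₁ + x₁ - x)                   ≈⟨ Frob-+ d (x₁ + x₁) (- x) ⟩
      Frob d (x₁ + x₁) + Frob d (- x)        ≈⟨ +-cong (Frob-+ d x₁ x₁) (Frob-neg d x) ⟩
      Frob d x₁ + Frob d x₁ - Frob d x       ≈⟨ +-cong (+-cong fixed₁ fixed₁) (-‿cong e) ⟩
      σ x                                    ∎
    tr-σ : ∀ x → ρ x ≡ 1 → ρ (σ x) ≡ 1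
    tr-σ x e = ≡.trans (ρ-tr-cong (begin
      tr (σ x)                     ≈⟨ solve 2 (λ a b → a := a :+ b :- b) refl (tr (σ x)) (tr x) ⟩
      tr (σ x) + tr x - tr x       ≈⟨ +-cong (tr-+ (σ x) x) refl ⟨
      tr (σ x + x) - tr x          ≈⟨ +-congʳ (tr-cong (solve 2 (λ a x → a :+ a :- x :+ x := a :+ a) refl x₁ x)) ⟩
      tr (x₁ + x₁) - tr x          ≈⟨ +-cong (tr-+ x₁ x₁) (-‿cong tr-x) ⟩
      tr x₁ + tr x₁ - tr x₁        ≈⟨ solve 1 (λ a → a :+ a :- a := a) refl (tr x₁) ⟩
      tr x₁                        ∎)) ρ₁≡1
      where
      tr-x : tr x ≈ tr x₁
      tr-x = trans (sym (ρ·1≈tr x)) (trans (reflexive (≡.cong (_· 1#) (≡.trans e (≡.sym ρ₁≡1)))) (ρ·1≈tr x₁))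
    v-σ : ∀ x → v (σ x) ≡ v x
    v-σ x = ≡.cong₂ ℕ._*_
      ([]-cong (Frob d (σ x) ≟ σ x) (Frob d x ≟ x)
        (λ e → trans (Frob-cong d (sym (σσ x))) (trans (Frob-σ (σ x) e) (σσ x)))
        (Frob-σ x))
      ([]-cong (ρ (σ x) ℕ.≟ 1) (ρ x ℕ.≟ 1)
        (λ e → ≡.trans (ρ-cong (sym (σσ x))) (tr-σ (σ x) e))
        (tr-σ x))
    σ-fixed : ∀ {x} → σ x ≈ x → x ≈ x₁
    σ-fixed {x} e = decide (x - x₁ ≟ 0#)
      where
      decide : Dec (x - x₁ ≈ 0#) → x ≈ x₁
      decide (yes x-x₁≈0) = trans (solve 2 (λ a x → x := x :- a :+ a) refl x₁ x) (trans (+-congʳ x-x₁≈0) (+-identityˡ x₁))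
      decide (no x-x₁≉0)  = contradiction (begin
        (x - x₁) + (x - x₁)       ≈⟨ solve 2 (λ a x → (x :- a) :+ (x :- a) := x :- (a :+ a :- x)) refl x₁ x ⟩
        x - σ x                   ≈⟨ +-congˡ (-‿cong e) ⟩
        x - x                     ≈⟨ -‿inverseʳ x ⟩
        0#                        ∎) (2·x≉0 x-x₁≉0)
    σ-fix : ∀ x → x ≈ x₁ → σ x ≈ x
    σ-fix x e = trans (+-congˡ (-‿cong e)) (trans (solve 1 (λ a → a :+ a :- a := a) refl x₁) (sym e))
    v₁≡1 : v x₁ ≡ 1
    v₁≡1 = ≡.cong₂ ℕ._*_ ([]-yes (Frob d x₁ ≟ x₁) fixed₁) ([]-yes (ρ x₁ ℕ.≟ 1) ρ₁≡1)
    parity = involution-parity v v-cong σ σ σ-cong σ-cong σσ σσ v-σ (λ x _ → σσ x)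
    k = proj₁ parity
    eq = proj₂ parity

-- The additive character and its orthogonality

module CharacterSums {c ℓ c′ ℓ′ : Level} (p N : ℕ) (p-prime : Prime p) (1≤N : 1 ℕ.≤ N) (2<p : 2 ℕ.< p)
             (F : FiniteField c ℓ (p ℕ.^ N))
             (g : FiniteField.Carrier F) (primitive-root : IsPrimitiveRoot F g)
             (m : ℕ) (q≡1+4m : p ℕ.^ N ≡ suc (m ℕ.* 4))
             (W : ℕ) (4m≡W*p⁻ : m ℕ.* 4 ≡ W ℕ.* ℕ.pred p)
             (K : Char0DomainWithRoot c′ ℓ′ p) where
  private
    module F = FiniteField F
    module T = TraceOneParity p N p-prime 1≤N 2<p F g primitive-root m q≡1+4m W 4m≡W*p⁻
  open T using (ρ; p-nonZero)
  open Char0DomainWithRoot K hiding (zero)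
  open Algebra.Properties.Ring ring
  open SemiringPowers commutativeSemiring hiding (_^_)
  open IntegerMultiples commutativeRing public
  open FiniteSums commutativeSemiring
  module ∑ℕ = FiniteSums ℕ.+-*-commutativeSemiring
  open Relation.Binary.Reasoning.Setoid setoid

  x≈1+x-1 : ∀ x → x ≈ 1# + x - 1#
  x≈1+x-1 x = solve 2 (λ x o → x := o :+ x :- o) refl x 1#
    where open Solver

  ι≈0⇒≡0 : ∀ i → ι i ≈ 0# → i ≡ ℤ.0ℤ
  ι≈0⇒≡0 (pos zero)    eq = ≡.refl
  ι≈0⇒≡0 (pos (suc n)) eq = contradiction eq (char0 n)
  ι≈0⇒≡0 -[1+ n ]      eq = contradiction (trans (sym (-‿involutive _)) (trans (-‿cong eq) -0#≈0#)) (char0 n)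

  ι-injective : ∀ {i j} → ι i ≈ ι j → i ≡ j
  ι-injective {i} {j} eq = ℤ.i-j≡0⇒i≡j i j (ι≈0⇒≡0 (i ℤ.- j)
    (trans (ι-+ i (ℤ.- j)) (trans (+-congˡ (ι-neg j)) (x≈y⇒x∙y⁻¹≈ε eq))))

  -- The cancellation law for the factor h - 1. It makes the sums over roots of unity and over the
  -- whole character vanish.
  hx≈x⇒x≈0 : ∀ {h x} → ¬ (h ≈ 1#) → h * x ≈ x → x ≈ 0#
  hx≈x⇒x≈0 {h} {x} h≉1 eq = *-cancel (h - 1#) x 0# (λ e → h≉1 (x∙y⁻¹≈ε⇒x≈y h 1# e)) (begin
    (h - 1#) * x    ≈⟨ solve 3 (λ h o x → (h :- o) :* x := h :* x :- o :* x) refl h 1# x ⟩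
    h * x - 1# * x  ≈⟨ +-congˡ (-‿cong (*-identityˡ x)) ⟩
    h * x - x       ≈⟨ x≈y⇒x∙y⁻¹≈ε eq ⟩
    0#              ≈⟨ zeroʳ _ ⟨
    (h - 1#) * 0#   ∎)
    where open Solver

  ζ^i≈ζ^[i%p] : ∀ i → ζ ^ i ≈ ζ ^ (i % p)
  ζ^i≈ζ^[i%p] i = begin
    ζ ^ i                                ≈⟨ ^-congʳ ζ (m≡m%n+[m/n]*n i p) ⟩
    ζ ^ (i % p ℕ.+ i / p ℕ.* p)          ≈⟨ ^-homo-* ζ (i % p) (i / p ℕ.* p) ⟩
    ζ ^ (i % p) * ζ ^ (i / p ℕ.* p)      ≈⟨ *-congˡ (^-congʳ ζ (ℕ.*-comm (i / p) p)) ⟩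
    ζ ^ (i % p) * ζ ^ (p ℕ.* (i / p))    ≈⟨ *-congˡ (^-assocʳ ζ p (i / p)) ⟨
    ζ ^ (i % p) * (ζ ^ p) ^ (i / p)      ≈⟨ *-congˡ (trans (^-congˡ (i / p) ζᵖ≈1) (1^n≈1 (i / p))) ⟩
    ζ ^ (i % p) * 1#                     ≈⟨ *-identityʳ _ ⟩
    ζ ^ (i % p)                          ∎

  -- ζ is a power of ζ ^ r: raise it to an inverse t of r modulo p.
  ζ^r≉1 : ∀ r → 0 ℕ.< r → r ℕ.< p → ¬ (ζ ^ r ≈ 1#)
  ζ^r≉1 r 0<r r<p eq with t , v , tr≡1+vp ← inverse-mod-prime p-prime r 0<r r<p = ζ≉1 (begin
    ζ                         ≈⟨ *-identityʳ ζ ⟨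
    ζ ^ 1                     ≈⟨ ^-congʳ ζ (≡.trans ([m+kn]%n≡m%n 1 v p) (m<n⇒m%n≡m T.1<p)) ⟨
    ζ ^ ((1 ℕ.+ v ℕ.* p) % p) ≈⟨ ζ^i≈ζ^[i%p] (1 ℕ.+ v ℕ.* p) ⟨
    ζ ^ (1 ℕ.+ v ℕ.* p)       ≈⟨ ^-congʳ ζ (≡.trans (≡.sym tr≡1+vp) (ℕ.*-comm t r)) ⟩
    ζ ^ (r ℕ.* t)             ≈⟨ ^-assocʳ ζ r t ⟨
    (ζ ^ r) ^ t               ≈⟨ ^-congˡ t eq ⟩
    1# ^ t                    ≈⟨ 1^n≈1 t ⟩
    1#                        ∎)

  ζ^r^p≈1 : ∀ r → (ζ ^ r) ^ p ≈ 1#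
  ζ^r^p≈1 r = begin
    (ζ ^ r) ^ p      ≈⟨ ^-assocʳ ζ r p ⟩
    ζ ^ (r ℕ.* p)    ≈⟨ ^-congʳ ζ (ℕ.*-comm r p) ⟩
    ζ ^ (p ℕ.* r)    ≈⟨ ^-assocʳ ζ p r ⟨
    (ζ ^ p) ^ r      ≈⟨ ^-congˡ r ζᵖ≈1 ⟩
    1# ^ r           ≈⟨ 1^n≈1 r ⟩
    1#               ∎

  ∑ζ^rt : ∀ r → r ℕ.< p → ∑< p ((ζ ^ r) ^_) ≈ [ r ℕ.≟ 0 ] * ι (pos p)
  ∑ζ^rt zero _ = begin
    ∑< p (1# ^_)          ≈⟨ ∑<-cong p (λ t _ → 1^n≈1 t) ⟩
    ∑< p (λ _ → 1#)       ≈⟨ ∑<-const p 1# ⟩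
    p · 1#                ≈⟨ *-identityˡ _ ⟨
    1# * (p · 1#)         ∎
  ∑ζ^rt (suc r) r<p = trans
    (hx≈x⇒x≈0 (ζ^r≉1 (suc r) ℕ.z<s r<p) (geometric-sum commutativeRing (ζ ^ suc r) p (ζ^r^p≈1 (suc r))))
    (sym (zeroˡ _))

  ψ : F.Carrier → Carrier
  ψ x = ζ ^ ρ x

  ψ-cong : ψ Preserves F._≈_ ⟶ _≈_
  ψ-cong eq = ^-congʳ ζ (T.ρ-cong eq)

  ψ-+ : ∀ x y → ψ (x F.+ y) ≈ ψ x * ψ y
  ψ-+ x y = begin
    ζ ^ ρ (x F.+ y)             ≈⟨ ^-congʳ ζ (T.ρ-+ x y) ⟨
    ζ ^ ((ρ x ℕ.+ ρ y) % p)     ≈⟨ ζ^i≈ζ^[i%p] (ρ x ℕ.+ ρ y) ⟨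
    ζ ^ (ρ x ℕ.+ ρ y)           ≈⟨ ^-homo-* ζ (ρ x) (ρ y) ⟩
    ψ x * ψ y                   ∎

  ψ-· : ∀ t x → ψ (t F.· x) ≈ (ζ ^ ρ x) ^ t
  ψ-· t x = begin
    ζ ^ ρ (t F.· x)           ≈⟨ ^-congʳ ζ (T.ρ-· t x) ⟨
    ζ ^ ((t ℕ.* ρ x) % p)     ≈⟨ ζ^i≈ζ^[i%p] (t ℕ.* ρ x) ⟨
    ζ ^ (t ℕ.* ρ x)           ≈⟨ ^-congʳ ζ (ℕ.*-comm t (ρ x)) ⟩
    ζ ^ (ρ x ℕ.* t)           ≈⟨ ^-assocʳ ζ (ρ x) t ⟨
    (ζ ^ ρ x) ^ t             ∎

  ψ-0 : ψ F.0# ≈ 1#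
  ψ-0 = ^-congʳ ζ (T.ρ≡0 T.tr-0)

  Ψ : ℕ → Carrier
  Ψ k = ψ (g F.^ k)

  Ψ-periodic : ∀ k → Ψ (m ℕ.* 4 ℕ.+ k) ≈ Ψ k
  Ψ-periodic k = ψ-cong (T.g^[n+k]≈g^k k)

  -- Translation by a point of trace 1 multiplies the sum by ζ and yet leaves it unchanged.
  ∑ψ≈0 : T.SumOver.∑F commutativeSemiring ψ ≈ 0#
  ∑ψ≈0 = hx≈x⇒x≈0 ζ≉1 (begin
    ζ * ∑F ψ                       ≈⟨ *-congʳ (*-identityʳ ζ) ⟨
    ζ ^ 1 * ∑F ψ                   ≈⟨ *-congʳ (^-congʳ ζ ρ₁≡1) ⟨
    ψ x₁ * ∑F ψ                    ≈⟨ *-distribˡ-sum {p ℕ.^ N} (ψ x₁) (λ i → ψ (T.from i)) ⟩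
    ∑F (λ x → ψ x₁ * ψ x)          ≈⟨ ∑F-cong (λ x → trans (*-comm _ _) (sym (ψ-+ x x₁))) ⟩
    ∑F (λ x → ψ (x F.+ x₁))        ≈⟨ ∑F-translate ψ ψ-cong x₁ ⟨
    ∑F ψ                           ∎)
    where
    open T.SumOver commutativeSemiring
    x₁ = proj₁ (T.trace-one-point N T.fixed-point-N)
    ρ₁≡1 = proj₂ (proj₂ (T.trace-one-point N T.fixed-point-N))

  ∑Ψ : 1# + ∑< (m ℕ.* 4) Ψ ≈ 0#
  ∑Ψ = trans (+-congʳ (sym ψ-0)) (trans (sym (T.∑F-by-powers commutativeSemiring ψ ψ-cong)) ∑ψ≈0)

  -- Over the whole field the sum is q or 0. The powers of g run over the non-zero elements only,
  -- and the missing term at 0 accounts for the -1.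
  orthogonality : ∀ y → ∑< (m ℕ.* 4) (λ k → ψ (g F.^ k F.* y)) ≈ [ y F.≟ F.0# ] * ι (pos (p ℕ.^ N)) - 1#
  orthogonality y = decide (y F.≟ F.0#)
    where
    decide : Dec (y F.≈ F.0#) → ∑< (m ℕ.* 4) (λ k → ψ (g F.^ k F.* y)) ≈ [ y F.≟ F.0# ] * ι (pos (p ℕ.^ N)) - 1#
    decide (yes y≈0) = begin
      ∑< (m ℕ.* 4) (λ k → ψ (g F.^ k F.* y))       ≈⟨ ∑<-cong (m ℕ.* 4) (λ k _ → trans (ψ-cong (F.trans (F.*-congˡ y≈0) (F.zeroʳ (g F.^ k)))) ψ-0) ⟩
      ∑< (m ℕ.* 4) (λ _ → 1#)                      ≈⟨ ∑<-const (m ℕ.* 4) 1# ⟩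
      (m ℕ.* 4) · 1#                               ≈⟨ x≈1+x-1 _ ⟩
      suc (m ℕ.* 4) · 1# - 1#                      ≡⟨ ≡.cong (λ k → k · 1# - 1#) q≡1+4m ⟨
      ι (pos (p ℕ.^ N)) - 1#                       ≈⟨ +-congʳ (trans (*-congʳ ([]-yes (y F.≟ F.0#) y≈0)) (*-identityˡ _)) ⟨
      [ y F.≟ F.0# ] * ι (pos (p ℕ.^ N)) - 1#      ∎
    decide (no y≉0) = begin
      ∑< (m ℕ.* 4) (λ k → ψ (g F.^ k F.* y))       ≈⟨ ∑<-cong (m ℕ.* 4) (λ k _ → ψ-cong (F.trans (F.*-congˡ (T.g^log y y≉0)) (F.trans (F.*-comm _ _) (F.sym (T.^-homo-* g a k))))) ⟩
      ∑< (m ℕ.* 4) (λ k → Ψ (a ℕ.+ k))             ≈⟨ ∑<-shift (m ℕ.* 4) Ψ Ψ-periodic a ⟩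
      ∑< (m ℕ.* 4) Ψ                               ≈⟨ x≈1+x-1 _ ⟩
      1# + ∑< (m ℕ.* 4) Ψ - 1#                     ≈⟨ +-congʳ (trans ∑Ψ (sym (zeroˡ _))) ⟩
      0# * ι (pos (p ℕ.^ N)) - 1#                  ≈⟨ +-congʳ (*-congʳ ([]-no (y F.≟ F.0#) y≉0)) ⟨
      [ y F.≟ F.0# ] * ι (pos (p ℕ.^ N)) - 1#      ∎
      where a = T.log y y≉0

-- A variance identity in ℕ

module ℕ-Sums where
  open FiniteSums ℕ.+-*-commutativeSemiring
  open ≡.≡-Reasoning

  ∑ℕ<≡0 : ∀ n (f : ℕ → ℕ) → ∑< n f ≡ 0 → ∀ i → i ℕ.< n → f i ≡ 0
  ∑ℕ<≡0 (suc n) f eq zero    _         = ℕ.m+n≡0⇒m≡0 (f 0) eq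
  ∑ℕ<≡0 (suc n) f eq (suc i) (ℕ.s≤s l) = ∑ℕ<≡0 n (f ∘ suc) (ℕ.m+n≡0⇒n≡0 (f 0) eq) i l

  ∑ℕ<-const : ∀ n c → ∑< n (λ _ → c) ≡ n ℕ.* c
  ∑ℕ<-const zero    c = ≡.refl
  ∑ℕ<-const (suc n) c = ≡.cong (c ℕ.+_) (∑ℕ<-const n c)

  -- The absolute difference keeps (a - b)² inside ℕ, where a vanishing sum forces every summand to
  -- vanish.
  ∣-∣²+2ab≡a²+b² : ∀ a b → ℕ.∣ a - b ∣ ℕ.* ℕ.∣ a - b ∣ ℕ.+ (a ℕ.* b ℕ.+ a ℕ.* b) ≡ a ℕ.* a ℕ.+ b ℕ.* b
  ∣-∣²+2ab≡a²+b² zero    b       = ℕ.+-identityʳ (b ℕ.* b)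
  ∣-∣²+2ab≡a²+b² (suc a) zero    = ≡.cong (λ k → suc a ℕ.* suc a ℕ.+ (k ℕ.+ k)) (ℕ.*-zeroʳ (suc a))
  ∣-∣²+2ab≡a²+b² (suc a) (suc b) = begin
    d ℕ.* d ℕ.+ (suc a ℕ.* suc b ℕ.+ suc a ℕ.* suc b)             ≡⟨ lhs d a b ⟩
    d ℕ.* d ℕ.+ (a ℕ.* b ℕ.+ a ℕ.* b) ℕ.+ (a ℕ.+ a ℕ.+ b ℕ.+ b ℕ.+ 2) ≡⟨ ≡.cong (ℕ._+ (a ℕ.+ a ℕ.+ b ℕ.+ b ℕ.+ 2)) (∣-∣²+2ab≡a²+b² a b) ⟩
    a ℕ.* a ℕ.+ b ℕ.* b ℕ.+ (a ℕ.+ a ℕ.+ b ℕ.+ b ℕ.+ 2)           ≡⟨ rhs a b ⟩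
    suc a ℕ.* suc a ℕ.+ suc b ℕ.* suc b                           ∎
    where
    d = ℕ.∣ a - b ∣
    lhs : ∀ d a b → d ℕ.* d ℕ.+ (suc a ℕ.* suc b ℕ.+ suc a ℕ.* suc b) ≡ d ℕ.* d ℕ.+ (a ℕ.* b ℕ.+ a ℕ.* b) ℕ.+ (a ℕ.+ a ℕ.+ b ℕ.+ b ℕ.+ 2)
    lhs = solve-∀
    rhs : ∀ a b → a ℕ.* a ℕ.+ b ℕ.* b ℕ.+ (a ℕ.+ a ℕ.+ b ℕ.+ b ℕ.+ 2) ≡ suc a ℕ.* suc a ℕ.+ suc b ℕ.* suc b
    rhs = solve-∀

  -- This is Σ (c_r - c_s)² = 2n Σ c_r² - 2 (Σ c_r)² with the negative term moved to the left. The
  -- double sum measures how far `c` is from being constant.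
  variance : ∀ n (c : ℕ → ℕ) →
    ∑< n (λ r → ∑< n (λ s → ℕ.∣ c r - c s ∣ ℕ.* ℕ.∣ c r - c s ∣)) ℕ.+ (∑< n c ℕ.* ∑< n c ℕ.+ ∑< n c ℕ.* ∑< n c)
      ≡ n ℕ.* ∑< n (λ r → c r ℕ.* c r) ℕ.+ n ℕ.* ∑< n (λ r → c r ℕ.* c r)
  variance n c = begin
    ∑∑ D ℕ.+ (Σc ℕ.* Σc ℕ.+ Σc ℕ.* Σc)
      ≡⟨ ≡.cong (λ k → ∑∑ D ℕ.+ (k ℕ.+ k)) product ⟩
    ∑∑ D ℕ.+ (∑∑ AB ℕ.+ ∑∑ AB)
      ≡⟨ ≡.cong (∑∑ D ℕ.+_) (∑∑-+ AB AB) ⟨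
    ∑∑ D ℕ.+ ∑∑ (λ r s → AB r s ℕ.+ AB r s)
      ≡⟨ ∑∑-+ D (λ r s → AB r s ℕ.+ AB r s) ⟨
    ∑∑ (λ r s → D r s ℕ.+ (AB r s ℕ.+ AB r s))
      ≡⟨ sum-cong {n} (λ r → sum-cong {n} (λ s → ∣-∣²+2ab≡a²+b² (c (toℕ r)) (c (toℕ s)))) ⟩
    ∑∑ (λ r s → c r ℕ.* c r ℕ.+ c s ℕ.* c s)
      ≡⟨ ∑∑-+ (λ r s → c r ℕ.* c r) (λ r s → c s ℕ.* c s) ⟩
    ∑∑ (λ r s → c r ℕ.* c r) ℕ.+ ∑∑ (λ r s → c s ℕ.* c s)
      ≡⟨ ≡.cong₂ ℕ._+_ (≡.trans (sum-cong {n} (λ r → ∑ℕ<-const n (c (toℕ r) ℕ.* c (toℕ r)))) (≡.sym (*-distribˡ-sum {n} n (λ r → c (toℕ r) ℕ.* c (toℕ r)))))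
                       (∑ℕ<-const n V) ⟩
    n ℕ.* V ℕ.+ n ℕ.* V ∎
    where
    Σc = ∑< n c
    V = ∑< n (λ r → c r ℕ.* c r)
    D AB : ℕ → ℕ → ℕ
    D r s = ℕ.∣ c r - c s ∣ ℕ.* ℕ.∣ c r - c s ∣
    AB r s = c r ℕ.* c s
    ∑∑ : (ℕ → ℕ → ℕ) → ℕ
    ∑∑ f = ∑< n (λ r → ∑< n (f r))
    ∑∑-+ : ∀ f h → ∑∑ (λ r s → f r s ℕ.+ h r s) ≡ ∑∑ f ℕ.+ ∑∑ h
    ∑∑-+ f h = ≡.trans (sum-cong {n} (λ r → ∑-distrib-+ {n} (f (toℕ r) ∘ toℕ) (h (toℕ r) ∘ toℕ)))
      (∑-distrib-+ {n} (λ r → ∑< n (f (toℕ r))) (λ r → ∑< n (h (toℕ r))))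
    product : Σc ℕ.* Σc ≡ ∑∑ AB
    product = ≡.trans (*-distribʳ-sum {n} Σc (c ∘ toℕ)) (sum-cong {n} (λ r → *-distribˡ-sum {n} (c (toℕ r)) (c ∘ toℕ)))

open ℕ-Sums

-- The quartic Gaussian periods and their integer values

module Periods {c ℓ c′ ℓ′ : Level} (p N : ℕ) (p-prime : Prime p) (1≤N : 1 ℕ.≤ N) (2<p : 2 ℕ.< p)
             (F : FiniteField c ℓ (p ℕ.^ N))
             (g : FiniteField.Carrier F) (primitive-root : IsPrimitiveRoot F g)
             (m : ℕ) (q≡1+4m : p ℕ.^ N ≡ suc (m ℕ.* 4))
             (W : ℕ) (4m≡W*p⁻ : m ℕ.* 4 ≡ W ℕ.* ℕ.pred p)
             (K : Char0DomainWithRoot c′ ℓ′ p)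
             (h : ℕ) (m≡h+h : m ≡ h ℕ.+ h) (4∣W : 4 ∣ W) (p%4≡3 : p % 4 ≡ 3) where
  private
    module F = FiniteField F
    module T = TraceOneParity p N p-prime 1≤N 2<p F g primitive-root m q≡1+4m W 4m≡W*p⁻
  open T using (ρ; p-nonZero)
  open CharacterSums p N p-prime 1≤N 2<p F g primitive-root m q≡1+4m W 4m≡W*p⁻ K public
  open Char0DomainWithRoot K hiding (zero)
  open Algebra.Properties.Ring ring
  open FiniteSums commutativeSemiring
  open Relation.Binary.Reasoning.Setoid setoid

  private
    n : ℕ
    n = m ℕ.* 4

  instance
    m-nonZero : ℕ.NonZero m
    m-nonZero = ℕ.m*n≢0⇒m≢0 m {{T.n-nonZero}}

  ι-pos≉0 : ∀ k .{{_ : ℕ.NonZero k}} → ¬ (ι (pos k) ≈ 0#)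
  ι-pos≉0 (suc k) = char0 k

  ι-[] : ∀ {a} {P : Set a} (d : Dec P) → ι (pos ∑ℕ.[ d ]) ≈ [ d ]
  ι-[] (yes _) = ι-1
  ι-[] (no _)  = refl

  ι-sum : ∀ {k} (f : Fin k → ℕ) → ι (pos (∑ℕ.sum f)) ≈ sum (λ i → ι (pos (f i)))
  ι-sum {zero}  f = refl
  ι-sum {suc k} f = trans (ι-+ (pos (f zero)) (pos (∑ℕ.sum (f ∘ suc)))) (+-congˡ (ι-sum (f ∘ suc)))

  -- The element squares to 1 and differs from 1 because 0 < 4h < 4m. Its exponent is a multiple of
  -- 4, so -1 lies in C₀ and every class is symmetric.
  g^[4h]≈-1 : g F.^ (h ℕ.* 4) F.≈ F.- F.1#
  g^[4h]≈-1 = decide (x F.- F.1# F.≟ F.0#)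
    where
    open T.Solver using (solve; _:+_; _:*_; _:-_; _:=_)
    x = g F.^ (h ℕ.* 4)
    x*x≈1 : x F.* x F.≈ F.1#
    x*x≈1 = F.trans (F.sym (T.^-homo-* g (h ℕ.* 4) (h ℕ.* 4)))
      (F.trans (T.^-congʳ g (≡.trans (≡.sym (ℕ.*-distribʳ-+ 4 h h)) (≡.cong (ℕ._* 4) (≡.sym m≡h+h)))) T.g^n≈1)
    zero-or : (x F.- F.1#) F.* (x F.+ F.1#) F.≈ F.0#
    zero-or = F.trans (solve 2 (λ x o → (x :- o) :* (x :+ o) := x :* x :- o :* o) F.refl x F.1#)
      (F.trans (F.+-cong x*x≈1 (F.-‿cong (F.*-identityˡ F.1#))) (F.-‿inverseʳ F.1#))
    4h<n : h ℕ.* 4 ℕ.< n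
    4h<n = ℕ.*-monoˡ-< 4 (≡.subst (h ℕ.<_) (≡.sym m≡h+h) (ℕ.m<m+n h (ℕ.n≢0⇒n>0 h≢0)))
      where
      h≢0 : h ≢ 0
      h≢0 h≡0 = ℕ.≢-nonZero⁻¹ m (≡.trans m≡h+h (≡.cong₂ ℕ._+_ h≡0 h≡0))
    h≢0 : h ℕ.* 4 ≢ 0
    h≢0 4h≡0 = ℕ.≢-nonZero⁻¹ m (≡.trans m≡h+h (≡.cong₂ ℕ._+_ h≡0 h≡0))
      where
      h≡0 = ℕ.m*n≡0⇒m≡0 h 4 4h≡0
    decide : Dec (x F.- F.1# F.≈ F.0#) → x F.≈ F.- F.1#
    decide (yes eq) = contradiction (T.g^-injective (h ℕ.* 4) 0 4h<n (ℕ.n≢0⇒n>0 (ℕ.≢-nonZero⁻¹ n {{T.n-nonZero}}))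
      (F.trans (solve 2 (λ x o → x := x :- o :+ o) F.refl x F.1#) (F.trans (F.+-congʳ eq) (F.+-identityˡ F.1#)))) h≢0
    decide (no neq) = F.trans (solve 2 (λ x o → x := x :+ o :- o) F.refl x F.1#)
      (F.trans (F.+-congʳ (T.x≉0⇒*-cancelˡ neq (F.trans zero-or (F.sym (F.zeroʳ _))))) (F.+-identityˡ _))

  g^[4h+k]≈-g^k : ∀ k → g F.^ (h ℕ.* 4 ℕ.+ k) F.≈ F.- (g F.^ k)
  g^[4h+k]≈-g^k k = F.trans (T.^-homo-* g (h ℕ.* 4) k) (F.trans (F.*-congʳ g^[4h]≈-1) (T.-1*x≈-x (g F.^ k)))

  η : ℕ → Carrier
  η j = ∑< m (λ i → Ψ (i ℕ.* 4 ℕ.+ j))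

  -- Multiplication by g ^ (4a) permutes each class. The target semiring is left open because `f`
  -- takes values in `K` and, for counting, in ℕ.
  ∑<-class-shift : ∀ {c″ ℓ″} (R : CommutativeSemiring c″ ℓ″) (f : F.Carrier → CommutativeSemiring.Carrier R) →
                   f Preserves F._≈_ ⟶ CommutativeSemiring._≈_ R → ∀ a j →
                   CommutativeSemiring._≈_ R
                     (FiniteSums.∑< R m (λ i → f (g F.^ (i ℕ.* 4 ℕ.+ (a ℕ.* 4 ℕ.+ j)))))
                     (FiniteSums.∑< R m (λ i → f (g F.^ (i ℕ.* 4 ℕ.+ j))))
  ∑<-class-shift R f f-cong a j = R.trans
    (∑R.∑<-cong m (λ i _ → f-cong (T.^-congʳ g (arith a i j))))
    (∑R.∑<-shift m (λ i → f (g F.^ (i ℕ.* 4 ℕ.+ j)))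
      (λ i → f-cong (F.trans (T.^-congʳ g (arith′ m i j)) (T.g^[n+k]≈g^k (i ℕ.* 4 ℕ.+ j)))) a)
    where
    module R = CommutativeSemiring R
    module ∑R = FiniteSums R
    arith : ∀ a i j → i ℕ.* 4 ℕ.+ (a ℕ.* 4 ℕ.+ j) ≡ (a ℕ.+ i) ℕ.* 4 ℕ.+ j
    arith = solve-∀
    arith′ : ∀ m i j → (m ℕ.+ i) ℕ.* 4 ℕ.+ j ≡ m ℕ.* 4 ℕ.+ (i ℕ.* 4 ℕ.+ j)
    arith′ = solve-∀

  η-shift : ∀ a j → η (a ℕ.* 4 ℕ.+ j) ≈ η j
  η-shift = ∑<-class-shift commutativeSemiring ψ ψ-cong

  η-twist : ∀ j y l → y F.≈ g F.^ l → ∑< m (λ i → ψ (y F.* g F.^ (i ℕ.* 4 ℕ.+ j))) ≈ η (l ℕ.+ j)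
  η-twist j y l y≈g^l = ∑<-cong m (λ i _ → ψ-cong (F.trans (F.*-congʳ y≈g^l)
    (F.trans (F.sym (T.^-homo-* g l (i ℕ.* 4 ℕ.+ j))) (T.^-congʳ g (arith i l j)))))
    where
    arith : ∀ i l j → l ℕ.+ (i ℕ.* 4 ℕ.+ j) ≡ i ℕ.* 4 ℕ.+ (l ℕ.+ j)
    arith = solve-∀

  ∑η : 1# + ∑< 4 η ≈ 0#
  ∑η = trans (+-congˡ (sym (∑<-mod4 m Ψ))) ∑Ψ

  sum*sum : ∀ {k l} (f : Fin k → Carrier) (f′ : Fin l → Carrier) →
            sum f * sum f′ ≈ sum (λ i → sum (λ i′ → f i * f′ i′))
  sum*sum {k} {l} f f′ = trans (*-distribʳ-sum {k} (sum f′) f) (sum-cong {k} (λ i → *-distribˡ-sum {l} (f i) f′))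

  module _ (a b : ℕ) (a<4 : a ℕ.< 4) (b<4 : b ℕ.< 4) where
    private
      y : ℕ → ℕ → F.Carrier
      y i i′ = g F.^ (i ℕ.* 4 ℕ.+ a) F.- g F.^ (i′ ℕ.* 4 ℕ.+ b)

      q : Carrier
      q = ι (pos (p ℕ.^ N))

      product : ∀ k → η (k ℕ.+ a) * η (k ℕ.+ b) ≈ ∑< m (λ i → ∑< m (λ i′ → ψ (g F.^ k F.* y i i′)))
      product k = begin
        η (k ℕ.+ a) * η (k ℕ.+ b)
          -- Since -1 is in C₀, the second period may be summed over the negatives of its class; the
          -- product of two characters then becomes the character of a difference.
          ≈⟨ *-congˡ (η-shift h (k ℕ.+ b)) ⟨
        η (k ℕ.+ a) * η (h ℕ.* 4 ℕ.+ (k ℕ.+ b))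
          ≈⟨ sum*sum {m} {m} (λ i → Ψ (toℕ i ℕ.* 4 ℕ.+ (k ℕ.+ a))) (λ i′ → Ψ (toℕ i′ ℕ.* 4 ℕ.+ (h ℕ.* 4 ℕ.+ (k ℕ.+ b)))) ⟩
        ∑< m (λ i → ∑< m (λ i′ → Ψ (i ℕ.* 4 ℕ.+ (k ℕ.+ a)) * Ψ (i′ ℕ.* 4 ℕ.+ (h ℕ.* 4 ℕ.+ (k ℕ.+ b)))))
          ≈⟨ ∑<-cong m (λ i _ → ∑<-cong m (λ i′ _ → term i i′)) ⟩
        ∑< m (λ i → ∑< m (λ i′ → ψ (g F.^ k F.* y i i′))) ∎
        where
        arith : ∀ i k a → i ℕ.* 4 ℕ.+ (k ℕ.+ a) ≡ k ℕ.+ (i ℕ.* 4 ℕ.+ a)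
        arith = solve-∀
        arith′ : ∀ i h k a → i ℕ.* 4 ℕ.+ (h ℕ.* 4 ℕ.+ (k ℕ.+ a)) ≡ h ℕ.* 4 ℕ.+ (k ℕ.+ (i ℕ.* 4 ℕ.+ a))
        arith′ = solve-∀
        open T.Solver using (solve; _:+_; _:*_; _:-_; :-_; _:=_)
        term : ∀ i i′ → Ψ (i ℕ.* 4 ℕ.+ (k ℕ.+ a)) * Ψ (i′ ℕ.* 4 ℕ.+ (h ℕ.* 4 ℕ.+ (k ℕ.+ b))) ≈ ψ (g F.^ k F.* y i i′)
        term i i′ = trans (sym (ψ-+ _ _)) (ψ-cong (F.trans
          (F.+-cong (F.trans (T.^-congʳ g (arith i k a)) (T.^-homo-* g k (i ℕ.* 4 ℕ.+ a)))
                    (F.trans (T.^-congʳ g (arith′ i′ h k b)) (F.trans (g^[4h+k]≈-g^k (k ℕ.+ (i′ ℕ.* 4 ℕ.+ b)))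
                      (F.-‿cong (T.^-homo-* g k (i′ ℕ.* 4 ℕ.+ b))))))
          (solve 3 (λ x u v → x :* u :+ :- (x :* v) := x :* (u :- v)) F.refl (g F.^ k) (g F.^ (i ℕ.* 4 ℕ.+ a)) (g F.^ (i′ ℕ.* 4 ℕ.+ b)))))

      vanish : ∀ i i′ → i ℕ.< m → i′ ℕ.< m → [ y i i′ F.≟ F.0# ] ≈ [ i′ ℕ.≟ i ] * [ a ℕ.≟ b ]
      vanish i i′ i<m i′<m = decide (i′ ℕ.≟ i) (a ℕ.≟ b)
        where
        open T.Solver using (solve; _:+_; _:-_; _:=_)
        bound : ∀ i a → i ℕ.< m → a ℕ.< 4 → i ℕ.* 4 ℕ.+ a ℕ.< n
        bound i a i<m a<4 = ℕ.<-≤-trans (ℕ.+-monoʳ-< (i ℕ.* 4) a<4)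
          (≡.subst (ℕ._≤ n) (ℕ.+-comm 4 (i ℕ.* 4)) (ℕ.*-monoˡ-≤ 4 i<m))
        y≈0⇒ : y i i′ F.≈ F.0# → i ℕ.* 4 ℕ.+ a ≡ i′ ℕ.* 4 ℕ.+ b
        y≈0⇒ eq = T.g^-injective _ _ (bound i a i<m a<4) (bound i′ b i′<m b<4)
          (F.trans (solve 2 (λ u v → u := u :- v :+ v) F.refl (g F.^ (i ℕ.* 4 ℕ.+ a)) (g F.^ (i′ ℕ.* 4 ℕ.+ b)))
            (F.trans (F.+-congʳ eq) (F.+-identityˡ _)))
        a≡b : y i i′ F.≈ F.0# → a ≡ b
        a≡b eq = ≡.trans (≡.sym (m<n⇒m%n≡m a<4)) (≡.trans (≡.sym ([m+kn]%n≡m%n a i 4))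
          (≡.trans (≡.cong (_% 4) (≡.trans (ℕ.+-comm a (i ℕ.* 4)) (≡.trans (y≈0⇒ eq) (ℕ.+-comm (i′ ℕ.* 4) b))))
          (≡.trans ([m+kn]%n≡m%n b i′ 4) (m<n⇒m%n≡m b<4))))
        i′≡i : y i i′ F.≈ F.0# → i′ ≡ i
        i′≡i eq = ≡.sym (ℕ.*-cancelʳ-≡ i i′ 4 (ℕ.+-cancelʳ-≡ a (i ℕ.* 4) (i′ ℕ.* 4)
          (≡.trans (y≈0⇒ eq) (≡.cong (i′ ℕ.* 4 ℕ.+_) (≡.sym (a≡b eq))))))
        decide : Dec (i′ ≡ i) → Dec (a ≡ b) → [ y i i′ F.≟ F.0# ] ≈ [ i′ ℕ.≟ i ] * [ a ℕ.≟ b ]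
        decide (no ¬i) _ = trans ([]-no (y i i′ F.≟ F.0#) (¬i ∘ i′≡i)) (sym (trans (*-congʳ ([]-no (i′ ℕ.≟ i) ¬i)) (zeroˡ _)))
        decide (yes _) (no ¬a) = trans ([]-no (y i i′ F.≟ F.0#) (¬a ∘ a≡b)) (sym (trans (*-congˡ ([]-no (a ℕ.≟ b) ¬a)) (zeroʳ _)))
        decide (yes ei) (yes ea) = trans
          ([]-yes (y i i′ F.≟ F.0#) (F.trans (F.+-congʳ (T.^-congʳ g (≡.cong₂ (λ i a → i ℕ.* 4 ℕ.+ a) (≡.sym ei) ea))) (F.-‿inverseʳ _)))
          (sym (trans (*-cong ([]-yes (i′ ℕ.≟ i) ei) ([]-yes (a ℕ.≟ b) ea)) (*-identityˡ 1#)))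

      -- For equal classes exactly one `i′` gives the difference 0 and contributes q - 1; all other
      -- terms are -1.
      inner : ∀ i → i ℕ.< m → ∑< m (λ i′ → [ y i i′ F.≟ F.0# ] * q - 1#) ≈ [ a ℕ.≟ b ] * q - ι (pos m)
      inner i i<m = begin
        ∑< m (λ i′ → [ y i i′ F.≟ F.0# ] * q - 1#)
          ≈⟨ ∑<-cong m (λ i′ i′<m → +-congʳ (trans (*-congʳ (vanish i i′ i<m i′<m)) (*-assoc _ _ _))) ⟩
        ∑< m (λ i′ → [ i′ ℕ.≟ i ] * ([ a ℕ.≟ b ] * q) - 1#)
          ≈⟨ ∑-distrib-+ {m} (λ i′ → [ toℕ i′ ℕ.≟ i ] * ([ a ℕ.≟ b ] * q)) (λ _ → - 1#) ⟩
        ∑< m (λ i′ → [ i′ ℕ.≟ i ] * ([ a ℕ.≟ b ] * q)) + ∑< m (λ _ → - 1#)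
          ≈⟨ +-cong (∑<-select m i i<m (λ _ → [ a ℕ.≟ b ] * q)) (∑<-neg m) ⟩
        [ a ℕ.≟ b ] * q - ι (pos m) ∎
        where
        ∑<-neg : ∀ k → ∑< k (λ _ → - 1#) ≈ - ι (pos k)
        ∑<-neg zero    = sym -0#≈0#
        ∑<-neg (suc k) = trans (+-congˡ (∑<-neg k)) (-‿+-comm _ _)

    -- Evaluating Σₖ η(k + a) η(k + b) over a full period in two ways.
    η-correlation : ∑< 4 (λ j → η (j ℕ.+ a) * η (j ℕ.+ b)) ≈ [ a ℕ.≟ b ] * ι (pos (p ℕ.^ N)) - ι (pos m)
    η-correlation = *-cancel (ι (pos m)) _ _ (ι-pos≉0 m) (begin
      ι (pos m) * ∑< 4 (λ j → η (j ℕ.+ a) * η (j ℕ.+ b))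
        ≈⟨ *-distribˡ-sum {4} (ι (pos m)) (λ j → G (toℕ j)) ⟩
      ∑< 4 (λ j → ι (pos m) * G j)
        ≈⟨ ∑<-cong 4 (λ j _ → ι*≈∑ (G j)) ⟩
      ∑< 4 (λ j → ∑< m (λ i → G j))
        ≈⟨ ∑<-cong 4 (λ j _ → ∑<-cong m (λ i _ → G-periodic i j)) ⟨
      ∑< 4 (λ j → ∑< m (λ i → G (i ℕ.* 4 ℕ.+ j)))
        ≈⟨ ∑<-mod4 m G ⟨
      ∑< n G
        ≈⟨ ∑<-cong n (λ k _ → product k) ⟩
      ∑< n (λ k → ∑< m (λ i → ∑< m (λ i′ → ψ (g F.^ k F.* y i i′))))
        ≈⟨ ∑-comm {n} {m} (λ k i → ∑< m (λ i′ → ψ (g F.^ toℕ k F.* y (toℕ i) i′))) ⟩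
      ∑< m (λ i → ∑< n (λ k → ∑< m (λ i′ → ψ (g F.^ k F.* y i i′))))
        ≈⟨ ∑<-cong m (λ i _ → ∑-comm {n} {m} (λ k i′ → ψ (g F.^ toℕ k F.* y i (toℕ i′)))) ⟩
      ∑< m (λ i → ∑< m (λ i′ → ∑< n (λ k → ψ (g F.^ k F.* y i i′))))
        ≈⟨ ∑<-cong m (λ i _ → ∑<-cong m (λ i′ _ → orthogonality (y i i′))) ⟩
      ∑< m (λ i → ∑< m (λ i′ → [ y i i′ F.≟ F.0# ] * q - 1#))
        ≈⟨ ∑<-cong m inner ⟩
      ∑< m (λ i → [ a ℕ.≟ b ] * q - ι (pos m))
        ≈⟨ ι*≈∑ _ ⟨
      ι (pos m) * ([ a ℕ.≟ b ] * q - ι (pos m)) ∎)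
      where
      G : ℕ → Carrier
      G k = η (k ℕ.+ a) * η (k ℕ.+ b)
      G-periodic : ∀ i j → G (i ℕ.* 4 ℕ.+ j) ≈ G j
      G-periodic i j = *-cong (periodic a) (periodic b)
        where
        periodic : ∀ a → η (i ℕ.* 4 ℕ.+ j ℕ.+ a) ≈ η (j ℕ.+ a)
        periodic a = trans (reflexive (≡.cong η (ℕ.+-assoc (i ℕ.* 4) j a))) (η-shift i (j ℕ.+ a))
      ι*≈∑ : ∀ x → ι (pos m) * x ≈ ∑< m (λ _ → x)
      ι*≈∑ x = trans (*-congʳ (sym (∑<-const m 1#))) (trans (*-distribʳ-sum {m} x (λ _ → 1#)) (sum-cong {m} (λ _ → *-identityˡ x)))

  count : ∀ {k} → (Fin k → F.Carrier) → ℕ → ℕ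
  count x r = ∑ℕ.sum (λ i → ∑ℕ.[ ρ (x i) ℕ.≟ r ])

  ∑ψ-by-residue : ∀ {k} (x : Fin k → F.Carrier) →
                  sum (λ i → ψ (x i)) ≈ ∑< p (λ r → ι (pos (count x r)) * ζ ^ r)
  ∑ψ-by-residue {k} x = begin
    sum (λ i → ψ (x i))
      ≈⟨ sum-cong {k} (λ i → ∑<-select p (ρ (x i)) (T.ρ<p (x i)) (ζ ^_)) ⟨
    sum (λ i → ∑< p (λ r → [ r ℕ.≟ ρ (x i) ] * ζ ^ r))
      ≈⟨ ∑-comm {k} {p} (λ i r → [ toℕ r ℕ.≟ ρ (x i) ] * ζ ^ toℕ r) ⟩
    ∑< p (λ r → sum (λ i → [ r ℕ.≟ ρ (x i) ] * ζ ^ r))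
      ≈⟨ ∑<-cong p (λ r _ → *-distribʳ-sum {k} (ζ ^ r) (λ i → [ r ℕ.≟ ρ (x i) ])) ⟨
    ∑< p (λ r → sum (λ i → [ r ℕ.≟ ρ (x i) ]) * ζ ^ r)
      ≈⟨ ∑<-cong p (λ r _ → *-congʳ {ζ ^ r} (sum-cong {k} (λ i → trans ([]-cong (r ℕ.≟ ρ (x i)) (ρ (x i) ℕ.≟ r) ≡.sym ≡.sym) (sym (ι-[] (ρ (x i) ℕ.≟ r)))))) ⟩
    ∑< p (λ r → sum (λ i → ι (pos ∑ℕ.[ ρ (x i) ℕ.≟ r ])) * ζ ^ r)
      ≈⟨ ∑<-cong p (λ r _ → *-congʳ {ζ ^ r} (ι-sum {k} (λ i → ∑ℕ.[ ρ (x i) ℕ.≟ r ]))) ⟨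
    ∑< p (λ r → ι (pos (count x r)) * ζ ^ r) ∎

  ∑ζ^r≈0 : ∑< p (ζ ^_) ≈ 0#
  ∑ζ^r≈0 = hx≈x⇒x≈0 ζ≉1 (geometric-sum commutativeRing ζ p ζᵖ≈1)

  class : ℕ → Fin m → F.Carrier
  class j i = g F.^ (toℕ i ℕ.* 4 ℕ.+ j)

  -- Elements of the prime field are fixed by Frobenius, so their logarithms are multiples of `W`,
  -- hence of 4.
  r·1≈g^[4a] : ∀ r → 0 ℕ.< r → r ℕ.< p → ∃[ a ] r F.· F.1# F.≈ g F.^ (a ℕ.* 4)
  r·1≈g^[4a] r 0<r r<p = from-divides (∣-trans 4∣W (T.fixed⇒∣log 1 T.p⁻ W T.p^1≡1+p⁻ 4m≡W*p⁻ τ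
      (F.trans (T.Frob-cong 1 (F.sym r·1≈g^τ)) (F.trans (T.Frob-·1 1 r) r·1≈g^τ))))
    where
    r·1≉0 = T.m·1≉0 r 0<r r<p
    τ = T.log (r F.· F.1#) r·1≉0
    r·1≈g^τ = T.g^log (r F.· F.1#) r·1≉0
    from-divides : 4 ∣ τ → ∃[ a ] r F.· F.1# F.≈ g F.^ (a ℕ.* 4)
    from-divides (divides a τ≡4a) = a , F.trans r·1≈g^τ (T.^-congʳ g τ≡4a)

  -- Multiplication by r, a fourth power, permutes the class and multiplies traces by r, so it
  -- carries trace 1 to trace r.
  count-class : ∀ j r → 0 ℕ.< r → r ℕ.< p → count (class j) r ≡ count (class j) 1
  count-class j r 0<r r<p = ≡.trans
    (≡.sym (∑<-class-shift ℕ.+-*-commutativeSemiring (λ x → ∑ℕ.[ ρ x ℕ.≟ r ]) (λ eq → ≡.cong (λ s → ∑ℕ.[ s ℕ.≟ r ]) (T.ρ-cong eq)) a j))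
    (∑ℕ.∑<-cong m (λ i _ → ∑ℕ.[]-cong (ρ (x′ i) ℕ.≟ r) (ρ (x i) ℕ.≟ 1)
      (λ eq → T.·1-injective (T.ρ<p (x i)) T.1<p (T.x≉0⇒*-cancelˡ (T.m·1≉0 r 0<r r<p)
        (F.trans (F.sym (T.×1-homo-* r (ρ (x i)))) (F.trans (T.m·1≈[m%p]·1 (r ℕ.* ρ (x i)))
          (F.trans (F.reflexive (≡.cong (F._· F.1#) (≡.trans (r*ρ i) eq))) (F.sym (F.trans (F.*-congˡ (F.+-identityʳ F.1#)) (F.*-identityʳ _))))))))
      (λ eq → ≡.trans (≡.sym (r*ρ i)) (≡.trans (≡.cong (λ s → (r ℕ.* s) % p) eq)
        (≡.trans (≡.cong (_% p) (ℕ.*-identityʳ r)) (m<n⇒m%n≡m r<p))))))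
    where
    a = proj₁ (r·1≈g^[4a] r 0<r r<p)
    x x′ : ℕ → F.Carrier
    x i = g F.^ (i ℕ.* 4 ℕ.+ j)
    x′ i = g F.^ (i ℕ.* 4 ℕ.+ (a ℕ.* 4 ℕ.+ j))
    arith : ∀ a i j → i ℕ.* 4 ℕ.+ (a ℕ.* 4 ℕ.+ j) ≡ a ℕ.* 4 ℕ.+ (i ℕ.* 4 ℕ.+ j)
    arith = solve-∀
    x′≈r·x : ∀ i → x′ i F.≈ r F.· x i
    x′≈r·x i = F.trans (T.^-congʳ g (arith a i j)) (F.trans (T.^-homo-* g (a ℕ.* 4) (i ℕ.* 4 ℕ.+ j))
      (F.trans (F.*-congʳ (F.sym (proj₂ (r·1≈g^[4a] r 0<r r<p)))) (F.sym (T.m·x≈[m·1]*x r (x i)))))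
    r*ρ : ∀ i → (r ℕ.* ρ (x i)) % p ≡ ρ (x′ i)
    r*ρ i = ≡.trans (T.ρ-· r (x i)) (T.ρ-cong (F.sym (x′≈r·x i)))

  e : ℕ → ℤ
  e j = pos (count (class j) 0) ℤ.- pos (count (class j) 1)

  -- The classes are unions of 𝔽ₚ*-orbits, hence all non-zero traces occur
  -- equally often and η(j) is rational.
  η≈ι : ∀ j → η j ≈ ι (e j)
  η≈ι j = begin
    η j
      ≈⟨ ∑ψ-by-residue (class j) ⟩
    ∑< p (λ r → ι (pos (count (class j) r)) * ζ ^ r)
      ≡⟨ ≡.cong (λ k → ∑< k (λ r → ι (pos (count (class j) r)) * ζ ^ r)) (≡.sym T.1+p⁻≡p) ⟩
    Z * 1# + ∑< T.p⁻ (λ r → ι (pos (count (class j) (suc r))) * ζ ^ suc r)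
      ≈⟨ +-congˡ (∑<-cong T.p⁻ (λ r r<p⁻ → *-congʳ {ζ ^ suc r} (reflexive (≡.cong (ι ∘ pos)
           (count-class j (suc r) ℕ.z<s (≡.subst (suc r ℕ.<_) T.1+p⁻≡p (ℕ.s≤s r<p⁻))))))) ⟩
    Z * 1# + ∑< T.p⁻ (λ r → N₁ * ζ ^ suc r)
      ≈⟨ +-congˡ (*-distribˡ-sum {T.p⁻} N₁ (λ r → ζ ^ suc (toℕ r))) ⟨
    Z * 1# + N₁ * R
      -- Taking N₁ out of the coefficient at r = 0 completes N₁ times the sum over all powers of ζ,
      -- which is 0.
      ≈⟨ solve 4 (λ z o n r → z :* o :+ n :* r := z :* o :- n :* o :+ n :* (o :+ r)) refl Z 1# N₁ R ⟩
    Z * 1# - N₁ * 1# + N₁ * (1# + R)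
      ≡⟨ ≡.cong (λ k → Z * 1# - N₁ * 1# + N₁ * ∑< k (ζ ^_)) T.1+p⁻≡p ⟩
    Z * 1# - N₁ * 1# + N₁ * ∑< p (ζ ^_)
      ≈⟨ +-cong (+-cong (*-identityʳ Z) (-‿cong (*-identityʳ N₁))) (trans (*-congˡ ∑ζ^r≈0) (zeroʳ N₁)) ⟩
    Z - N₁ + 0#
      ≈⟨ +-identityʳ _ ⟩
    Z - N₁
      ≈⟨ +-congˡ (ι-neg (pos (count (class j) 1))) ⟨
    Z + ι (ℤ.- pos (count (class j) 1))
      ≈⟨ ι-+ (pos (count (class j) 0)) (ℤ.- pos (count (class j) 1)) ⟨
    ι (e j) ∎
    where
    open Solver
    Z = ι (pos (count (class j) 0))
    N₁ = ι (pos (count (class j) 1))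
    R = ∑< T.p⁻ (λ r → ζ ^ suc r)

  -- Frobenius preserves traces and, p being 3 modulo 4, multiplies exponents by 3 modulo 4; the
  -- class label g ^ m goes to g ^ (3m).
  η₁≈η₃ : η 1 ≈ η 3
  η₁≈η₃ = sym (begin
    η 3
      ≈⟨ T.∑F-class commutativeSemiring ψ ψ-cong 3 ℕ.≤-refl ⟨
    ∑F (λ x → [ x F.^ m F.≟ g F.^ (3 ℕ.* m) ] * ψ x)
      ≈⟨ ∑F-reindex (λ x → [ x F.^ m F.≟ g F.^ (3 ℕ.* m) ] * ψ x)
           (λ {x} {y} eq → *-cong ([]-cong (x F.^ m F.≟ g F.^ (3 ℕ.* m)) (y F.^ m F.≟ g F.^ (3 ℕ.* m))
              (F.trans (T.^-congˡ m (F.sym eq))) (F.trans (T.^-congˡ m eq))) (ψ-cong eq))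
           (T.Frob 1) (T.Frob (N ℕ.∸ 1)) (T.Frob-cong 1) (T.Frob-cong (N ℕ.∸ 1))
           (T.Frob-inverse′ 1 1≤N) (T.Frob-inverse 1 1≤N) ⟩
    ∑F (λ x → [ T.Frob 1 x F.^ m F.≟ g F.^ (3 ℕ.* m) ] * ψ (T.Frob 1 x))
      ≈⟨ ∑F-cong (λ x → *-cong
           ([]-cong (T.Frob 1 x F.^ m F.≟ g F.^ (3 ℕ.* m)) (x F.^ m F.≟ g F.^ (1 ℕ.* m))
             (λ eq → T.Frob-injective 1 1≤N (F.trans (swap x) (F.trans eq (F.sym Frob-g^m))))
             (λ eq → F.trans (F.sym (swap x)) (F.trans (T.Frob-cong 1 eq) Frob-g^m)))
           (reflexive (≡.cong (ζ ^_) (T.ρ-tr-cong (T.tr-Frob 1 x))))) ⟩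
    ∑F (λ x → [ x F.^ m F.≟ g F.^ (1 ℕ.* m) ] * ψ x)
      ≈⟨ T.∑F-class commutativeSemiring ψ ψ-cong 1 (ℕ.s≤s (ℕ.s≤s ℕ.z≤n)) ⟩
    η 1 ∎)
    where
    open T.SumOver commutativeSemiring
    swap : ∀ x → T.Frob 1 (x F.^ m) F.≈ T.Frob 1 x F.^ m
    swap x = F.trans (T.^-assocʳ x m (p ℕ.^ 1)) (F.trans (T.^-congʳ x (ℕ.*-comm m (p ℕ.^ 1))) (F.sym (T.^-assocʳ x (p ℕ.^ 1) m)))
    Frob-g^m : T.Frob 1 (g F.^ (1 ℕ.* m)) F.≈ g F.^ (3 ℕ.* m)
    Frob-g^m = F.trans (T.^-assocʳ g (1 ℕ.* m) (p ℕ.^ 1)) (F.trans (T.^-congʳ g exponent)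
      (F.trans (T.^-homo-* g ((p / 4) ℕ.* (m ℕ.* 4)) (3 ℕ.* m)) (F.trans (F.*-congʳ g^[p/4*4m]≈1) (F.*-identityˡ _))))
      where
      g^[p/4*4m]≈1 : g F.^ ((p / 4) ℕ.* (m ℕ.* 4)) F.≈ F.1#
      g^[p/4*4m]≈1 = F.trans (F.sym (T.^-assocʳ g (p / 4) (m ℕ.* 4))) (T.g^k^n≈1 (p / 4))
      arith : ∀ m a → 1 ℕ.* m ℕ.* ((3 ℕ.+ a ℕ.* 4) ℕ.* 1) ≡ a ℕ.* (m ℕ.* 4) ℕ.+ 3 ℕ.* m
      arith = solve-∀
      exponent : 1 ℕ.* m ℕ.* p ℕ.^ 1 ≡ (p / 4) ℕ.* (m ℕ.* 4) ℕ.+ 3 ℕ.* m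
      exponent = ≡.trans (≡.cong (λ p → 1 ℕ.* m ℕ.* (p ℕ.* 1)) (≡.trans (m≡m%n+[m/n]*n p 4) (≡.cong (ℕ._+ (p / 4) ℕ.* 4) p%4≡3)))
        (arith m (p / 4))

  -- Negation moves the index i to i + h and preserves trace 0, so the two halves of the class
  -- contribute equally.
  count-class-0-0-even : ∃[ k ] count (class 0) 0 ≡ k ℕ.+ k
  count-class-0-0-even = ∑ℕ.∑< h f , ≡.trans (≡.cong (λ k → ∑ℕ.∑< k f) m≡h+h)
    (≡.trans (∑ℕ.∑<-split h h f) (≡.cong (∑ℕ.∑< h f ℕ.+_) (∑ℕ.∑<-cong h (λ i _ → f-shift i))))
    where
    f : ℕ → ℕ
    f i = ∑ℕ.[ ρ (g F.^ (i ℕ.* 4 ℕ.+ 0)) ℕ.≟ 0 ]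
    arith : ∀ h i → (h ℕ.+ i) ℕ.* 4 ℕ.+ 0 ≡ h ℕ.* 4 ℕ.+ (i ℕ.* 4 ℕ.+ 0)
    arith = solve-∀
    tr-neg : ∀ x → T.tr x F.≈ F.0# → T.tr (F.- x) F.≈ F.0#
    tr-neg x eq = F.trans (F.sym (F.+-identityˡ _)) (F.trans (F.+-congʳ (F.sym eq))
      (F.trans (F.sym (T.tr-+ x (F.- x))) (F.trans (T.tr-cong (F.-‿inverseʳ x)) T.tr-0)))
    f-shift : ∀ i → f (h ℕ.+ i) ≡ f i
    f-shift i = ∑ℕ.[]-cong (ρ x′ ℕ.≟ 0) (ρ x ℕ.≟ 0)
      (λ eq → T.ρ≡0 (F.trans (T.tr-cong (F.trans (F.sym (T.-‿involutive x)) (F.-‿cong (F.sym x′≈-x)))) (tr-neg x′ (T.ρ≡0⇒tr≈0 eq))))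
      (λ eq → T.ρ≡0 (F.trans (T.tr-cong x′≈-x) (tr-neg x (T.ρ≡0⇒tr≈0 eq))))
      where
      x = g F.^ (i ℕ.* 4 ℕ.+ 0)
      x′ = g F.^ ((h ℕ.+ i) ℕ.* 4 ℕ.+ 0)
      x′≈-x : x′ F.≈ F.- x
      x′≈-x = F.trans (T.^-congʳ g (arith h i)) (g^[4h+k]≈-g^k (i ℕ.* 4 ℕ.+ 0))

  e₁≡e₃ : e 1 ≡ e 3
  e₁≡e₃ = ι-injective (trans (sym (η≈ι 1)) (trans η₁≈η₃ (η≈ι 3)))

  -- The bracketing with a final 0 is what `∑< 4` unfolds to. The integer equations keep this shape
  -- until `ℤ-Solver` normalises them.
  ι-∑4 : ∀ (f : ℕ → ℤ) (f′ : ℕ → Carrier) → (∀ j → ι (f j) ≈ f′ j) →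
         ι (f 0 ℤ.+ (f 1 ℤ.+ (f 2 ℤ.+ (f 3 ℤ.+ ℤ.0ℤ)))) ≈ ∑< 4 f′
  ι-∑4 f f′ eq =
    trans (ι-+ (f 0) (f 1 ℤ.+ (f 2 ℤ.+ (f 3 ℤ.+ ℤ.0ℤ)))) (+-cong (eq 0)
    (trans (ι-+ (f 1) (f 2 ℤ.+ (f 3 ℤ.+ ℤ.0ℤ))) (+-cong (eq 1)
    (trans (ι-+ (f 2) (f 3 ℤ.+ ℤ.0ℤ)) (+-cong (eq 2)
    (trans (ι-+ (f 3) ℤ.0ℤ) (+-congʳ (eq 3))))))))

  ∑e : ℤ.1ℤ ℤ.+ (e 0 ℤ.+ (e 1 ℤ.+ (e 2 ℤ.+ (e 3 ℤ.+ ℤ.0ℤ)))) ≡ ℤ.0ℤ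
  ∑e = ι-injective (trans (ι-+ ℤ.1ℤ (e 0 ℤ.+ (e 1 ℤ.+ (e 2 ℤ.+ (e 3 ℤ.+ ℤ.0ℤ)))))
    (trans (+-cong ι-1 (ι-∑4 e η (λ j → sym (η≈ι j)))) ∑η))

  e-correlation : ∀ a b → a ℕ.< 4 → b ℕ.< 4 →
    e a ℤ.* e b ℤ.+ (e (1 ℕ.+ a) ℤ.* e (1 ℕ.+ b) ℤ.+ (e (2 ℕ.+ a) ℤ.* e (2 ℕ.+ b) ℤ.+ (e (3 ℕ.+ a) ℤ.* e (3 ℕ.+ b) ℤ.+ ℤ.0ℤ)))
      ≡ pos (∑ℕ.[ a ℕ.≟ b ]) ℤ.* pos (p ℕ.^ N) ℤ.- pos m
  e-correlation a b a<4 b<4 = ι-injective (trans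
    (ι-∑4 (λ j → e (j ℕ.+ a) ℤ.* e (j ℕ.+ b)) (λ j → η (j ℕ.+ a) * η (j ℕ.+ b))
      (λ j → trans (ι-* (e (j ℕ.+ a)) (e (j ℕ.+ b))) (sym (*-cong (η≈ι (j ℕ.+ a)) (η≈ι (j ℕ.+ b))))))
    (trans (η-correlation a b a<4 b<4) (sym (trans (ι-+ (pos ∑ℕ.[ a ℕ.≟ b ] ℤ.* pos (p ℕ.^ N)) (ℤ.- pos m))
      (+-cong (trans (ι-* (pos ∑ℕ.[ a ℕ.≟ b ]) (pos (p ℕ.^ N))) (*-congʳ (ι-[] (a ℕ.≟ b)))) (ι-neg (pos m)))))))

  e-periodic : ∀ j → e (4 ℕ.+ j) ≡ e j
  e-periodic j = ι-injective (trans (sym (η≈ι (4 ℕ.+ j))) (trans (η-shift 1 j) (η≈ι j)))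

  -- Sums over the differences of a family of field elements

  module Differences (M : ℕ) (α : Fin M → F.Carrier) where
    S : F.Carrier → Carrier
    S x = sum (λ i → ψ (α i F.* x))

    S-cong : S Preserves F._≈_ ⟶ _≈_
    S-cong eq = sum-cong {M} (λ i → ψ-cong (F.*-congˡ eq))

    -- This is S(x) S(-x), over ℂ the square |S(x)|², expanded into differences so that no
    -- conjugation occurs.
    P : F.Carrier → Carrier
    P x = sum (λ i → sum (λ j → ψ ((α i F.- α j) F.* x)))

    P-cong : P Preserves F._≈_ ⟶ _≈_
    P-cong eq = sum-cong {M} (λ i → sum-cong {M} (λ j → ψ-cong (F.*-congˡ eq)))

    S≈0⇒P≈0 : ∀ x → S x ≈ 0# → P x ≈ 0#
    S≈0⇒P≈0 x S≈0 = begin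
      P x
        ≈⟨ sum-cong {M} (λ i → sum-cong {M} (λ j → trans
             (ψ-cong (solve 3 (λ a b x → (a :- b) :* x := a :* x :+ (:- (b :* x))) F.refl (α i) (α j) x))
             (ψ-+ (α i F.* x) (F.- (α j F.* x))))) ⟩
      sum (λ i → sum (λ j → ψ (α i F.* x) * ψ (F.- (α j F.* x))))
        ≈⟨ sum*sum {M} {M} (λ i → ψ (α i F.* x)) (λ j → ψ (F.- (α j F.* x))) ⟨
      S x * sum (λ j → ψ (F.- (α j F.* x)))
        ≈⟨ *-congʳ S≈0 ⟩
      0# * sum (λ j → ψ (F.- (α j F.* x)))
        ≈⟨ zeroˡ _ ⟩
      0# ∎
      where open T.Solver using (solve; _:+_; _:*_; _:-_; :-_; _:=_)

    counts : F.Carrier → ℕ → ℕ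
    counts x = count (λ i → α i F.* x)

    ∑counts : ∀ x → ∑ℕ.∑< p (counts x) ≡ M
    ∑counts x = ≡.trans (∑ℕ.∑-comm {p} {M} (λ r i → ∑ℕ.[ ρ (α i F.* x) ℕ.≟ toℕ r ]))
      (≡.trans (∑ℕ.sum-cong {M} (λ i → ≡.trans
          (∑ℕ.∑<-cong p (λ r _ → ≡.trans (∑ℕ.[]-cong (ρ (α i F.* x) ℕ.≟ r) (r ℕ.≟ ρ (α i F.* x)) ≡.sym ≡.sym) (≡.sym (ℕ.*-identityʳ _))))
          (∑ℕ.∑<-select p (ρ (α i F.* x)) (T.ρ<p (α i F.* x)) (λ _ → 1))))
        (∑1 M))
      where
      ∑1 : ∀ k → ∑ℕ.sum {k} (λ _ → 1) ≡ k
      ∑1 zero    = ≡.refl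
      ∑1 (suc k) = ≡.cong suc (∑1 k)

    square-counts : F.Carrier → ℕ
    square-counts x = ∑ℕ.∑< p (λ r → counts x r ℕ.* counts x r)

    -- Sort the pairs with equal residues by their common residue s.
    ∑≟≡square-counts : ∀ x → ∑ℕ.sum (λ i → ∑ℕ.sum (λ j → ∑ℕ.[ ρ (α j F.* x) ℕ.≟ ρ (α i F.* x) ])) ≡ square-counts x
    ∑≟≡square-counts x = ≡.trans
      (∑ℕ.sum-cong {M} (λ i → ∑ℕ.sum-cong {M} (λ j →
        ≡.sym (∑ℕ.∑<-select p (r i) (T.ρ<p (α i F.* x)) (λ s → ∑ℕ.[ r j ℕ.≟ s ])))))
      (≡.trans (∑ℕ.sum-cong {M} (λ i → ∑ℕ.∑-comm {M} {p} (λ j s → ∑ℕ.[ toℕ s ℕ.≟ r i ] ℕ.* ∑ℕ.[ r j ℕ.≟ toℕ s ])))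
      (≡.trans (∑ℕ.∑-comm {M} {p} (λ i s → ∑ℕ.sum (λ j → ∑ℕ.[ toℕ s ℕ.≟ r i ] ℕ.* ∑ℕ.[ r j ℕ.≟ toℕ s ])))
      (∑ℕ.∑<-cong p (λ s _ → ≡.trans
        (∑ℕ.sum-cong {M} (λ i → ≡.trans
          (≡.sym (∑ℕ.*-distribˡ-sum {M} ∑ℕ.[ s ℕ.≟ r i ] (λ j → ∑ℕ.[ r j ℕ.≟ s ])))
          (≡.cong (ℕ._* counts x s) (∑ℕ.[]-cong (s ℕ.≟ r i) (r i ℕ.≟ s) ≡.sym ≡.sym))))
        (≡.sym (∑ℕ.*-distribʳ-sum {M} (counts x s) (λ i → ∑ℕ.[ r i ℕ.≟ s ])))))))
      where
      r : Fin M → ℕ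
      r i = ρ (α i F.* x)

    -- Summing over the line through x, t = 0 included, singles out the pairs with Tr((α i - α j) x)
    -- = 0: each of them contributes p, every other pair 0.
    ∑P[t·x] : ∀ x → ∑< p (λ t → P (t F.· x)) ≈ ι (pos (p ℕ.* square-counts x))
    ∑P[t·x] x = begin
      ∑< p (λ t → P (t F.· x))
        ≈⟨ ∑-comm {p} {M} (λ t i → sum (λ j → ψ ((α i F.- α j) F.* (toℕ t F.· x)))) ⟩
      sum (λ i → ∑< p (λ t → sum (λ j → ψ ((α i F.- α j) F.* (t F.· x)))))
        ≈⟨ sum-cong {M} (λ i → ∑-comm {p} {M} (λ t j → ψ ((α i F.- α j) F.* (toℕ t F.· x)))) ⟩
      sum (λ i → sum (λ j → ∑< p (λ t → ψ ((α i F.- α j) F.* (t F.· x)))))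
        ≈⟨ sum-cong {M} (λ i → sum-cong {M} (λ j → inner i j)) ⟩
      sum (λ i → sum (λ j → ι (pos p) * ι (pos ∑ℕ.[ ρ (α j F.* x) ℕ.≟ ρ (α i F.* x) ])))
        ≈⟨ sum-cong {M} (λ i → *-distribˡ-sum {M} (ι (pos p)) (λ j → ι (pos ∑ℕ.[ ρ (α j F.* x) ℕ.≟ ρ (α i F.* x) ]))) ⟨
      sum (λ i → ι (pos p) * sum (λ j → ι (pos ∑ℕ.[ ρ (α j F.* x) ℕ.≟ ρ (α i F.* x) ])))
        ≈⟨ *-distribˡ-sum {M} (ι (pos p)) (λ i → sum (λ j → ι (pos ∑ℕ.[ ρ (α j F.* x) ℕ.≟ ρ (α i F.* x) ]))) ⟨
      ι (pos p) * sum (λ i → sum (λ j → ι (pos ∑ℕ.[ ρ (α j F.* x) ℕ.≟ ρ (α i F.* x) ])))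
        ≈⟨ *-congˡ (trans (ι-sum {M} _) (sum-cong {M} (λ i → ι-sum {M} (λ j → ∑ℕ.[ ρ (α j F.* x) ℕ.≟ ρ (α i F.* x) ])))) ⟨
      ι (pos p) * ι (pos (∑ℕ.sum (λ i → ∑ℕ.sum (λ j → ∑ℕ.[ ρ (α j F.* x) ℕ.≟ ρ (α i F.* x) ]))))
        ≡⟨ ≡.cong (λ k → ι (pos p) * ι (pos k)) (∑≟≡square-counts x) ⟩
      ι (pos p) * ι (pos (square-counts x))
        ≈⟨ ι-* (pos p) (pos (square-counts x)) ⟨
      ι (pos p ℤ.* pos (square-counts x))
        ≡⟨ ≡.cong ι (ℤ.pos-* p (square-counts x)) ⟨
      ι (pos (p ℕ.* square-counts x)) ∎
      where
      open T.Solver using (solve; _:+_; _:*_; _:-_; :-_; _:=_)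
      inner : ∀ i j → ∑< p (λ t → ψ ((α i F.- α j) F.* (t F.· x))) ≈ ι (pos p) * ι (pos ∑ℕ.[ ρ (α j F.* x) ℕ.≟ ρ (α i F.* x) ])
      inner i j = begin
        ∑< p (λ t → ψ ((α i F.- α j) F.* (t F.· x)))
          ≈⟨ ∑<-cong p (λ t _ → trans (ψ-cong (T.×-comm-* t (α i F.- α j) x)) (ψ-· t y)) ⟩
        ∑< p ((ζ ^ ρ y) ^_)
          ≈⟨ ∑ζ^rt (ρ y) (T.ρ<p y) ⟩
        [ ρ y ℕ.≟ 0 ] * ι (pos p)
          ≈⟨ *-congʳ ([]-cong (ρ y ℕ.≟ 0) (ρ (α j F.* x) ℕ.≟ ρ (α i F.* x)) to from) ⟩
        [ ρ (α j F.* x) ℕ.≟ ρ (α i F.* x) ] * ι (pos p)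
          ≈⟨ *-comm _ _ ⟩
        ι (pos p) * [ ρ (α j F.* x) ℕ.≟ ρ (α i F.* x) ]
          ≈⟨ *-congˡ (ι-[] (ρ (α j F.* x) ℕ.≟ ρ (α i F.* x))) ⟨
        ι (pos p) * ι (pos ∑ℕ.[ ρ (α j F.* x) ℕ.≟ ρ (α i F.* x) ]) ∎
        where
        y = (α i F.- α j) F.* x
        αi≈y+αj : α i F.* x F.≈ y F.+ α j F.* x
        αi≈y+αj = solve 3 (λ a b x → a :* x := (a :- b) :* x :+ b :* x) F.refl (α i) (α j) x
        to : ρ y ≡ 0 → ρ (α j F.* x) ≡ ρ (α i F.* x)
        to eq = T.ρ-tr-cong (F.sym (F.trans (T.tr-cong αi≈y+αj) (F.trans (T.tr-+ y (α j F.* x))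
          (F.trans (F.+-congʳ (T.ρ≡0⇒tr≈0 eq)) (F.+-identityˡ _)))))
        from : ρ (α j F.* x) ≡ ρ (α i F.* x) → ρ y ≡ 0
        from eq = T.ρ≡0 (T.+-cancelʳ (T.tr (α j F.* x)) (T.tr y) F.0# (F.trans (F.sym (T.tr-+ y (α j F.* x)))
          (F.trans (T.tr-cong (F.sym αi≈y+αj)) (F.trans (F.sym (T.ρ·1≈tr (α i F.* x)))
          (F.trans (F.reflexive (≡.cong (F._· F.1#) (≡.sym eq))) (F.trans (T.ρ·1≈tr (α j F.* x)) (F.sym (F.+-identityˡ _))))))))

    spread : F.Carrier → ℕ
    spread x = ∑ℕ.∑< p (λ r → ∑ℕ.∑< p (λ s → ℕ.∣ counts x r - counts x s ∣ ℕ.* ℕ.∣ counts x r - counts x s ∣))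

    spread-identity : ∀ x → spread x ℕ.+ (M ℕ.* M ℕ.+ M ℕ.* M) ≡ p ℕ.* square-counts x ℕ.+ p ℕ.* square-counts x
    spread-identity x = ≡.trans (≡.cong (λ k → spread x ℕ.+ (k ℕ.* k ℕ.+ k ℕ.* k)) (≡.sym (∑counts x))) (variance p (counts x))

    spread≡0⇒S≈0 : ∀ x → spread x ≡ 0 → S x ≈ 0#
    spread≡0⇒S≈0 x spread≡0 = begin
      S x
        ≈⟨ ∑ψ-by-residue (λ i → α i F.* x) ⟩
      ∑< p (λ r → ι (pos (counts x r)) * ζ ^ r)
        ≈⟨ ∑<-cong p (λ r r<p → *-congʳ {ζ ^ r} (reflexive (≡.cong (ι ∘ pos) (constant r r<p)))) ⟩
      ∑< p (λ r → ι (pos (counts x 0)) * ζ ^ r)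
        ≈⟨ *-distribˡ-sum {p} (ι (pos (counts x 0))) (λ r → ζ ^ toℕ r) ⟨
      ι (pos (counts x 0)) * ∑< p (ζ ^_)
        ≈⟨ *-congˡ ∑ζ^r≈0 ⟩
      ι (pos (counts x 0)) * 0#
        ≈⟨ zeroʳ _ ⟩
      0# ∎
      where
      square : ℕ → ℕ → ℕ
      square r s = ℕ.∣ counts x r - counts x s ∣ ℕ.* ℕ.∣ counts x r - counts x s ∣
      constant : ∀ r → r ℕ.< p → counts x r ≡ counts x 0
      constant r r<p = ℕ.∣m-n∣≡0⇒m≡n (square≡0 (∑ℕ<≡0 p (square r) (∑ℕ<≡0 p (λ r → ∑ℕ.∑< p (square r)) spread≡0 r r<p) 0 (ℕ.<-trans ℕ.z<s T.1<p)))
        where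
        square≡0 : ∀ {k} → k ℕ.* k ≡ 0 → k ≡ 0
        square≡0 {zero} _ = ≡.refl

    block : ℕ → Carrier
    block j = ∑< m (λ i → P (g F.^ (i ℕ.* 4 ℕ.+ j)))

    -- The classes `j₁` and `j₂` that make up B are parameters, so that both cases of the theorem
    -- are treated at once. `H` will be (Q + 1)/2.
    module Clique
      (α-differences : ∀ i j → i ≢ j → ∃[ l ] ((l % 4 ≡ 0 ⊎ l % 4 ≡ 1) × α i F.- α j F.≈ g F.^ l))
      (j₁ j₂ H Q : ℕ) (2m+H≡QH : m ℕ.+ m ℕ.+ H ≡ Q ℕ.* H)
      (η-pair : ∀ l → l % 4 ≡ 0 ⊎ l % 4 ≡ 1 → η (l ℕ.+ j₁) + η (l ℕ.+ j₂) ≈ - ι (pos H)) where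

      private
        inner : ℕ → Fin M → Fin M → Carrier
        inner j a b = ∑< m (λ i → ψ ((α a F.- α b) F.* g F.^ (i ℕ.* 4 ℕ.+ j)))

        block≈ : ∀ j → block j ≈ sum (λ a → sum (λ b → inner j a b))
        block≈ j = trans (∑-comm {m} {M} (λ i a → sum (λ b → ψ ((α a F.- α b) F.* g F.^ (toℕ i ℕ.* 4 ℕ.+ j)))))
          (sum-cong {M} (λ a → ∑-comm {m} {M} (λ i b → ψ ((α a F.- α b) F.* g F.^ (toℕ i ℕ.* 4 ℕ.+ j)))))

        inner-diagonal : ∀ j a → inner j a a ≈ ι (pos m)
        inner-diagonal j a = trans (∑<-cong m (λ i _ → trans (ψ-cong (F.trans (F.*-congʳ (F.-‿inverseʳ (α a))) (F.zeroˡ (g F.^ (i ℕ.* 4 ℕ.+ j))))) ψ-0))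
          (∑<-const m 1#)

        QH : Carrier
        QH = ι (pos (Q ℕ.* H))

        -- Off the diagonal this is `η-pair`. On it the two sums give 2m = QH - H, so both cases
        -- share the term -H and differ by a Kronecker delta.
        inner-pair : ∀ a b → inner j₁ a b + inner j₂ a b ≈ [ b Fin.≟ a ] * QH - ι (pos H)
        inner-pair a b = decide (b Fin.≟ a)
          where
          open Solver
          decide : Dec (b ≡ a) → inner j₁ a b + inner j₂ a b ≈ [ b Fin.≟ a ] * QH - ι (pos H)
          decide (yes ≡.refl) = begin
            inner j₁ a a + inner j₂ a a
              ≈⟨ +-cong (inner-diagonal j₁ a) (inner-diagonal j₂ a) ⟩
            ι (pos m) + ι (pos m)
              ≈⟨ solve 2 (λ m h → m :+ m := m :+ m :+ h :- h) refl (ι (pos m)) (ι (pos H)) ⟩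
            ι (pos m) + ι (pos m) + ι (pos H) - ι (pos H)
              ≈⟨ +-congʳ (trans (ι-+ (pos (m ℕ.+ m)) (pos H)) (+-congʳ (ι-+ (pos m) (pos m)))) ⟨
            ι (pos (m ℕ.+ m ℕ.+ H)) - ι (pos H)
              ≡⟨ ≡.cong (λ k → ι (pos k) - ι (pos H)) 2m+H≡QH ⟩
            QH - ι (pos H)
              ≈⟨ +-congʳ (trans (*-congʳ ([]-yes (a Fin.≟ a) ≡.refl)) (*-identityˡ QH)) ⟨
            [ a Fin.≟ a ] * QH - ι (pos H) ∎
          decide (no b≢a) = begin
            inner j₁ a b + inner j₂ a b
              ≈⟨ +-cong (η-twist j₁ _ l α≈) (η-twist j₂ _ l α≈) ⟩
            η (l ℕ.+ j₁) + η (l ℕ.+ j₂)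
              ≈⟨ η-pair l (proj₁ (proj₂ difference)) ⟩
            - ι (pos H)
              ≈⟨ +-identityˡ _ ⟨
            0# - ι (pos H)
              ≈⟨ +-congʳ (trans (*-congʳ ([]-no (b Fin.≟ a) b≢a)) (zeroˡ QH)) ⟨
            [ b Fin.≟ a ] * QH - ι (pos H) ∎
            where
            difference = α-differences a b (λ eq → b≢a (≡.sym eq))
            l = proj₁ difference
            α≈ = proj₂ (proj₂ difference)

        ∑-constant : ∀ k x → sum {k} (λ _ → x) ≈ ι (pos k) * x
        ∑-constant k x = sym (trans (*-congʳ (sym (sum-replicate k))) (trans (*-distribʳ-sum {k} x (λ _ → 1#)) (sum-cong {k} (λ _ → *-identityˡ x))))

      -- Each of the M rows contributes QH once, from the diagonal, and -H from each of its M
      -- entries.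
      blocks-value : block j₁ + block j₂ ≈ ι (pos M ℤ.* (pos (Q ℕ.* H) ℤ.- pos M ℤ.* pos H))
      blocks-value = begin
        block j₁ + block j₂
          ≈⟨ +-cong (block≈ j₁) (block≈ j₂) ⟩
        sum (λ a → sum (λ b → inner j₁ a b)) + sum (λ a → sum (λ b → inner j₂ a b))
          ≈⟨ ∑-distrib-+ {M} (λ a → sum (λ b → inner j₁ a b)) (λ a → sum (λ b → inner j₂ a b)) ⟨
        sum (λ a → sum (λ b → inner j₁ a b) + sum (λ b → inner j₂ a b))
          ≈⟨ sum-cong {M} (λ a → ∑-distrib-+ {M} (inner j₁ a) (inner j₂ a)) ⟨
        sum (λ a → sum (λ b → inner j₁ a b + inner j₂ a b))
          ≈⟨ sum-cong {M} (λ a → sum-cong {M} (λ b → inner-pair a b)) ⟩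
        sum {M} (λ a → sum {M} (λ b → [ b Fin.≟ a ] * QH - ι (pos H)))
          ≈⟨ sum-cong {M} row ⟩
        sum {M} (λ a → QH - ι (pos M) * ι (pos H))
          ≈⟨ ∑-constant M _ ⟩
        ι (pos M) * (QH - ι (pos M) * ι (pos H))
          ≈⟨ *-congˡ (+-congˡ (-‿cong (ι-* (pos M) (pos H)))) ⟨
        ι (pos M) * (QH - ι (pos M ℤ.* pos H))
          ≈⟨ *-congˡ (trans (ι-+ (pos (Q ℕ.* H)) (ℤ.- (pos M ℤ.* pos H))) (+-congˡ (ι-neg (pos M ℤ.* pos H)))) ⟨
        ι (pos M) * ι (pos (Q ℕ.* H) ℤ.- pos M ℤ.* pos H)
          ≈⟨ ι-* (pos M) (pos (Q ℕ.* H) ℤ.- pos M ℤ.* pos H) ⟨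
        ι (pos M ℤ.* (pos (Q ℕ.* H) ℤ.- pos M ℤ.* pos H)) ∎
        where
        row : ∀ a → sum (λ b → [ b Fin.≟ a ] * QH - ι (pos H)) ≈ QH - ι (pos M) * ι (pos H)
        row a = begin
          sum (λ b → [ b Fin.≟ a ] * QH - ι (pos H))
            ≈⟨ ∑-distrib-+ {M} (λ b → [ b Fin.≟ a ] * QH) (λ _ → - ι (pos H)) ⟩
          sum (λ b → [ b Fin.≟ a ] * QH) + sum {M} (λ _ → - ι (pos H))
            ≈⟨ +-cong (sum-select {M} a (λ _ → QH)) (trans (∑-constant M (- ι (pos H))) (sym (-‿distribʳ-* _ _))) ⟩
          QH - ι (pos M) * ι (pos H) ∎

      -- The blocks vanish, hence M (QH - MH) = 0. The distinction which factor is 0 takes place in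
      -- ℤ, since cancellation in `K` does not decide it.
      vanishing⇒M≡Q : .{{_ : ℕ.NonZero M}} .{{_ : ℕ.NonZero H}} →
                      (∀ i j → i ℕ.< m → j ≡ j₁ ⊎ j ≡ j₂ → S (g F.^ (i ℕ.* 4 ℕ.+ j)) ≈ 0#) → M ≡ Q
      vanishing⇒M≡Q S≈0 = conclude (ℤ.i*j≡0⇒i≡0∨j≡0 (pos M) (ι≈0⇒≡0 _ (trans (sym blocks-value)
          (trans (+-cong (block≈0 j₁ (inj₁ ≡.refl)) (block≈0 j₂ (inj₂ ≡.refl))) (+-identityˡ 0#)))))
        where
        block≈0 : ∀ j → j ≡ j₁ ⊎ j ≡ j₂ → block j ≈ 0#
        block≈0 j j∈ = trans (∑<-cong m (λ i i<m → S≈0⇒P≈0 _ (S≈0 i j i<m j∈))) (sum-replicate-zero m)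
        conclude : pos M ≡ ℤ.0ℤ ⊎ pos (Q ℕ.* H) ℤ.- pos M ℤ.* pos H ≡ ℤ.0ℤ → M ≡ Q
        conclude (inj₁ M≡0)     = contradiction (ℤ.+-injective M≡0) (ℕ.≢-nonZero⁻¹ M)
        conclude (inj₂ QH-MH≡0) = ≡.sym (ℕ.*-cancelʳ-≡ Q M H (ℤ.+-injective
          (≡.trans (ℤ.i-j≡0⇒i≡j _ _ QH-MH≡0) (≡.sym (ℤ.pos-* M H)))))

      -- The orbits of 𝔽ₚ* turn the vanishing of the blocks into the vanishing
      -- of a sum of natural numbers.
      M≡Q⇒vanishing : M ≡ Q → ∀ i j → i ℕ.< m → j ≡ j₁ ⊎ j ≡ j₂ → S (g F.^ (i ℕ.* 4 ℕ.+ j)) ≈ 0#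
      M≡Q⇒vanishing M≡Q i j i<m j∈ = spread≡0⇒S≈0 _ (spread≡0 j∈)
        where
        open Solver
        x : ℕ → ℕ → F.Carrier
        x j i = g F.^ (i ℕ.* 4 ℕ.+ j)
        blocks≈0 : block j₁ + block j₂ ≈ 0#
        blocks≈0 = trans blocks-value (reflexive (≡.cong ι (≡.trans
          (≡.cong (pos M ℤ.*_) (ℤ.i≡j⇒i-j≡0 (≡.trans (≡.cong (λ k → pos (k ℕ.* H)) (≡.sym M≡Q)) (ℤ.pos-* M H)))) (ℤ.*-zeroʳ (pos M)))))
        -- A non-zero scalar of the prime field is some g ^ (4a), so multiplication by it permutes
        -- the class.
        shifted : ∀ j t → t ℕ.< T.p⁻ → ∑< m (λ i → P (suc t F.· x j i)) ≈ block j
        shifted j t t<p⁻ = trans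
          (∑<-cong m (λ i _ → P-cong (F.trans (T.m·x≈[m·1]*x (suc t) (x j i)) (F.trans (F.*-congʳ (proj₂ scalar))
            (F.trans (F.sym (T.^-homo-* g (proj₁ scalar ℕ.* 4) (i ℕ.* 4 ℕ.+ j))) (T.^-congʳ g (arith (proj₁ scalar) i j)))))))
          (∑<-class-shift commutativeSemiring P P-cong (proj₁ scalar) j)
          where
          scalar = r·1≈g^[4a] (suc t) ℕ.z<s (≡.subst (suc t ℕ.<_) T.1+p⁻≡p (ℕ.s≤s t<p⁻))
          arith : ∀ a i j → a ℕ.* 4 ℕ.+ (i ℕ.* 4 ℕ.+ j) ≡ i ℕ.* 4 ℕ.+ (a ℕ.* 4 ℕ.+ j)
          arith = solve-∀
        P-0 : ∀ y → P (0 F.· y) ≈ ι (pos (M ℕ.* M))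
        P-0 y = begin
          P F.0#
            ≈⟨ sum-cong {M} (λ a → sum-cong {M} (λ b → trans (ψ-cong (F.zeroʳ (α a F.- α b))) ψ-0)) ⟩
          sum {M} (λ a → sum {M} (λ b → 1#))
            ≈⟨ trans (sum-cong {M} (λ a → ∑-constant M 1#)) (∑-constant M _) ⟩
          ι (pos M) * (ι (pos M) * 1#)
            ≈⟨ *-congˡ (*-identityʳ _) ⟩
          ι (pos M) * ι (pos M)
            ≈⟨ ι-* (pos M) (pos M) ⟨
          ι (pos M ℤ.* pos M)
            ≡⟨ ≡.cong ι (ℤ.pos-* M M) ⟨
          ι (pos (M ℕ.* M)) ∎
        -- Leaving out t = 0, whose term is M², turns p Σ n_r² into p Σ n_r² - M², which is half of
        -- the spread.
        ∑P-suc : ∀ y → ∑< T.p⁻ (λ t → P (suc t F.· y)) + ∑< T.p⁻ (λ t → P (suc t F.· y)) ≈ ι (pos (spread y))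
        ∑P-suc y = begin
          R + R
            ≈⟨ solve 2 (λ r c → r :+ r := (c :+ r) :+ (c :+ r) :- (c :+ c)) refl R (P (0 F.· y)) ⟩
          (P (0 F.· y) + R) + (P (0 F.· y) + R) - (P (0 F.· y) + P (0 F.· y))
            ≡⟨ ≡.cong (λ k → ∑< k (λ t → P (t F.· y)) + ∑< k (λ t → P (t F.· y)) - (P (0 F.· y) + P (0 F.· y))) T.1+p⁻≡p ⟩
          ∑< p (λ t → P (t F.· y)) + ∑< p (λ t → P (t F.· y)) - (P (0 F.· y) + P (0 F.· y))
            ≈⟨ +-cong (+-cong (∑P[t·x] y) (∑P[t·x] y)) (-‿cong (+-cong (P-0 y) (P-0 y))) ⟩
          ι (pos pV) + ι (pos pV) - (ι (pos MM) + ι (pos MM))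
            ≈⟨ +-cong (ι-+ (pos pV) (pos pV)) (-‿cong (ι-+ (pos MM) (pos MM))) ⟨
          ι (pos (pV ℕ.+ pV)) - ι (pos (MM ℕ.+ MM))
            ≡⟨ ≡.cong (λ k → ι (pos k) - ι (pos (MM ℕ.+ MM))) (spread-identity y) ⟨
          ι (pos (spread y ℕ.+ (MM ℕ.+ MM))) - ι (pos (MM ℕ.+ MM))
            ≈⟨ +-congʳ (ι-+ (pos (spread y)) (pos (MM ℕ.+ MM))) ⟩
          ι (pos (spread y)) + ι (pos (MM ℕ.+ MM)) - ι (pos (MM ℕ.+ MM))
            ≈⟨ solve 2 (λ a b → a :+ b :- b := a) refl (ι (pos (spread y))) (ι (pos (MM ℕ.+ MM))) ⟩
          ι (pos (spread y)) ∎
          where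
          R = ∑< T.p⁻ (λ t → P (suc t F.· y))
          pV = p ℕ.* square-counts y
          MM = M ℕ.* M
        spread-block : ∀ j → ι (pos (∑ℕ.∑< m (λ i → spread (x j i)))) ≈ ∑< T.p⁻ (λ _ → block j) + ∑< T.p⁻ (λ _ → block j)
        spread-block j = begin
          ι (pos (∑ℕ.∑< m (λ i → spread (x j i))))
            ≈⟨ ι-sum {m} (λ i → spread (x j (toℕ i))) ⟩
          ∑< m (λ i → ι (pos (spread (x j i))))
            ≈⟨ ∑<-cong m (λ i _ → ∑P-suc (x j i)) ⟨
          ∑< m (λ i → ∑< T.p⁻ (λ t → P (suc t F.· x j i)) + ∑< T.p⁻ (λ t → P (suc t F.· x j i)))
            ≈⟨ ∑-distrib-+ {m} (λ i → ∑< T.p⁻ (λ t → P (suc t F.· x j (toℕ i)))) (λ i → ∑< T.p⁻ (λ t → P (suc t F.· x j (toℕ i)))) ⟩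
          ∑< m (λ i → ∑< T.p⁻ (λ t → P (suc t F.· x j i))) + ∑< m (λ i → ∑< T.p⁻ (λ t → P (suc t F.· x j i)))
            ≈⟨ +-cong swap swap ⟩
          ∑< T.p⁻ (λ _ → block j) + ∑< T.p⁻ (λ _ → block j) ∎
          where
          swap : ∑< m (λ i → ∑< T.p⁻ (λ t → P (suc t F.· x j i))) ≈ ∑< T.p⁻ (λ _ → block j)
          swap = trans (∑-comm {m} {T.p⁻} (λ i t → P (suc (toℕ t) F.· x j (toℕ i)))) (∑<-cong T.p⁻ (shifted j))
        -- In `K` this is a multiple of block j₁ + block j₂ = 0; characteristic zero brings the
        -- equation back to ℕ.
        total : ∑ℕ.∑< m (λ i → spread (x j₁ i)) ℕ.+ ∑ℕ.∑< m (λ i → spread (x j₂ i)) ≡ 0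
        total = ℤ.+-injective (ι≈0⇒≡0 _ (begin
          ι (pos (A₁ ℕ.+ A₂))
            ≈⟨ ι-+ (pos A₁) (pos A₂) ⟩
          ι (pos A₁) + ι (pos A₂)
            ≈⟨ +-cong (spread-block j₁) (spread-block j₂) ⟩
          (∑< T.p⁻ (λ _ → block j₁) + ∑< T.p⁻ (λ _ → block j₁)) + (∑< T.p⁻ (λ _ → block j₂) + ∑< T.p⁻ (λ _ → block j₂))
            ≈⟨ +-cong (+-cong (∑-constant T.p⁻ _) (∑-constant T.p⁻ _)) (+-cong (∑-constant T.p⁻ _) (∑-constant T.p⁻ _)) ⟩
          (k * block j₁ + k * block j₁) + (k * block j₂ + k * block j₂)
            ≈⟨ solve 3 (λ k a b → (k :* a :+ k :* a) :+ (k :* b :+ k :* b) := k :* (a :+ b) :+ k :* (a :+ b)) refl k (block j₁) (block j₂) ⟩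
          k * (block j₁ + block j₂) + k * (block j₁ + block j₂)
            ≈⟨ +-cong (trans (*-congˡ blocks≈0) (zeroʳ k)) (trans (*-congˡ blocks≈0) (zeroʳ k)) ⟩
          0# + 0#
            ≈⟨ +-identityˡ 0# ⟩
          0# ∎))
          where
          A₁ = ∑ℕ.∑< m (λ i → spread (x j₁ i))
          A₂ = ∑ℕ.∑< m (λ i → spread (x j₂ i))
          k = ι (pos T.p⁻)
        spread≡0 : j ≡ j₁ ⊎ j ≡ j₂ → spread (x j i) ≡ 0
        spread≡0 (inj₁ ≡.refl) = ∑ℕ<≡0 m (λ i → spread (x j₁ i)) (ℕ.m+n≡0⇒m≡0 (∑ℕ.∑< m (λ i → spread (x j₁ i))) total) i i<m
        spread≡0 (inj₂ ≡.refl) = ∑ℕ<≡0 m (λ i → spread (x j₂ i)) (ℕ.m+n≡0⇒n≡0 (∑ℕ.∑< m (λ i → spread (x j₁ i))) total) i i<m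

-- The equations between the periods, solved in ℤ

i²≡j²⇒i≡±j : ∀ i j → i ℤ.* i ≡ j ℤ.* j → i ≡ j ⊎ i ≡ ℤ.- j
i²≡j²⇒i≡±j i j eq with ℤ.i*j≡0⇒i≡0∨j≡0 (i ℤ.- j) {i ℤ.+ j} (≡.trans (factor i j) (ℤ.i≡j⇒i-j≡0 eq))
  where
  factor : ∀ i j → (i ℤ.- j) ℤ.* (i ℤ.+ j) ≡ i ℤ.* i ℤ.- j ℤ.* j
  factor = ℤ-Solver.solve-∀
... | inj₁ i-j≡0 = inj₁ (ℤ.i-j≡0⇒i≡j i j i-j≡0)
... | inj₂ i+j≡0 = inj₂ (≡.trans (add-sub i j) (≡.trans (≡.cong (ℤ._- j) i+j≡0) (ℤ.+-identityˡ (ℤ.- j))))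
  where
  add-sub : ∀ i j → i ≡ i ℤ.+ j ℤ.- j
  add-sub = ℤ-Solver.solve-∀

i+i≡j+j⇒i≡j : ∀ i j → i ℤ.+ i ≡ j ℤ.+ j → i ≡ j
i+i≡j+j⇒i≡j i j eq = ℤ.*-cancelˡ-≡ (pos 2) i j (≡.trans (≡.sym (double i)) (≡.trans eq (double j)))
  where
  double : ∀ i → i ℤ.+ i ≡ pos 2 ℤ.* i
  double = ℤ-Solver.solve-∀

module PeriodEquations
  (e₀ e₁ e₂ k Q m : ℤ)
  (sum-eq : ℤ.1ℤ ℤ.+ (e₀ ℤ.+ (e₁ ℤ.+ (e₂ ℤ.+ (e₁ ℤ.+ ℤ.0ℤ)))) ≡ ℤ.0ℤ)
  (corr₀  : e₀ ℤ.* e₀ ℤ.+ (e₁ ℤ.* e₁ ℤ.+ (e₂ ℤ.* e₂ ℤ.+ (e₁ ℤ.* e₁ ℤ.+ ℤ.0ℤ))) ≡ ℤ.1ℤ ℤ.* (Q ℤ.* Q) ℤ.- m)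
  (corr₁  : e₀ ℤ.* e₁ ℤ.+ (e₁ ℤ.* e₂ ℤ.+ (e₂ ℤ.* e₁ ℤ.+ (e₁ ℤ.* e₀ ℤ.+ ℤ.0ℤ))) ≡ ℤ.0ℤ ℤ.* (Q ℤ.* Q) ℤ.- m)
  (corr₂  : e₀ ℤ.* e₂ ℤ.+ (e₁ ℤ.* e₁ ℤ.+ (e₂ ℤ.* e₀ ℤ.+ (e₁ ℤ.* e₁ ℤ.+ ℤ.0ℤ))) ≡ ℤ.0ℤ ℤ.* (Q ℤ.* Q) ℤ.- m)
  (e₀-odd : e₀ ≡ k ℤ.+ k ℤ.+ ℤ.1ℤ)
  where
  open ≡.≡-Reasoning

  private
    -- With e₃ = e₁ these are the Gauss sums Σ iʲ e_j and Σ (-1)ʲ e_j of a quartic and of the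
    -- quadratic character.
    D E : ℤ
    D = e₀ ℤ.- e₂
    E = e₀ ℤ.+ e₂ ℤ.- e₁ ℤ.- e₁

    D²≡Q² : D ℤ.* D ≡ Q ℤ.* Q
    D²≡Q² = ≡.trans (lhs e₀ e₁ e₂) (≡.trans (≡.cong₂ ℤ._-_ corr₀ corr₂) (rhs (Q ℤ.* Q) m))
      where
      lhs : ∀ a b c → (a ℤ.- c) ℤ.* (a ℤ.- c) ≡
        (a ℤ.* a ℤ.+ (b ℤ.* b ℤ.+ (c ℤ.* c ℤ.+ (b ℤ.* b ℤ.+ ℤ.0ℤ)))) ℤ.- (a ℤ.* c ℤ.+ (b ℤ.* b ℤ.+ (c ℤ.* a ℤ.+ (b ℤ.* b ℤ.+ ℤ.0ℤ))))
      lhs = ℤ-Solver.solve-∀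
      rhs : ∀ q m → (ℤ.1ℤ ℤ.* q ℤ.- m) ℤ.- (ℤ.0ℤ ℤ.* q ℤ.- m) ≡ q
      rhs = ℤ-Solver.solve-∀

    E²≡Q² : E ℤ.* E ≡ Q ℤ.* Q
    E²≡Q² = ≡.trans (lhs e₀ e₁ e₂) (≡.trans (≡.cong₂ ℤ._-_ (≡.cong₂ ℤ._+_ corr₀ corr₂) (≡.cong₂ ℤ._+_ corr₁ corr₁)) (rhs (Q ℤ.* Q) m))
      where
      lhs : ∀ a b c → (a ℤ.+ c ℤ.- b ℤ.- b) ℤ.* (a ℤ.+ c ℤ.- b ℤ.- b) ≡
        ((a ℤ.* a ℤ.+ (b ℤ.* b ℤ.+ (c ℤ.* c ℤ.+ (b ℤ.* b ℤ.+ ℤ.0ℤ)))) ℤ.+ (a ℤ.* c ℤ.+ (b ℤ.* b ℤ.+ (c ℤ.* a ℤ.+ (b ℤ.* b ℤ.+ ℤ.0ℤ)))))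
        ℤ.- ((a ℤ.* b ℤ.+ (b ℤ.* c ℤ.+ (c ℤ.* b ℤ.+ (b ℤ.* a ℤ.+ ℤ.0ℤ)))) ℤ.+ (a ℤ.* b ℤ.+ (b ℤ.* c ℤ.+ (c ℤ.* b ℤ.+ (b ℤ.* a ℤ.+ ℤ.0ℤ)))))
      lhs = ℤ-Solver.solve-∀
      rhs : ∀ q m → ((ℤ.1ℤ ℤ.* q ℤ.- m) ℤ.+ (ℤ.0ℤ ℤ.* q ℤ.- m)) ℤ.- ((ℤ.0ℤ ℤ.* q ℤ.- m) ℤ.+ (ℤ.0ℤ ℤ.* q ℤ.- m)) ≡ q
      rhs = ℤ-Solver.solve-∀

    -- 4e₀ is E + 2D plus the sum of the four periods, which is -1; and 4e₀ = 8k + 4.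
    8k≡E+2D-5 : pos 8 ℤ.* k ≡ E ℤ.+ D ℤ.+ D ℤ.- pos 5
    8k≡E+2D-5 = begin
      pos 8 ℤ.* k                                         ≡⟨ id₁ k ⟩
      pos 4 ℤ.* (k ℤ.+ k ℤ.+ ℤ.1ℤ) ℤ.- pos 4              ≡⟨ ≡.cong (λ x → pos 4 ℤ.* x ℤ.- pos 4) e₀-odd ⟨
      pos 4 ℤ.* e₀ ℤ.- pos 4                              ≡⟨ id₂ e₀ e₁ e₂ ⟩
      E ℤ.+ D ℤ.+ D ℤ.- pos 5 ℤ.+ (ℤ.1ℤ ℤ.+ (e₀ ℤ.+ (e₁ ℤ.+ (e₂ ℤ.+ (e₁ ℤ.+ ℤ.0ℤ)))))
                                                          ≡⟨ ≡.cong (λ x → E ℤ.+ D ℤ.+ D ℤ.- pos 5 ℤ.+ x) sum-eq ⟩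
      E ℤ.+ D ℤ.+ D ℤ.- pos 5 ℤ.+ ℤ.0ℤ                    ≡⟨ ℤ.+-identityʳ _ ⟩
      E ℤ.+ D ℤ.+ D ℤ.- pos 5                             ∎
      where
      id₁ : ∀ k → pos 8 ℤ.* k ≡ pos 4 ℤ.* (k ℤ.+ k ℤ.+ ℤ.1ℤ) ℤ.- pos 4
      id₁ = ℤ-Solver.solve-∀
      id₂ : ∀ a b c → pos 4 ℤ.* a ℤ.- pos 4 ≡
        (a ℤ.+ c ℤ.- b ℤ.- b) ℤ.+ (a ℤ.- c) ℤ.+ (a ℤ.- c) ℤ.- pos 5 ℤ.+ (ℤ.1ℤ ℤ.+ (a ℤ.+ (b ℤ.+ (c ℤ.+ (b ℤ.+ ℤ.0ℤ)))))
      id₂ = ℤ-Solver.solve-∀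

    8k≡ : ∀ D′ E′ → D ≡ D′ → E ≡ E′ → pos 8 ℤ.* k ≡ E′ ℤ.+ D′ ℤ.+ D′ ℤ.- pos 5
    8k≡ D′ E′ ≡.refl ≡.refl = 8k≡E+2D-5

    8k≡c-8a⇒8∣c : ∀ a c → pos 8 ℤ.* k ≡ c ℤ.- pos 8 ℤ.* a → 8 ∣ ℤ.∣ c ∣
    8k≡c-8a⇒8∣c a c eq = divides ℤ.∣ k ℤ.+ a ∣ (≡.trans (≡.cong ℤ.∣_∣ c≡8[k+a])
      (≡.trans (ℤ.abs-* (pos 8) (k ℤ.+ a)) (ℕ.*-comm 8 ℤ.∣ k ℤ.+ a ∣)))
      where
      add-sub : ∀ x y → x ≡ x ℤ.- y ℤ.+ y
      add-sub = ℤ-Solver.solve-∀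
      c≡8[k+a] : c ≡ pos 8 ℤ.* (k ℤ.+ a)
      c≡8[k+a] = ≡.trans (add-sub c (pos 8 ℤ.* a)) (≡.trans (≡.cong (λ x → x ℤ.+ pos 8 ℤ.* a) (≡.sym eq))
        (≡.sym (ℤ.*-distribˡ-+ (pos 8) k a)))

    -- Since 8 k = E + 2 D − 5 with D, E ∈ {Q, −Q}, the residue of Q modulo 8
    -- determines the sign of D.
    D≡Q : ∀ a → Q ≡ pos 8 ℤ.* a ℤ.+ pos 7 → D ≡ Q
    D≡Q a Q≡ = signs (i²≡j²⇒i≡±j D Q D²≡Q²) (i²≡j²⇒i≡±j E Q E²≡Q²)
      where
      arith₁ : ∀ a → (pos 8 ℤ.* a ℤ.+ pos 7) ℤ.+ ℤ.- (pos 8 ℤ.* a ℤ.+ pos 7) ℤ.+ ℤ.- (pos 8 ℤ.* a ℤ.+ pos 7) ℤ.- pos 5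
                 ≡ ℤ.- pos 12 ℤ.- pos 8 ℤ.* a
      arith₁ = ℤ-Solver.solve-∀
      arith₂ : ∀ a → ℤ.- (pos 8 ℤ.* a ℤ.+ pos 7) ℤ.+ ℤ.- (pos 8 ℤ.* a ℤ.+ pos 7) ℤ.+ ℤ.- (pos 8 ℤ.* a ℤ.+ pos 7) ℤ.- pos 5
                 ≡ ℤ.- pos 26 ℤ.- pos 8 ℤ.* (pos 3 ℤ.* a)
      arith₂ = ℤ-Solver.solve-∀
      -- D = -Q would make 8k equal to -Q - 5 or -3Q - 5, which are -12 and -26 modulo 8 for Q ≡ 7.
      signs : D ≡ Q ⊎ D ≡ ℤ.- Q → E ≡ Q ⊎ E ≡ ℤ.- Q → D ≡ Q
      signs (inj₁ D≡Q)  _           = D≡Q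
      signs (inj₂ D≡-Q) (inj₁ E≡Q)  = contradiction
        (8k≡c-8a⇒8∣c a (ℤ.- pos 12) (≡.trans (8k≡ (ℤ.- Q) Q D≡-Q E≡Q)
          (≡.trans (≡.cong (λ Q → Q ℤ.+ ℤ.- Q ℤ.+ ℤ.- Q ℤ.- pos 5) Q≡) (arith₁ a))))
        (from-no (8 ∣? 12))
      signs (inj₂ D≡-Q) (inj₂ E≡-Q) = contradiction
        (8k≡c-8a⇒8∣c (pos 3 ℤ.* a) (ℤ.- pos 26) (≡.trans (8k≡ (ℤ.- Q) (ℤ.- Q) D≡-Q E≡-Q)
          (≡.trans (≡.cong (λ Q → ℤ.- Q ℤ.+ ℤ.- Q ℤ.+ ℤ.- Q ℤ.- pos 5) Q≡) (arith₂ a))))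
        (from-no (8 ∣? 26))

    -- For D = Q the number E + 2D - 5 is 3Q - 5 or Q - 5, congruent to 3c - 5 or c - 5 modulo 8.
    -- The remainder c is left open because c = 3 and c = 1 lead to the same sign.
    D≡-Q : ∀ a c → Q ≡ pos 8 ℤ.* a ℤ.+ c → ¬ (8 ∣ ℤ.∣ pos 3 ℤ.* c ℤ.- pos 5 ∣) → ¬ (8 ∣ ℤ.∣ c ℤ.- pos 5 ∣) → D ≡ ℤ.- Q
    D≡-Q a c Q≡ ¬₁ ¬₂ = signs (i²≡j²⇒i≡±j D Q D²≡Q²) (i²≡j²⇒i≡±j E Q E²≡Q²)
      where
      arith₁ : ∀ a c → (pos 8 ℤ.* a ℤ.+ c) ℤ.+ (pos 8 ℤ.* a ℤ.+ c) ℤ.+ (pos 8 ℤ.* a ℤ.+ c) ℤ.- pos 5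
                 ≡ (pos 3 ℤ.* c ℤ.- pos 5) ℤ.- pos 8 ℤ.* (ℤ.- (pos 3 ℤ.* a))
      arith₁ = ℤ-Solver.solve-∀
      arith₂ : ∀ a c → ℤ.- (pos 8 ℤ.* a ℤ.+ c) ℤ.+ (pos 8 ℤ.* a ℤ.+ c) ℤ.+ (pos 8 ℤ.* a ℤ.+ c) ℤ.- pos 5
                 ≡ (c ℤ.- pos 5) ℤ.- pos 8 ℤ.* (ℤ.- a)
      arith₂ = ℤ-Solver.solve-∀
      signs : D ≡ Q ⊎ D ≡ ℤ.- Q → E ≡ Q ⊎ E ≡ ℤ.- Q → D ≡ ℤ.- Q
      signs (inj₂ D≡-Q) _           = D≡-Q
      signs (inj₁ D≡Q)  (inj₁ E≡Q)  = contradiction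
        (8k≡c-8a⇒8∣c (ℤ.- (pos 3 ℤ.* a)) (pos 3 ℤ.* c ℤ.- pos 5) (≡.trans (8k≡ Q Q D≡Q E≡Q)
          (≡.trans (≡.cong (λ Q → Q ℤ.+ Q ℤ.+ Q ℤ.- pos 5) Q≡) (arith₁ a c)))) ¬₁
      signs (inj₁ D≡Q)  (inj₂ E≡-Q) = contradiction
        (8k≡c-8a⇒8∣c (ℤ.- a) (c ℤ.- pos 5) (≡.trans (8k≡ Q (ℤ.- Q) D≡Q E≡-Q)
          (≡.trans (≡.cong (λ Q → ℤ.- Q ℤ.+ Q ℤ.+ Q ℤ.- pos 5) Q≡) (arith₂ a c)))) ¬₂

  module _ (H : ℤ) (1+Q≡2H : ℤ.1ℤ ℤ.+ Q ≡ H ℤ.+ H) where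
    -- The sum -1 of all periods minus D is twice e₁ + e₂, and plus D it is twice e₀ + e₁. So the
    -- sign of D decides which of the two equals -H: this is the origin of the two cases in the
    -- definition of B.
    e₁+e₂≡-H : ∀ a → Q ≡ pos 8 ℤ.* a ℤ.+ pos 7 → e₁ ℤ.+ e₂ ≡ ℤ.- H
    e₁+e₂≡-H a Q≡ = i+i≡j+j⇒i≡j _ _ (begin
      e₁ ℤ.+ e₂ ℤ.+ (e₁ ℤ.+ e₂)
        ≡⟨ lhs e₀ e₁ e₂ ⟩
      (ℤ.1ℤ ℤ.+ (e₀ ℤ.+ (e₁ ℤ.+ (e₂ ℤ.+ (e₁ ℤ.+ ℤ.0ℤ))))) ℤ.- (ℤ.1ℤ ℤ.+ D)
        ≡⟨ ≡.cong₂ (λ x y → x ℤ.- (ℤ.1ℤ ℤ.+ y)) sum-eq (D≡Q a Q≡) ⟩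
      ℤ.0ℤ ℤ.- (ℤ.1ℤ ℤ.+ Q)
        ≡⟨ ≡.cong (λ x → ℤ.0ℤ ℤ.- x) 1+Q≡2H ⟩
      ℤ.0ℤ ℤ.- (H ℤ.+ H)
        ≡⟨ rhs H ⟩
      ℤ.- H ℤ.+ ℤ.- H ∎)
      where
      lhs : ∀ a b c → b ℤ.+ c ℤ.+ (b ℤ.+ c) ≡ (ℤ.1ℤ ℤ.+ (a ℤ.+ (b ℤ.+ (c ℤ.+ (b ℤ.+ ℤ.0ℤ))))) ℤ.- (ℤ.1ℤ ℤ.+ (a ℤ.- c))
      lhs = ℤ-Solver.solve-∀
      rhs : ∀ H → ℤ.0ℤ ℤ.- (H ℤ.+ H) ≡ ℤ.- H ℤ.+ ℤ.- H
      rhs = ℤ-Solver.solve-∀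

    e₀+e₁≡-H : ∀ a → Q ≡ pos 8 ℤ.* a ℤ.+ pos 3 ⊎ Q ≡ pos 8 ℤ.* a ℤ.+ pos 1 → e₀ ℤ.+ e₁ ≡ ℤ.- H
    e₀+e₁≡-H a Q≡ = i+i≡j+j⇒i≡j _ _ (begin
      e₀ ℤ.+ e₁ ℤ.+ (e₀ ℤ.+ e₁)
        ≡⟨ lhs e₀ e₁ e₂ ⟩
      (ℤ.1ℤ ℤ.+ (e₀ ℤ.+ (e₁ ℤ.+ (e₂ ℤ.+ (e₁ ℤ.+ ℤ.0ℤ))))) ℤ.- (ℤ.1ℤ ℤ.- D)
        ≡⟨ ≡.cong₂ (λ x y → x ℤ.- (ℤ.1ℤ ℤ.- y)) sum-eq (negative Q≡) ⟩
      ℤ.0ℤ ℤ.- (ℤ.1ℤ ℤ.- ℤ.- Q)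
        ≡⟨ ≡.cong (λ x → ℤ.0ℤ ℤ.- (ℤ.1ℤ ℤ.+ x)) (ℤ.neg-involutive Q) ⟩
      ℤ.0ℤ ℤ.- (ℤ.1ℤ ℤ.+ Q)
        ≡⟨ ≡.cong (λ x → ℤ.0ℤ ℤ.- x) 1+Q≡2H ⟩
      ℤ.0ℤ ℤ.- (H ℤ.+ H)
        ≡⟨ rhs H ⟩
      ℤ.- H ℤ.+ ℤ.- H ∎)
      where
      negative : Q ≡ pos 8 ℤ.* a ℤ.+ pos 3 ⊎ Q ≡ pos 8 ℤ.* a ℤ.+ pos 1 → D ≡ ℤ.- Q
      negative (inj₁ Q≡) = D≡-Q a (pos 3) Q≡ (from-no (8 ∣? 4)) (from-no (8 ∣? 2))
      negative (inj₂ Q≡) = D≡-Q a (pos 1) Q≡ (from-no (8 ∣? 2)) (from-no (8 ∣? 4))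
      lhs : ∀ a b c → a ℤ.+ b ℤ.+ (a ℤ.+ b) ≡ (ℤ.1ℤ ℤ.+ (a ℤ.+ (b ℤ.+ (c ℤ.+ (b ℤ.+ ℤ.0ℤ))))) ℤ.- (ℤ.1ℤ ℤ.- (a ℤ.- c))
      lhs = ℤ-Solver.solve-∀
      rhs : ∀ H → ℤ.0ℤ ℤ.- (H ℤ.+ H) ≡ ℤ.- H ℤ.+ ℤ.- H
      rhs = ℤ-Solver.solve-∀

-- Powers of p modulo 8 and the factorisation of q - 1

[1+x]^k≡1+x*G : ∀ x k → ∃[ G ] suc x ℕ.^ k ≡ suc (x ℕ.* G)
[1+x]^k≡1+x*G x zero    = 0 , ≡.cong suc (≡.sym (ℕ.*-zeroʳ x))
[1+x]^k≡1+x*G x (suc k) with G , eq ← [1+x]^k≡1+x*G x k =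
  suc (G ℕ.+ x ℕ.* G) , ≡.trans (≡.cong (suc x ℕ.*_) eq) (expand x G)
  where
  expand : ∀ x G → suc x ℕ.* suc (x ℕ.* G) ≡ suc (x ℕ.* suc (G ℕ.+ x ℕ.* G))
  expand = solve-∀

module PowersOf (p : ℕ) (p%4≡3 : p % 4 ≡ 3) where
  private
    a : ℕ
    a = p / 4

    p≡3+4a : p ≡ 3 ℕ.+ a ℕ.* 4
    p≡3+4a = ≡.trans (m≡m%n+[m/n]*n p 4) (≡.cong (ℕ._+ a ℕ.* 4) p%4≡3)

    -- Chosen so that p² - 1 = (2 + 4a)(4 + 4a) = 8t.
    t : ℕ
    t = suc (a ℕ.+ a) ℕ.* suc a

  2<p : 2 ℕ.< p
  2<p = ≡.subst (2 ℕ.<_) (≡.sym p≡3+4a) (ℕ.s≤s (ℕ.s≤s (ℕ.s≤s ℕ.z≤n)))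

  p^2≡1+8t : p ℕ.^ 2 ≡ suc (8 ℕ.* t)
  p^2≡1+8t = ≡.trans (≡.cong (ℕ._^ 2) p≡3+4a) (expand a)
    where
    expand : ∀ a → (3 ℕ.+ a ℕ.* 4) ℕ.* ((3 ℕ.+ a ℕ.* 4) ℕ.* 1) ≡ suc (8 ℕ.* (suc (a ℕ.+ a) ℕ.* suc a))
    expand = solve-∀

  p^[2b]≡1+8tG : ∀ b → ∃[ G ] p ℕ.^ (2 ℕ.* b) ≡ suc (8 ℕ.* t ℕ.* G)
  p^[2b]≡1+8tG b = proj₁ power ,
    ≡.trans (≡.sym (ℕ.^-*-assoc p 2 b)) (≡.trans (≡.cong (ℕ._^ b) p^2≡1+8t) (proj₂ power))
    where power = [1+x]^k≡1+x*G (8 ℕ.* t) b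

  record Exponents (s : ℕ) : Set where
    field
      h m W     : ℕ
      q≡1+4m    : p ℕ.^ (2 ℕ.* s) ≡ suc (m ℕ.* 4)
      m≡h+h     : m ≡ h ℕ.+ h
      4m≡W*p⁻   : m ℕ.* 4 ≡ W ℕ.* ℕ.pred p
      4∣W       : 4 ∣ W

  exponents : ∀ s → Exponents s
  exponents s = record
    { h       = h
    ; m       = h ℕ.+ h
    -- This is (q - 1)/(p - 1), a multiple of (p² - 1)/(p - 1) = p + 1 = 4 (a + 1).
    ; W       = suc a ℕ.* G ℕ.* 4
    ; q≡1+4m  = ≡.trans eq (≡.cong suc (arith a G))
    ; m≡h+h   = ≡.refl
    ; 4m≡W*p⁻ = ≡.trans (arith′ a G) (≡.cong (λ p → suc a ℕ.* G ℕ.* 4 ℕ.* ℕ.pred p) (≡.sym p≡3+4a))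
    ; 4∣W     = n∣m*n (suc a ℕ.* G)
    }
    where
    G = proj₁ (p^[2b]≡1+8tG s)
    eq = proj₂ (p^[2b]≡1+8tG s)
    h = suc (a ℕ.+ a) ℕ.* suc a ℕ.* G
    arith : ∀ a G → 8 ℕ.* (suc (a ℕ.+ a) ℕ.* suc a) ℕ.* G ≡
      (suc (a ℕ.+ a) ℕ.* suc a ℕ.* G ℕ.+ suc (a ℕ.+ a) ℕ.* suc a ℕ.* G) ℕ.* 4
    arith = solve-∀
    arith′ : ∀ a G → (suc (a ℕ.+ a) ℕ.* suc a ℕ.* G ℕ.+ suc (a ℕ.+ a) ℕ.* suc a ℕ.* G) ℕ.* 4
      ≡ suc a ℕ.* G ℕ.* 4 ℕ.* (2 ℕ.+ a ℕ.* 4)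
    arith′ = solve-∀

  p^k≡1+2f : ∀ k → ∃[ f ] p ℕ.^ k ≡ suc (f ℕ.+ f)
  p^k≡1+2f k = suc (a ℕ.+ a) ℕ.* proj₁ power ,
    ≡.trans (≡.cong (ℕ._^ k) p≡3+4a) (≡.trans (proj₂ power) (≡.cong suc (arith a (proj₁ power))))
    where
    power = [1+x]^k≡1+x*G (2 ℕ.+ a ℕ.* 4) k
    arith : ∀ a G → (2 ℕ.+ a ℕ.* 4) ℕ.* G ≡ suc (a ℕ.+ a) ℕ.* G ℕ.+ suc (a ℕ.+ a) ℕ.* G
    arith = solve-∀

  s%2≡0⇒p^s%8≡1 : ∀ s → s % 2 ≡ 0 → (p ℕ.^ s) % 8 ≡ 1
  s%2≡0⇒p^s%8≡1 s s%2≡0 = ≡.trans (≡.cong (_% 8) (≡.trans (≡.cong (p ℕ.^_) s≡) (≡.trans eq (≡.cong suc (arith t G)))))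
    ([m+kn]%n≡m%n 1 (t ℕ.* G) 8)
    where
    s≡ : s ≡ 2 ℕ.* (s / 2)
    s≡ = ≡.trans (m≡m%n+[m/n]*n s 2) (≡.trans (≡.cong (ℕ._+ s / 2 ℕ.* 2) s%2≡0) (ℕ.*-comm (s / 2) 2))
    G = proj₁ (p^[2b]≡1+8tG (s / 2))
    eq = proj₂ (p^[2b]≡1+8tG (s / 2))
    arith : ∀ x G → 8 ℕ.* x ℕ.* G ≡ x ℕ.* G ℕ.* 8
    arith = solve-∀

  s%2≡1⇒p^s≡p+8x : ∀ s → s % 2 ≡ 1 → ∃[ x ] p ℕ.^ s ≡ p ℕ.+ x ℕ.* 8
  s%2≡1⇒p^s≡p+8x s s%2≡1 = p ℕ.* (t ℕ.* G) ,
    ≡.trans (≡.cong (p ℕ.^_) s≡) (≡.trans (≡.cong (p ℕ.*_) eq) (arith p t G))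
    where
    s≡ : s ≡ suc (2 ℕ.* (s / 2))
    s≡ = ≡.trans (m≡m%n+[m/n]*n s 2) (≡.trans (≡.cong (ℕ._+ s / 2 ℕ.* 2) s%2≡1) (≡.cong suc (ℕ.*-comm (s / 2) 2)))
    G = proj₁ (p^[2b]≡1+8tG (s / 2))
    eq = proj₂ (p^[2b]≡1+8tG (s / 2))
    arith : ∀ p x G → p ℕ.* suc (8 ℕ.* x ℕ.* G) ≡ p ℕ.+ p ℕ.* (x ℕ.* G) ℕ.* 8
    arith = solve-∀

  s%2≡1⇒p^s%8≡p%8 : ∀ s → s % 2 ≡ 1 → (p ℕ.^ s) % 8 ≡ p % 8
  s%2≡1⇒p^s%8≡p%8 s s%2≡1 = ≡.trans (≡.cong (_% 8) (proj₂ form)) ([m+kn]%n≡m%n p (proj₁ form) 8)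
    where form = s%2≡1⇒p^s≡p+8x s s%2≡1

  p%8≡3⊎7 : p % 8 ≡ 3 ⊎ p % 8 ≡ 7
  p%8≡3⊎7 with a % 2 in parity | m%n<n a 2
  ... | 0 | _ = inj₁ (≡.trans (≡.cong (_% 8) (≡.trans p≡3+4a (≡.trans (≡.cong (λ a → 3 ℕ.+ a ℕ.* 4) (≡.trans (m≡m%n+[m/n]*n a 2) (≡.cong (ℕ._+ a / 2 ℕ.* 2) parity))) (arith (a / 2)))))
                  ([m+kn]%n≡m%n 3 (a / 2) 8))
    where
    arith : ∀ b → 3 ℕ.+ (0 ℕ.+ b ℕ.* 2) ℕ.* 4 ≡ 3 ℕ.+ b ℕ.* 8
    arith = solve-∀
  ... | 1 | _ = inj₂ (≡.trans (≡.cong (_% 8) (≡.trans p≡3+4a (≡.trans (≡.cong (λ a → 3 ℕ.+ a ℕ.* 4) (≡.trans (m≡m%n+[m/n]*n a 2) (≡.cong (ℕ._+ a / 2 ℕ.* 2) parity))) (arith (a / 2)))))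
                  ([m+kn]%n≡m%n 7 (a / 2) 8))
    where
    arith : ∀ b → 3 ℕ.+ (1 ℕ.+ b ℕ.* 2) ℕ.* 4 ≡ 7 ℕ.+ b ℕ.* 8
    arith = solve-∀
  ... | suc (suc _) | ℕ.s≤s (ℕ.s≤s ())

  s%2≡1⇒4∣1+p^s : ∀ s → s % 2 ≡ 1 → 4 ∣ suc (p ℕ.^ s)
  s%2≡1⇒4∣1+p^s s s%2≡1 =
    divides (suc a ℕ.+ x ℕ.* 2) (≡.trans (≡.cong suc (≡.trans (proj₂ form) (≡.cong (ℕ._+ x ℕ.* 8) p≡3+4a))) (arith a x))
    where
    form = s%2≡1⇒p^s≡p+8x s s%2≡1
    x = proj₁ form
    arith : ∀ a x → suc (3 ℕ.+ a ℕ.* 4 ℕ.+ x ℕ.* 8) ≡ (suc a ℕ.+ x ℕ.* 2) ℕ.* 4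
    arith = solve-∀

%2-cases : ∀ s → s % 2 ≡ 0 ⊎ s % 2 ≡ 1
%2-cases s with s % 2 | m%n<n s 2
... | 0 | _ = inj₁ ≡.refl
... | 1 | _ = inj₂ ≡.refl
... | suc (suc _) | ℕ.s≤s (ℕ.s≤s ())

-- Cliques of the Peisert graph: the bound and the case of equality

module PeisertClique {c ℓ : Level} (p s : ℕ) (p-prime : Prime p) (p%4≡3 : p % 4 ≡ 3) (1≤s : 1 ℕ.≤ s)
                     (F : FiniteField c ℓ (p ℕ.^ (2 ℕ.* s)))
                     (g : FiniteField.Carrier F) (primitive-root : IsPrimitiveRoot F g) where
  private
    module F = FiniteField F
    open PowersOf p p%4≡3
    open Exponents (exponents s)

    N Q : ℕ
    N = 2 ℕ.* s
    Q = p ℕ.^ s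

    1≤N : 1 ℕ.≤ N
    1≤N = ℕ.≤-trans 1≤s (ℕ.m≤m+n s (s ℕ.+ 0))

    module T = TraceOneParity p N p-prime 1≤N 2<p F g primitive-root m q≡1+4m W 4m≡W*p⁻

    f : ℕ
    f = proj₁ (p^k≡1+2f s)

    Q≡1+2f : Q ≡ suc (f ℕ.+ f)
    Q≡1+2f = proj₂ (p^k≡1+2f s)

    q≡Q*Q : p ℕ.^ N ≡ Q ℕ.* Q
    q≡Q*Q = ≡.trans (≡.cong (λ k → p ℕ.^ (s ℕ.+ k)) (ℕ.+-identityʳ s)) (ℕ.^-distribˡ-+-* p s s)

    m≡f*[1+f] : m ≡ f ℕ.* suc f
    m≡f*[1+f] = ℕ.*-cancelʳ-≡ m (f ℕ.* suc f) 4 (ℕ.suc-injective (≡.trans (≡.sym q≡1+4m)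
      (≡.trans q≡Q*Q (≡.trans (≡.cong₂ ℕ._*_ Q≡1+2f Q≡1+2f) (square f)))))
      where
      square : ∀ f → suc (f ℕ.+ f) ℕ.* suc (f ℕ.+ f) ≡ suc (f ℕ.* suc f ℕ.* 4)
      square = solve-∀

  -- Adjacency provides only some exponent of a difference. Its residue modulo 4 can be read off the
  -- m-th power of the element.
  g^-class : ∀ a b → g F.^ a F.≈ g F.^ b → a % 4 ≡ b % 4
  g^-class a b eq = T.g^[j*m]-injective (a % 4) (b % 4) (m%n<n a 4) (m%n<n b 4)
    (F.trans (F.sym (mth-power a)) (F.trans (T.^-congˡ m eq) (mth-power b)))
    where
    mth-power : ∀ a → (g F.^ a) F.^ m F.≈ g F.^ ((a % 4) ℕ.* m)
    mth-power a = F.trans (T.^-congˡ m (T.^-congʳ g (≡.trans (m≡m%n+[m/n]*n a 4) (ℕ.+-comm (a % 4) (a / 4 ℕ.* 4)))))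
      (T.g^[4i+j]^m≈g^[j*m] (a / 4) (a % 4))

  -- The non-zero elements of the subfield are powers of g ^ W′, itself a fourth power when 4
  -- divides W′.
  fixed⇒fourth-power : ∀ d e W′ → p ℕ.^ d ≡ suc e → m ℕ.* 4 ≡ W′ ℕ.* e → 4 ∣ W′ →
                       ∀ x → ¬ (x F.≈ F.0#) → T.Frob d x F.≈ x → x F.^ m F.≈ F.1#
  fixed⇒fourth-power d e W′ p^d≡1+e 4m≡W′*e 4∣W′ x x≉0 fixed =
    F.trans (T.^-congˡ m (T.g^log x x≉0)) (T.4∣k⇒g^k^m≈1 k (∣-trans 4∣W′
      (T.fixed⇒∣log d e W′ {{e-nonZero}} p^d≡1+e 4m≡W′*e k
        (F.trans (T.Frob-cong d (F.sym (T.g^log x x≉0))) (F.trans fixed (T.g^log x x≉0))))))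
    where
    k = T.log x x≉0
    e-nonZero : ℕ.NonZero e
    e-nonZero = ℕ.m*n≢0⇒n≢0 W′ {{≡.subst ℕ.NonZero 4m≡W′*e T.n-nonZero}}

  trace-one-odd : ∃[ k ] T.SumOver.∑F ℕ.+-*-commutativeSemiring T.u ≡ k ℕ.+ k ℕ.+ 1
  trace-one-odd = by-parity (%2-cases s)
    where
    open T.SumOver ℕ.+-*-commutativeSemiring
    s≤N : s ℕ.≤ N
    s≤N = ℕ.m≤m+n s (s ℕ.+ 0)
    N≡s+s : N ≡ s ℕ.+ s
    N≡s+s = ≡.cong (s ℕ.+_) (ℕ.+-identityʳ s)
    point-s : ∃[ x ] (T.Frob s x F.≈ x × ¬ (T.tr x F.≈ F.0#))
    point-s = T.fixed-point-halve s (≡.subst (λ d → ∃[ x ] (T.Frob d x F.≈ x × ¬ (T.tr x F.≈ F.0#))) N≡s+s T.fixed-point-N)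
    halve-N : ∃[ k ] ∑F T.u ≡ k ℕ.+ k ℕ.+ ∑F (T.fixed-u s)
    halve-N = proj₁ (T.fixed-u-halve s s≤N) ,
      ≡.trans T.∑F-fixed-u-N (≡.trans (≡.cong (λ d → ∑F (T.fixed-u d)) N≡s+s) (proj₂ (T.fixed-u-halve s s≤N)))
    combine : ∀ {a b c} → ∃[ k ] a ≡ k ℕ.+ k ℕ.+ b → ∃[ k ] b ≡ k ℕ.+ k ℕ.+ c → ∃[ k ] a ≡ k ℕ.+ k ℕ.+ c
    combine {c = c} (k , a≡) (l , b≡) = k ℕ.+ l , ≡.trans a≡ (≡.trans (≡.cong (k ℕ.+ k ℕ.+_) b≡) (arith k l c))
      where
      arith : ∀ k l c → k ℕ.+ k ℕ.+ (l ℕ.+ l ℕ.+ c) ≡ k ℕ.+ l ℕ.+ (k ℕ.+ l) ℕ.+ c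
      arith = solve-∀
    by-parity : s % 2 ≡ 0 ⊎ s % 2 ≡ 1 → ∃[ k ] ∑F T.u ≡ k ℕ.+ k ℕ.+ 1
    by-parity (inj₂ s%2≡1) = combine halve-N (T.fixed-u-odd s point-s
      (fixed⇒fourth-power s (f ℕ.+ f) (suc Q) Q≡1+2f 4m≡ (s%2≡1⇒4∣1+p^s s s%2≡1)))
      where
      arith : ∀ f → f ℕ.* suc f ℕ.* 4 ≡ suc (suc (f ℕ.+ f)) ℕ.* (f ℕ.+ f)
      arith = solve-∀
      4m≡ : m ℕ.* 4 ≡ suc Q ℕ.* (f ℕ.+ f)
      4m≡ = ≡.trans (≡.cong (ℕ._* 4) m≡f*[1+f]) (≡.trans (arith f) (≡.cong (λ k → suc k ℕ.* (f ℕ.+ f)) (≡.sym Q≡1+2f)))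
    -- With pᵈ = 1 + 2e the quotient (q - 1)/(pᵈ - 1) is (pᵈ + 1)(p²ᵈ + 1). Both factors are even,
    -- and their halves are the two factors in front of the 4.
    by-parity (inj₁ s%2≡0) = combine halve-N (combine halve-s (T.fixed-u-odd d point-d
      (fixed⇒fourth-power d (e ℕ.+ e) ((suc e ℕ.* suc ((e ℕ.+ e) ℕ.* suc e)) ℕ.* 4) p^d≡1+2e 4m≡ (n∣m*n (suc e ℕ.* suc ((e ℕ.+ e) ℕ.* suc e))))))
      where
      d = s / 2
      e = proj₁ (p^k≡1+2f d)
      p^d≡1+2e = proj₂ (p^k≡1+2f d)
      s≡d+d : s ≡ d ℕ.+ d
      s≡d+d = ≡.trans (m≡m%n+[m/n]*n s 2) (≡.trans (≡.cong (ℕ._+ d ℕ.* 2) s%2≡0) (double d))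
        where
        double : ∀ d → 0 ℕ.+ d ℕ.* 2 ≡ d ℕ.+ d
        double = solve-∀
      d≤N : d ℕ.≤ N
      d≤N = ℕ.≤-trans (≡.subst (d ℕ.≤_) (≡.sym s≡d+d) (ℕ.m≤m+n d d)) s≤N
      point-d : ∃[ x ] (T.Frob d x F.≈ x × ¬ (T.tr x F.≈ F.0#))
      point-d = T.fixed-point-halve d (≡.subst (λ d → ∃[ x ] (T.Frob d x F.≈ x × ¬ (T.tr x F.≈ F.0#))) s≡d+d point-s)
      halve-s : ∃[ k ] ∑F (T.fixed-u s) ≡ k ℕ.+ k ℕ.+ ∑F (T.fixed-u d)
      halve-s = proj₁ (T.fixed-u-halve d d≤N) ,
        ≡.trans (≡.cong (λ d → ∑F (T.fixed-u d)) s≡d+d) (proj₂ (T.fixed-u-halve d d≤N))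
      Q≡ : Q ≡ suc (e ℕ.+ e) ℕ.* suc (e ℕ.+ e)
      Q≡ = ≡.trans (≡.cong (p ℕ.^_) s≡d+d) (≡.trans (ℕ.^-distribˡ-+-* p d d) (≡.cong₂ ℕ._*_ p^d≡1+2e p^d≡1+2e))
      arith : ∀ e → suc (e ℕ.+ e) ℕ.* suc (e ℕ.+ e) ℕ.* (suc (e ℕ.+ e) ℕ.* suc (e ℕ.+ e))
        ≡ suc ((suc e ℕ.* suc ((e ℕ.+ e) ℕ.* suc e)) ℕ.* 4 ℕ.* (e ℕ.+ e))
      arith = solve-∀
      4m≡ : m ℕ.* 4 ≡ (suc e ℕ.* suc ((e ℕ.+ e) ℕ.* suc e)) ℕ.* 4 ℕ.* (e ℕ.+ e)
      4m≡ = ℕ.suc-injective (≡.trans (≡.sym q≡1+4m) (≡.trans q≡Q*Q (≡.trans (≡.cong₂ ℕ._*_ Q≡ Q≡) (arith e))))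

  module _ {M : ℕ} (α : Fin M → F.Carrier)
           (α-differences : ∀ i j → i ≢ j → ∃[ l ] ((l % 4 ≡ 0 ⊎ l % 4 ≡ 1) × α i F.- α j F.≈ g F.^ l))
           (α-injective : ∀ i j → α i F.≈ α j → i ≡ j) where

    clique-bound : M ℕ.≤ Q
    clique-bound = ℕ.≮⇒≥ (λ Q<M → ℕ.<⇒≱ (ℕ.*-mono-< Q<M Q<M)
      (≡.subst (M ℕ.* M ℕ.≤_) q≡Q*Q (Fin.injective⇒≤ {f = embedding} embedding-injective)))
      where
      open T.Solver using (solve; _:+_; _:*_; _:-_; _:=_)
      value : Fin M → Fin M → F.Carrier
      value i j = α i F.+ g F.^ 2 F.* α j
      embedding : Fin (M ℕ.* M) → Fin (p ℕ.^ N)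
      embedding k = T.to (value (proj₁ (Fin.remQuot {M} M k)) (proj₂ (Fin.remQuot {M} M k)))
      first : ∀ i j i′ j′ → value i j F.≈ value i′ j′ → i ≡ i′
      first i j i′ j′ eq = decide (i Fin.≟ i′) (j′ Fin.≟ j)
        where
        difference : α i F.- α i′ F.≈ g F.^ 2 F.* (α j′ F.- α j)
        difference = F.trans (solve 4 (λ a b c x → a :- b := (a :+ x :* c) :- (b :+ x :* c)) F.refl (α i) (α i′) (α j) (g F.^ 2))
          (F.trans (F.+-congʳ eq) (solve 4 (λ b c d x → (b :+ x :* d) :- (b :+ x :* c) := x :* (d :- c)) F.refl (α i′) (α j) (α j′) (g F.^ 2)))
        classes-disjoint : ∀ l k → l % 4 ≡ 0 ⊎ l % 4 ≡ 1 → k % 4 ≡ 0 ⊎ k % 4 ≡ 1 → l % 4 ≢ (2 ℕ.+ k) % 4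
        classes-disjoint l k l∈ k∈ eq = clash l∈ k∈ (≡.trans eq (%-distribˡ-+ 2 k 4))
          where
          clash : l % 4 ≡ 0 ⊎ l % 4 ≡ 1 → k % 4 ≡ 0 ⊎ k % 4 ≡ 1 → l % 4 ≢ (2 ℕ.+ k % 4) % 4
          clash (inj₁ a) (inj₁ b) eq = contradiction (≡.trans (≡.sym a) (≡.trans eq (≡.cong (λ r → (2 ℕ.+ r) % 4) b))) λ ()
          clash (inj₁ a) (inj₂ b) eq = contradiction (≡.trans (≡.sym a) (≡.trans eq (≡.cong (λ r → (2 ℕ.+ r) % 4) b))) λ ()
          clash (inj₂ a) (inj₁ b) eq = contradiction (≡.trans (≡.sym a) (≡.trans eq (≡.cong (λ r → (2 ℕ.+ r) % 4) b))) λ ()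
          clash (inj₂ a) (inj₂ b) eq = contradiction (≡.trans (≡.sym a) (≡.trans eq (≡.cong (λ r → (2 ℕ.+ r) % 4) b))) λ ()
        decide : Dec (i ≡ i′) → Dec (j′ ≡ j) → i ≡ i′
        decide (yes i≡i′) _ = i≡i′
        decide (no i≢i′) (yes ≡.refl) = α-injective i i′ (F.trans (solve 2 (λ a b → a := a :- b :+ b) F.refl (α i) (α i′))
          (F.trans (F.+-congʳ (F.trans difference (F.trans (F.*-congˡ (F.-‿inverseʳ (α j))) (F.zeroʳ (g F.^ 2))))) (F.+-identityˡ _)))
        decide (no i≢i′) (no j′≢j) = contradiction
          (g^-class l (2 ℕ.+ k) (F.trans (F.sym (proj₂ (proj₂ δ))) (F.trans difference
            (F.trans (F.*-congˡ (proj₂ (proj₂ δ′))) (F.sym (T.^-homo-* g 2 k))))))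
          (classes-disjoint l k (proj₁ (proj₂ δ)) (proj₁ (proj₂ δ′)))
          where
          δ = α-differences i i′ i≢i′
          δ′ = α-differences j′ j j′≢j
          l = proj₁ δ
          k = proj₁ δ′
      second : ∀ i j j′ → value i j F.≈ value i j′ → j ≡ j′
      second i j j′ eq = α-injective j j′ (T.x≉0⇒*-cancelˡ (T.^-nonzero T.g≉0 2) (T.+-cancelˡ (α i) _ _ eq))
      value-injective : ∀ i j i′ j′ → value i j F.≈ value i′ j′ → Fin.combine i j ≡ Fin.combine i′ j′
      value-injective i j i′ j′ eq with ≡.refl ← first i j i′ j′ eq = ≡.cong (Fin.combine i) (second i j j′ eq)
      embedding-injective : ∀ {k k′} → embedding k ≡ embedding k′ → k ≡ k′
      embedding-injective {k} {k′} eq = ≡.trans (≡.sym (Fin.combine-remQuot {M} M k))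
        (≡.trans (value-injective _ _ _ _ (T.to-injective eq)) (Fin.combine-remQuot {M} M k′))

    module _ {c′ ℓ′ : Level} (K : Char0DomainWithRoot c′ ℓ′ p) where
      open Periods p N p-prime 1≤N 2<p F g primitive-root m q≡1+4m W 4m≡W*p⁻ K h m≡h+h 4∣W p%4≡3
      open Differences M α
      open Char0DomainWithRoot K using (_≈_; 0#; _+_; -_; sym; trans; reflexive; +-cong; +-comm)

      private
        H : ℕ
        H = suc f

        1+Q≡2H : ℤ.1ℤ ℤ.+ pos Q ≡ pos H ℤ.+ pos H
        1+Q≡2H = ≡.cong pos (≡.trans (≡.cong suc Q≡1+2f) (≡.cong suc (≡.sym (ℕ.+-suc f f))))

        2m+H≡QH : m ℕ.+ m ℕ.+ H ≡ Q ℕ.* H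
        2m+H≡QH = ≡.trans (≡.cong (λ m → m ℕ.+ m ℕ.+ H) m≡f*[1+f]) (≡.trans (arith f) (≡.cong (ℕ._* H) (≡.sym Q≡1+2f)))
          where
          arith : ∀ f → f ℕ.* suc f ℕ.+ f ℕ.* suc f ℕ.+ suc f ≡ suc (f ℕ.+ f) ℕ.* suc f
          arith = solve-∀

        a b : ℕ
        a = proj₁ count-class-0-0-even
        b = proj₁ trace-one-odd

        -- The number of elements of trace 0 in C₀ is 2a and that of trace 1 is 2b + 1.
        e₀-odd : e 0 ≡ (pos a ℤ.- pos b ℤ.- ℤ.1ℤ) ℤ.+ (pos a ℤ.- pos b ℤ.- ℤ.1ℤ) ℤ.+ ℤ.1ℤ
        e₀-odd = ≡.trans (≡.cong₂ (λ x y → pos x ℤ.- pos y) (proj₂ count-class-0-0-even) (≡.trans (≡.sym T.∑F-u) (proj₂ trace-one-odd)))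
          (arith (pos a) (pos b))
          where
          arith : ∀ a b → (a ℤ.+ a) ℤ.- (b ℤ.+ b ℤ.+ ℤ.1ℤ) ≡ (a ℤ.- b ℤ.- ℤ.1ℤ) ℤ.+ (a ℤ.- b ℤ.- ℤ.1ℤ) ℤ.+ ℤ.1ℤ
          arith = ℤ-Solver.solve-∀

        q≡ : pos (p ℕ.^ N) ≡ pos Q ℤ.* pos Q
        q≡ = ≡.trans (≡.cong pos q≡Q*Q) (ℤ.pos-* Q Q)

        -- The correlations at the shifts 0, 1 and 2 mention e 3, e 4 and e 5, which become e 1, e 0
        -- and e 1 by `e₁≡e₃` and 4-periodicity.
        module Values = PeriodEquations (e 0) (e 1) (e 2) (pos a ℤ.- pos b ℤ.- ℤ.1ℤ) (pos Q) (pos m)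
          (≡.trans (≡.cong (λ x → ℤ.1ℤ ℤ.+ (e 0 ℤ.+ (e 1 ℤ.+ (e 2 ℤ.+ (x ℤ.+ ℤ.0ℤ))))) e₁≡e₃) ∑e)
          (≡.trans (≡.cong (λ x → e 0 ℤ.* e 0 ℤ.+ (e 1 ℤ.* e 1 ℤ.+ (e 2 ℤ.* e 2 ℤ.+ (x ℤ.* x ℤ.+ ℤ.0ℤ)))) e₁≡e₃)
            (≡.trans (e-correlation 0 0 ℕ.z<s ℕ.z<s) (≡.cong (λ x → ℤ.1ℤ ℤ.* x ℤ.- pos m) q≡)))
          (≡.trans (≡.cong₂ (λ x y → e 0 ℤ.* e 1 ℤ.+ (e 1 ℤ.* e 2 ℤ.+ (e 2 ℤ.* x ℤ.+ (x ℤ.* y ℤ.+ ℤ.0ℤ)))) e₁≡e₃ (≡.sym (e-periodic 0)))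
            (≡.trans (e-correlation 0 1 ℕ.z<s (ℕ.s<s ℕ.z<s)) (≡.cong (λ x → ℤ.0ℤ ℤ.* x ℤ.- pos m) q≡)))
          (≡.trans (≡.cong₂ (λ x y → e 0 ℤ.* e 2 ℤ.+ (e 1 ℤ.* x ℤ.+ (e 2 ℤ.* y ℤ.+ (x ℤ.* e 1 ℤ.+ ℤ.0ℤ)))) e₁≡e₃ (≡.sym (e-periodic 0)))
            (≡.trans (≡.cong (λ y → e 0 ℤ.* e 2 ℤ.+ (e 1 ℤ.* e 3 ℤ.+ (e 2 ℤ.* e 4 ℤ.+ (e 3 ℤ.* y ℤ.+ ℤ.0ℤ)))) (≡.sym (e-periodic 1)))
            (≡.trans (e-correlation 0 2 ℕ.z<s (ℕ.s<s (ℕ.s<s ℕ.z<s))) (≡.cong (λ x → ℤ.0ℤ ℤ.* x ℤ.- pos m) q≡))))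
          e₀-odd

        %8⇒ℤ : ∀ r → Q % 8 ≡ r → pos Q ≡ pos 8 ℤ.* pos (Q / 8) ℤ.+ pos r
        %8⇒ℤ r Q%8≡r = ≡.trans (≡.cong pos (≡.trans (m≡m%n+[m/n]*n Q 8)
            (≡.trans (≡.cong (ℕ._+ Q / 8 ℕ.* 8) Q%8≡r) (≡.trans (ℕ.+-comm r (Q / 8 ℕ.* 8)) (≡.cong (ℕ._+ r) (ℕ.*-comm (Q / 8) 8))))))
          (≡.trans (ℤ.pos-+ (8 ℕ.* (Q / 8)) r) (≡.cong (λ x → x ℤ.+ pos r) (ℤ.pos-* 8 (Q / 8))))

        η+η : ∀ i j → e i ℤ.+ e j ≡ ℤ.- pos H → η i + η j ≈ - ι (pos H)
        η+η i j eq = trans (+-cong (η≈ι i) (η≈ι j)) (trans (sym (ι-+ (e i) (e j)))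
          (trans (reflexive (≡.cong ι eq)) (ι-neg (pos H))))

        η-% : ∀ l j r → l % 4 ≡ r → η (l ℕ.+ j) ≈ η (r ℕ.+ j)
        η-% l j r l%4≡r = trans (reflexive (≡.cong η (≡.trans (≡.cong (ℕ._+ j) (≡.trans (m≡m%n+[m/n]*n l 4) (≡.cong (ℕ._+ l / 4 ℕ.* 4) l%4≡r)))
          (arith r (l / 4) j)))) (η-shift (l / 4) (r ℕ.+ j))
          where
          arith : ∀ r a j → r ℕ.+ a ℕ.* 4 ℕ.+ j ≡ a ℕ.* 4 ℕ.+ (r ℕ.+ j)
          arith = solve-∀

        -- A factor in C₁ moves the classes 1, 2 to 2, 3, and η₁ = η₃ keeps the sum. Thus the value
        -- is the same for all differences of clique elements.
        η-pair₁₂ : Q % 8 ≡ 7 → ∀ l → l % 4 ≡ 0 ⊎ l % 4 ≡ 1 → η (l ℕ.+ 1) + η (l ℕ.+ 2) ≈ - ι (pos H)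
        η-pair₁₂ Q%8≡7 l (inj₁ l%4≡0) = trans (+-cong (η-% l 1 0 l%4≡0) (η-% l 2 0 l%4≡0))
          (η+η 1 2 (Values.e₁+e₂≡-H (pos H) 1+Q≡2H (pos (Q / 8)) (%8⇒ℤ 7 Q%8≡7)))
        η-pair₁₂ Q%8≡7 l (inj₂ l%4≡1) = trans (+-cong (η-% l 1 1 l%4≡1) (trans (η-% l 2 1 l%4≡1) (sym η₁≈η₃)))
          (trans (+-comm (η 2) (η 1)) (η+η 1 2 (Values.e₁+e₂≡-H (pos H) 1+Q≡2H (pos (Q / 8)) (%8⇒ℤ 7 Q%8≡7))))

        η₀+η₁ : Q % 8 ≡ 3 ⊎ Q % 8 ≡ 1 → η 0 + η 1 ≈ - ι (pos H)
        η₀+η₁ Q%8 = η+η 0 1 (Values.e₀+e₁≡-H (pos H) 1+Q≡2H (pos (Q / 8)) (residues Q%8))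
          where
          residues : Q % 8 ≡ 3 ⊎ Q % 8 ≡ 1 → pos Q ≡ pos 8 ℤ.* pos (Q / 8) ℤ.+ pos 3 ⊎ pos Q ≡ pos 8 ℤ.* pos (Q / 8) ℤ.+ pos 1
          residues (inj₁ eq) = inj₁ (%8⇒ℤ 3 eq)
          residues (inj₂ eq) = inj₂ (%8⇒ℤ 1 eq)

        -- Likewise a factor in C₁ moves the classes 0, 3 to 1, 0.
        η-pair₀₃ : Q % 8 ≡ 3 ⊎ Q % 8 ≡ 1 → ∀ l → l % 4 ≡ 0 ⊎ l % 4 ≡ 1 → η (l ℕ.+ 0) + η (l ℕ.+ 3) ≈ - ι (pos H)
        η-pair₀₃ Q%8 l (inj₁ l%4≡0) = trans (+-cong (η-% l 0 0 l%4≡0) (trans (η-% l 3 0 l%4≡0) (sym η₁≈η₃))) (η₀+η₁ Q%8)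
        η-pair₀₃ Q%8 l (inj₂ l%4≡1) = trans (+-cong (η-% l 0 1 l%4≡1) (trans (η-% l 3 1 l%4≡1) (η-shift 1 0)))
          (trans (+-comm (η 1) (η 0)) (η₀+η₁ Q%8))

        Case₁ Case₂ : Set
        Case₁ = p % 8 ≡ 7 × s % 2 ≡ 1
        Case₂ = p % 8 ≡ 3 ⊎ s % 2 ≡ 0

        cases : Case₁ ⊎ Case₂
        cases = decide p%8≡3⊎7 (%2-cases s)
          where
          decide : p % 8 ≡ 3 ⊎ p % 8 ≡ 7 → s % 2 ≡ 0 ⊎ s % 2 ≡ 1 → Case₁ ⊎ Case₂
          decide (inj₁ p%8≡3) _             = inj₂ (inj₁ p%8≡3)
          decide (inj₂ _)     (inj₁ s%2≡0)  = inj₂ (inj₂ s%2≡0)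
          decide (inj₂ p%8≡7) (inj₂ s%2≡1)  = inj₁ (p%8≡7 , s%2≡1)

        Q%8-case₁ : Case₁ → Q % 8 ≡ 7
        Q%8-case₁ (p%8≡7 , s%2≡1) = ≡.trans (s%2≡1⇒p^s%8≡p%8 s s%2≡1) p%8≡7

        Q%8-case₂ : Case₂ → Q % 8 ≡ 3 ⊎ Q % 8 ≡ 1
        Q%8-case₂ (inj₂ s%2≡0) = inj₂ (s%2≡0⇒p^s%8≡1 s s%2≡0)
        Q%8-case₂ (inj₁ p%8≡3) = decide (%2-cases s)
          where
          decide : s % 2 ≡ 0 ⊎ s % 2 ≡ 1 → Q % 8 ≡ 3 ⊎ Q % 8 ≡ 1
          decide (inj₁ s%2≡0) = inj₂ (s%2≡0⇒p^s%8≡1 s s%2≡0)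
          decide (inj₂ s%2≡1) = inj₁ (≡.trans (s%2≡1⇒p^s%8≡p%8 s s%2≡1) p%8≡3)

        module Clique₁ (case₁ : Case₁) = Clique α-differences 1 2 H Q 2m+H≡QH (η-pair₁₂ (Q%8-case₁ case₁))
        module Clique₂ (case₂ : Case₂) = Clique α-differences 0 3 H Q 2m+H≡QH (η-pair₀₃ (Q%8-case₂ case₂))

        [q-1]/4≡m : (p ℕ.^ N ℕ.∸ 1) / 4 ≡ m
        [q-1]/4≡m = ≡.trans (≡.cong (λ x → (x ℕ.∸ 1) / 4) q≡1+4m) (m*n/n≡m m 4)

        -- B⟨ j ⟩ uses the exponents 4k + j with 1 ≤ k ≤ m instead of 0 ≤ k < m.
        on-B⟨⟩ : ∀ j → (∀ i → i ℕ.< m → S (g F.^ (i ℕ.* 4 ℕ.+ j)) ≈ 0#) → ∀ x → B⟨_⟩ F j g x → S x ≈ 0#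
        on-B⟨⟩ j S≈0 x (k , 1≤k , k≤[q-1]/4 , x≈) = trans (S-cong (F.trans x≈ (T.^-congʳ g (≡.cong (ℕ._+ j) (ℕ.*-comm 4 k)))))
          (decide (ℕ.m≤n⇒m<n∨m≡n (≡.subst (k ℕ.≤_) [q-1]/4≡m k≤[q-1]/4)))
          where
          decide : k ℕ.< m ⊎ k ≡ m → S (g F.^ (k ℕ.* 4 ℕ.+ j)) ≈ 0#
          decide (inj₁ k<m)    = S≈0 k k<m
          decide (inj₂ ≡.refl) = trans (S-cong (T.g^[n+k]≈g^k j)) (S≈0 0 (ℕ.≤-trans (ℕ.s≤s ℕ.z≤n) (ℕ.n≢0⇒n>0 (ℕ.≢-nonZero⁻¹ m))))

        from-B⟨⟩ : ∀ j → (∀ x → B⟨_⟩ F j g x → S x ≈ 0#) → ∀ i → i ℕ.< m → S (g F.^ (i ℕ.* 4 ℕ.+ j)) ≈ 0#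
        -- The index 0 corresponds to k = m in `B⟨ j ⟩`, as g ^ (4m) = 1.
        from-B⟨⟩ j S≈0 zero    0<m = trans (S-cong (F.sym (T.g^[n+k]≈g^k j)))
          (S≈0 _ (m , 0<m , ℕ.≤-reflexive (≡.sym [q-1]/4≡m) , T.^-congʳ g (≡.cong (ℕ._+ j) (ℕ.*-comm m 4))))
        from-B⟨⟩ j S≈0 (suc i) i<m =
          S≈0 _ (suc i , ℕ.z<s , ≡.subst (suc i ℕ.≤_) (≡.sym [q-1]/4≡m) (ℕ.<⇒≤ i<m) , T.^-congʳ g (≡.cong (ℕ._+ j) (ℕ.*-comm (suc i) 4)))

      -- For M = 0 the sums are empty and vanish although Q > 0; the factor M of `blocks-value` has
      -- to be cancelled.
      clique-equality : M ≢ 0 → M ≡ Q ⇔ (∀ x → B F p s g x → S x ≈ 0#)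
      clique-equality M≢0 = mk⇔ necessary (sufficient cases)
        where
        instance
          M-nonZero : ℕ.NonZero M
          M-nonZero = ℕ.≢-nonZero M≢0
        necessary : M ≡ Q → ∀ x → B F p s g x → S x ≈ 0#
        necessary M≡Q x (inj₁ (case₁ , inj₁ x∈B₁)) = on-B⟨⟩ 1 (λ i i<m → Clique₁.M≡Q⇒vanishing case₁ M≡Q i 1 i<m (inj₁ ≡.refl)) x x∈B₁
        necessary M≡Q x (inj₁ (case₁ , inj₂ x∈B₂)) = on-B⟨⟩ 2 (λ i i<m → Clique₁.M≡Q⇒vanishing case₁ M≡Q i 2 i<m (inj₂ ≡.refl)) x x∈B₂
        necessary M≡Q x (inj₂ (case₂ , inj₁ x∈B₀)) = on-B⟨⟩ 0 (λ i i<m → Clique₂.M≡Q⇒vanishing case₂ M≡Q i 0 i<m (inj₁ ≡.refl)) x x∈B₀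
        necessary M≡Q x (inj₂ (case₂ , inj₂ x∈B₃)) = on-B⟨⟩ 3 (λ i i<m → Clique₂.M≡Q⇒vanishing case₂ M≡Q i 3 i<m (inj₂ ≡.refl)) x x∈B₃
        -- `necessary` finds the side condition on p and s in the membership of x; here it is
        -- supplied by the decision `cases`.
        sufficient : Case₁ ⊎ Case₂ → (∀ x → B F p s g x → S x ≈ 0#) → M ≡ Q
        sufficient (inj₁ case₁) S≈0 = Clique₁.vanishing⇒M≡Q case₁ vanishing
          where
          vanishing : ∀ i j → i ℕ.< m → j ≡ 1 ⊎ j ≡ 2 → S (g F.^ (i ℕ.* 4 ℕ.+ j)) ≈ 0#
          vanishing i j i<m (inj₁ ≡.refl) = from-B⟨⟩ 1 (λ x x∈ → S≈0 x (inj₁ (case₁ , inj₁ x∈))) i i<m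
          vanishing i j i<m (inj₂ ≡.refl) = from-B⟨⟩ 2 (λ x x∈ → S≈0 x (inj₁ (case₁ , inj₂ x∈))) i i<m
        sufficient (inj₂ case₂) S≈0 = Clique₂.vanishing⇒M≡Q case₂ vanishing
          where
          vanishing : ∀ i j → i ℕ.< m → j ≡ 0 ⊎ j ≡ 3 → S (g F.^ (i ℕ.* 4 ℕ.+ j)) ≈ 0#
          vanishing i j i<m (inj₁ ≡.refl) = from-B⟨⟩ 0 (λ x x∈ → S≈0 x (inj₂ (case₂ , inj₁ x∈))) i i<m
          vanishing i j i<m (inj₂ ≡.refl) = from-B⟨⟩ 3 (λ x x∈ → S≈0 x (inj₂ (case₂ , inj₂ x∈))) i i<m

-- From duplicate-free lists to injective families

all-lookup : ∀ {a b} {A : Set a} {P : A → Set b} {xs : List A} → All P xs → ∀ i → P (lookup xs i)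
all-lookup (px All.∷ _)   zero    = px
all-lookup (_  All.∷ pxs) (suc i) = all-lookup pxs i

lookup-distinct : ∀ {c ℓ q} (F : FiniteField c ℓ q) (xs : List (FiniteField.Carrier F)) → IsFiniteSet F xs →
                  ∀ i j → FiniteField._≈_ F (lookup xs i) (lookup xs j) → i ≡ j
lookup-distinct F (x ∷ xs) (x∉ ∷ u) zero    zero    eq = ≡.refl
lookup-distinct F (x ∷ xs) (x∉ ∷ u) zero    (suc j) eq = contradiction eq (all-lookup x∉ j)
lookup-distinct F (x ∷ xs) (x∉ ∷ u) (suc i) zero    eq = contradiction (FiniteField.sym F eq) (all-lookup x∉ i)
lookup-distinct F (x ∷ xs) (x∉ ∷ u) (suc i) (suc j) eq = ≡.cong suc (lookup-distinct F xs u i j eq)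

length≢0 : ∀ {a} {A : Set a} {xs : List A} → xs ≢ [] → length xs ≢ 0
length≢0 {xs = []}    xs≢[] _ = xs≢[] ≡.refl
length≢0 {xs = _ ∷ _} _     ()

open import Data.Nat.Base using (_*_; _^_; _≤_)

theorem1p11 : ∀ {c ℓ c′ ℓ′ : Level} (p s : ℕ) → Prime p → p % 4 ≡ 3 → 1 ≤ s →
    (F : FiniteField c ℓ (p ^ (2 * s))) →
    (g : FiniteField.Carrier F) → IsPrimitiveRoot F g →
    (A : List (FiniteField.Carrier F)) → IsFiniteSet F A → IsPeisertClique F g A →
    length A ≤ p ^ s
    × (A ≢ [] → (K : Char0DomainWithRoot c′ ℓ′ p) →
    length A ≡ p ^ s
    ⇔ (∀ b → B F p s g b →
    Char0DomainWithRoot._≈_ K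
    (exponentialSum F p K (2 * s) A b)
    (Char0DomainWithRoot.0# K)))
theorem1p11 p s p-prime p%4≡3 1≤s F g primitive-root A A-unique A-clique =
  Clique.clique-bound α differences distinct , λ A≢[] K →
    let module K = Char0DomainWithRoot K
        -- The right-hand side left to unification is `S b` for the family `lookup A`, with `ψ`
        -- unfolded.
        sum≡S : ∀ b → exponentialSum F p K (2 ℕ.* s) A b ≡ _
        sum≡S b = FiniteSums.foldr-map≡sum K.commutativeSemiring (λ a → eₚ F p K (Tr F p (2 ℕ.* s) (a F.* b))) A
        equality = Clique.clique-equality α differences distinct K (length≢0 A≢[])
    in mk⇔ (λ eq b b∈B → K.trans (K.reflexive (sum≡S b)) (Equivalence.to equality eq b b∈B))
           (λ sum≈0 → Equivalence.from equality (λ b b∈B → K.trans (K.sym (K.reflexive (sum≡S b))) (sum≈0 b b∈B)))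
  where
  module F = FiniteField F
  module Clique = PeisertClique p s p-prime p%4≡3 1≤s F g primitive-root
  α : Fin (length A) → F.Carrier
  α = lookup A
  distinct : ∀ i j → α i F.≈ α j → i ≡ j
  distinct = lookup-distinct F A A-unique
  differences : ∀ i j → i ≢ j → ∃[ l ] ((l % 4 ≡ 0 ⊎ l % 4 ≡ 1) × α i F.- α j F.≈ g F.^ l)
  differences i j i≢j = proj₂ (A-clique (α i) (α j) (∈-lookup F.≈-setoid A i) (∈-lookup F.≈-setoid A j) (i≢j ∘ distinct i j))
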